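{- Let $n \ge 6$ be an integer. For any graph $G \in \mathcal{U}_{n,2}$, we have $\rho(G) \ge \rho\left(G_1\left(\lfloor \frac{n-4}{2} \rfloor, \lceil \frac{n-4}{2} \rceil\right)\right)$, and equality holds if and only if $G \cong G_1\left(\left\lfloor \frac{n-4}{2} \right\rfloor, \left\lceil \frac{n-4}{2} \right\rceil\right)$.
   Context: All graphs are finite and simple. $\rho(G)$ denotes the spectral radius of $G$, i.e. the maximum absolute value of an eigenvalue of its adjacency matrix. A unicyclic graph is a connected graph containing exactly one cycle. The matching number $\gamma(G)$ is the maximum number of pairwise disjoint edges of $G$. $\mathcal{U}_{n,\gamma}$ is the class of all connected unicyclic graphs on $n$ vertices with matching number $\gamma$. A pendant vertex is a vertex of degree one; "attaching $m$ pendant vertices to a vertex $v$" means adding $m$ new vertices, each adjacent only to $v$. For nonnegative integers $a,b$, $G_1(a,b)$ is the graph obtained from the $4$-cycle $[v_1,v_2,v_3,v_4,v_1]$ by attaching $a$ pendant vertices to $v_2$ and $b$ pendant vertices to $v_4$. $\cong$ denotes graph isomorphism. -}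

module Defs where

open import Data.Bool using (Bool; true; false; if_then_else_)
open import Data.Bool.Properties using () renaming (_≟_ to _≟ᵇ_)
open import Data.Fin using (Fin; splitAt; _↑ˡ_; _≟_)
open import Data.Fin.Patterns using (0F; 1F; 2F; 3F)
open import Data.Fin.Properties using (all?)
open import Data.List using (List; []; _∷_; _∷ʳ_; length; zip)
open import Data.List.Membership.Propositional using (_∈_)
open import Data.List.Relation.Unary.All using (All)
open import Data.List.Relation.Unary.AllPairs using (AllPairs)
open import Data.List.Relation.Unary.Unique.Propositional using (Unique)
open import Data.Nat using (ℕ; _⊔_) renaming (_+_ to _+ᴺ_; _≤_ to _≤ᴺ_)
import Data.Nat.Properties as ℕₚ
open import Data.Product using (∃; Σ-syntax; ∃-syntax; _×_; _,_; uncurry)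
open import Data.Rational as ℚ using (ℚ; 0ℚ; 1ℚ; ½)
import Data.Rational.Properties as ℚₚ
import Data.Rational.Solver as ℚSolver
open import Data.Sum using (_⊎_; inj₁; inj₂)
import Data.Vec.Functional as V
open import Function.Bundles using (_↔_; _⇔_; module Inverse)
open import Relation.Binary.Construct.Closure.ReflexiveTransitive using (Star)
open import Relation.Binary.PropositionalEquality
  using (_≡_; _≢_; refl; sym; trans; cong; subst)
open import Relation.Nullary using (¬_)
open import Relation.Nullary.Decidable using (does; from-yes)

------------------------------------------------------------------------
-- Real numbers: Cauchy sequences of rationals, compared by the setoid
-- equality _≈_. All operations are pointwise.

IsCauchy : (ℕ → ℚ) → Set
IsCauchy x = ∀ ε → 0ℚ ℚ.< ε →
  ∃[ N ] ∀ m n → N ≤ᴺ m → N ≤ᴺ n → ℚ.∣ x m ℚ.- x n ∣ ℚ.< ε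

record ℝ : Set where
  constructor mkℝ
  field
    seq    : ℕ → ℚ
    cauchy : IsCauchy seq

open ℝ public

infix 4 _≈_ _≤_

_≈_ : ℝ → ℝ → Set
x ≈ y = ∀ ε → 0ℚ ℚ.< ε → ∃[ N ] ∀ n → N ≤ᴺ n → ℚ.∣ seq x n ℚ.- seq y n ∣ ℚ.< ε

_≤_ : ℝ → ℝ → Set
x ≤ y = ∀ ε → 0ℚ ℚ.< ε → ∃[ N ] ∀ n → N ≤ᴺ n → seq x n ℚ.< seq y n ℚ.+ ε

fromℚ : ℚ → ℝ
fromℚ q = mkℝ (λ _ → q) λ ε 0<ε → 0 , λ _ _ _ _ →
  subst (λ t → ℚ.∣ t ∣ ℚ.< ε) (sym (ℚₚ.+-inverseʳ q)) 0<ε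

0ℝ 1ℝ : ℝ
0ℝ = fromℚ 0ℚ
1ℝ = fromℚ 1ℚ

private
  open ℚSolver.+-*-Solver

  q+[p-q]≡p : ∀ p q → q ℚ.+ (p ℚ.- q) ≡ p
  q+[p-q]≡p = solve 2 (λ p q → q :+ (p :- q) := p) refl

  b+c-b≡c : ∀ b c → b ℚ.+ c ℚ.- b ≡ c
  b+c-b≡c = solve 2 (λ b c → b :+ c :- b := c) refl

  -[p-q]≡q-p : ∀ p q → ℚ.- (p ℚ.- q) ≡ q ℚ.- p
  -[p-q]≡q-p = solve 2 (λ p q → :- (p :- q) := q :- p) refl

  sum-difference : ∀ a b c d →
    (a ℚ.+ b) ℚ.- (c ℚ.+ d) ≡ (a ℚ.- c) ℚ.+ (b ℚ.- d)
  sum-difference =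
    solve 4 (λ a b c d → (a :+ b) :- (c :+ d) := (a :- c) :+ (b :- d)) refl

  product-difference : ∀ a b c d →
    a ℚ.* b ℚ.- c ℚ.* d ≡ a ℚ.* (b ℚ.- d) ℚ.+ d ℚ.* (a ℚ.- c)
  product-difference =
    solve 4 (λ a b c d → a :* b :- c :* d := a :* (b :- d) :+ d :* (a :- c)) refl

  half : ∀ ε → 0ℚ ℚ.< ε → ∃[ η ] 0ℚ ℚ.< η × η ℚ.+ η ≡ ε
  half ε 0<ε = ½ ℚ.* ε
    , subst (ℚ._< ½ ℚ.* ε) (ℚₚ.*-zeroʳ ½) (ℚₚ.*-monoʳ-<-pos ½ 0<ε)
    , trans (sym (ℚₚ.*-distribʳ-+ ε ½ ½)) (ℚₚ.*-identityˡ ε)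

  ≤⊔ˡ : ∀ {a b k} → a ⊔ b ≤ᴺ k → a ≤ᴺ k
  ≤⊔ˡ {a} {b} = ℕₚ.≤-trans (ℕₚ.m≤m⊔n a b)

  ≤⊔ʳ : ∀ {a b k} → a ⊔ b ≤ᴺ k → b ≤ᴺ k
  ≤⊔ʳ {a} {b} = ℕₚ.≤-trans (ℕₚ.m≤n⊔m a b)

  ∣p∣≤∣q∣+∣p-q∣ : ∀ p q → ℚ.∣ p ∣ ℚ.≤ ℚ.∣ q ∣ ℚ.+ ℚ.∣ p ℚ.- q ∣
  ∣p∣≤∣q∣+∣p-q∣ p q = subst (λ t → ℚ.∣ t ∣ ℚ.≤ ℚ.∣ q ∣ ℚ.+ ℚ.∣ p ℚ.- q ∣)
    (q+[p-q]≡p p q)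
    (ℚₚ.∣p+q∣≤∣p∣+∣q∣ q (p ℚ.- q))

  ∣p∣-∣q∣≤∣p-q∣ : ∀ p q → ℚ.∣ p ∣ ℚ.- ℚ.∣ q ∣ ℚ.≤ ℚ.∣ p ℚ.- q ∣
  ∣p∣-∣q∣≤∣p-q∣ p q = subst (ℚ.∣ p ∣ ℚ.- ℚ.∣ q ∣ ℚ.≤_)
    (b+c-b≡c ℚ.∣ q ∣ ℚ.∣ p ℚ.- q ∣)
    (ℚₚ.+-monoˡ-≤ (ℚ.- ℚ.∣ q ∣) (∣p∣≤∣q∣+∣p-q∣ p q))

  ∣p-q∣≡∣q-p∣ : ∀ p q → ℚ.∣ p ℚ.- q ∣ ≡ ℚ.∣ q ℚ.- p ∣
  ∣p-q∣≡∣q-p∣ p q = trans (sym (ℚₚ.∣-p∣≡∣p∣ (p ℚ.- q)))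
    (cong ℚ.∣_∣ (-[p-q]≡q-p p q))

  ∣∣p∣-∣q∣∣≤∣p-q∣ : ∀ p q → ℚ.∣ ℚ.∣ p ∣ ℚ.- ℚ.∣ q ∣ ∣ ℚ.≤ ℚ.∣ p ℚ.- q ∣
  ∣∣p∣-∣q∣∣≤∣p-q∣ p q with ℚₚ.∣p∣≡p∨∣p∣≡-p (ℚ.∣ p ∣ ℚ.- ℚ.∣ q ∣)
  ... | inj₁ eq = subst (ℚ._≤ ℚ.∣ p ℚ.- q ∣) (sym eq) (∣p∣-∣q∣≤∣p-q∣ p q)
  ... | inj₂ eq = subst (ℚ._≤ ℚ.∣ p ℚ.- q ∣)
    (sym (trans eq (-[p-q]≡q-p ℚ.∣ p ∣ ℚ.∣ q ∣)))
    (subst (ℚ.∣ q ∣ ℚ.- ℚ.∣ p ∣ ℚ.≤_) (∣p-q∣≡∣q-p∣ q p) (∣p∣-∣q∣≤∣p-q∣ q p))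

  EventuallyBounded : (ℕ → ℚ) → ℚ → ℕ → Set
  EventuallyBounded x B N = ∀ n → N ≤ᴺ n → ℚ.∣ x n ∣ ℚ.≤ B

  bounded : ∀ x → IsCauchy x → ∃[ B ] ∃[ N ] 0ℚ ℚ.≤ B × EventuallyBounded x B N
  bounded x cx with cx 1ℚ (ℚₚ.positive⁻¹ 1ℚ)
  ... | N , h = ℚ.∣ x N ∣ ℚ.+ 1ℚ , N
    , ℚₚ.+-mono-≤ (ℚₚ.0≤∣p∣ (x N)) (ℚₚ.<⇒≤ (ℚₚ.positive⁻¹ 1ℚ))
    , λ n N≤n → ℚₚ.≤-trans (∣p∣≤∣q∣+∣p-q∣ (x n) (x N))
        (ℚₚ.+-monoʳ-≤ ℚ.∣ x N ∣ (ℚₚ.<⇒≤ (h n N N≤n ℕₚ.≤-refl)))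

  sum-close : ∀ {η ε} a b c d → η ℚ.+ η ≡ ε →
    ℚ.∣ a ℚ.- c ∣ ℚ.< η → ℚ.∣ b ℚ.- d ∣ ℚ.< η →
    ℚ.∣ (a ℚ.+ b) ℚ.- (c ℚ.+ d) ∣ ℚ.< ε
  sum-close {η} {ε} a b c d η+η≡ε a~c b~d = let open ℚₚ.≤-Reasoning in begin-strict
    ℚ.∣ (a ℚ.+ b) ℚ.- (c ℚ.+ d) ∣       ≡⟨ cong ℚ.∣_∣ (sum-difference a b c d) ⟩
    ℚ.∣ (a ℚ.- c) ℚ.+ (b ℚ.- d) ∣       ≤⟨ ℚₚ.∣p+q∣≤∣p∣+∣q∣ (a ℚ.- c) (b ℚ.- d) ⟩
    ℚ.∣ a ℚ.- c ∣ ℚ.+ ℚ.∣ b ℚ.- d ∣     <⟨ ℚₚ.+-mono-< a~c b~d ⟩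
    η ℚ.+ η                             ≡⟨ η+η≡ε ⟩
    ε                                   ∎

  abstract
    +-cauchy : ∀ {x y} → IsCauchy x → IsCauchy y → IsCauchy (λ n → x n ℚ.+ y n)
    +-cauchy {x} {y} cx cy ε 0<ε =
      let η , 0<η , η+η≡ε = half ε 0<ε
          M , hx = cx η 0<η
          N , hy = cy η 0<η
      in M ⊔ N , λ m n p q → sum-close (x m) (y m) (x n) (y n) η+η≡ε
           (hx m n (≤⊔ˡ p) (≤⊔ˡ q)) (hy m n (≤⊔ʳ {M} p) (≤⊔ʳ {M} q))

  quotient : ∀ c ε → 0ℚ ℚ.< c → 0ℚ ℚ.< ε → ∃[ δ ] 0ℚ ℚ.< δ × c ℚ.* δ ≡ ε
  quotient c ε 0<c 0<ε = c⁻¹ ℚ.* ε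
    , subst (ℚ._< c⁻¹ ℚ.* ε) (ℚₚ.*-zeroʳ c⁻¹)
        (ℚₚ.*-monoʳ-<-pos c⁻¹ {{ℚₚ.1/pos⇒pos c {{ℚ.positive 0<c}}}} 0<ε)
    , trans (sym (ℚₚ.*-assoc c c⁻¹ ε))
        (trans (cong (ℚ._* ε) (ℚₚ.*-inverseʳ c {{c≢0}})) (ℚₚ.*-identityˡ ε))
    where
    c≢0 = ℚₚ.pos⇒nonZero c {{ℚ.positive 0<c}}
    c⁻¹ = ℚ.1/_ c {{c≢0}}

  product-bound : ∀ {B δ ε} a b → 0ℚ ℚ.≤ B → B ℚ.* δ ℚ.< ε →
    ℚ.∣ a ∣ ℚ.≤ B → ℚ.∣ b ∣ ℚ.< δ → ℚ.∣ a ℚ.* b ∣ ℚ.< ε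
  product-bound {B} {δ} {ε} a b 0≤B Bδ<ε a≤B b<δ = let open ℚₚ.≤-Reasoning in begin-strict
    ℚ.∣ a ℚ.* b ∣         ≡⟨ ℚₚ.∣p*q∣≡∣p∣*∣q∣ a b ⟩
    ℚ.∣ a ∣ ℚ.* ℚ.∣ b ∣   ≤⟨ ℚₚ.*-monoʳ-≤-nonNeg ℚ.∣ b ∣ {{ℚₚ.∣-∣-nonNeg b}} a≤B ⟩
    B ℚ.* ℚ.∣ b ∣         ≤⟨ ℚₚ.*-monoˡ-≤-nonNeg B {{ℚ.nonNegative 0≤B}} (ℚₚ.<⇒≤ b<δ) ⟩
    B ℚ.* δ               <⟨ Bδ<ε ⟩
    ε                     ∎

  p<p+1 : ∀ p → p ℚ.< p ℚ.+ 1ℚ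
  p<p+1 p = subst (ℚ._< p ℚ.+ 1ℚ) (ℚₚ.+-identityʳ p)
    (ℚₚ.+-monoʳ-< p (ℚₚ.positive⁻¹ 1ℚ))

  tolerance : ∀ B ε → 0ℚ ℚ.≤ B → 0ℚ ℚ.< ε → ∃[ δ ] 0ℚ ℚ.< δ × B ℚ.* δ ℚ.< ε
  tolerance B ε 0≤B 0<ε
    with quotient (B ℚ.+ 1ℚ) ε (ℚₚ.≤-<-trans 0≤B (p<p+1 B)) 0<ε
  ... | δ , 0<δ , eq = δ , 0<δ
    , subst (B ℚ.* δ ℚ.<_) eq (ℚₚ.*-monoˡ-<-pos δ {{ℚ.positive 0<δ}} (p<p+1 B))

  ≤-⊔ˡ : ∀ {p q r} → r ℚ.≤ p → r ℚ.≤ p ℚ.⊔ q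
  ≤-⊔ˡ {p} {q} r≤p = ℚₚ.≤-trans r≤p (ℚₚ.p≤p⊔q p q)

  ≤-⊔ʳ : ∀ {p q r} → r ℚ.≤ q → r ℚ.≤ p ℚ.⊔ q
  ≤-⊔ʳ {p} {q} r≤q = ℚₚ.≤-trans r≤q (ℚₚ.p≤q⊔p p q)

  product-close : ∀ {B δ η ε} a b c d → 0ℚ ℚ.≤ B → B ℚ.* δ ℚ.< η → η ℚ.+ η ≡ ε →
    ℚ.∣ a ∣ ℚ.≤ B → ℚ.∣ d ∣ ℚ.≤ B →
    ℚ.∣ a ℚ.- c ∣ ℚ.< δ → ℚ.∣ b ℚ.- d ∣ ℚ.< δ →
    ℚ.∣ a ℚ.* b ℚ.- c ℚ.* d ∣ ℚ.< ε
  product-close {B} {δ} {η} {ε} a b c d 0≤B Bδ<η η+η≡ε a≤B d≤B a~c b~d =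
    let open ℚₚ.≤-Reasoning in begin-strict
    ℚ.∣ a ℚ.* b ℚ.- c ℚ.* d ∣
      ≡⟨ cong ℚ.∣_∣ (product-difference a b c d) ⟩
    ℚ.∣ a ℚ.* (b ℚ.- d) ℚ.+ d ℚ.* (a ℚ.- c) ∣
      ≤⟨ ℚₚ.∣p+q∣≤∣p∣+∣q∣ (a ℚ.* (b ℚ.- d)) (d ℚ.* (a ℚ.- c)) ⟩
    ℚ.∣ a ℚ.* (b ℚ.- d) ∣ ℚ.+ ℚ.∣ d ℚ.* (a ℚ.- c) ∣
      <⟨ ℚₚ.+-mono-< (product-bound a (b ℚ.- d) 0≤B Bδ<η a≤B b~d)
                     (product-bound d (a ℚ.- c) 0≤B Bδ<η d≤B a~c) ⟩
    η ℚ.+ η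
      ≡⟨ η+η≡ε ⟩
    ε ∎

  abstract
    *-cauchy : ∀ {x y} → IsCauchy x → IsCauchy y → IsCauchy (λ n → x n ℚ.* y n)
    *-cauchy {x} {y} cx cy ε 0<ε =
      let B₁ , K , 0≤B₁ , bx = bounded x cx
          B₂ , L , 0≤B₂ , by = bounded y cy
          0≤B = ≤-⊔ˡ {B₁} {B₂} 0≤B₁
          η , 0<η , η+η≡ε = half ε 0<ε
          δ , 0<δ , Bδ<η = tolerance (B₁ ℚ.⊔ B₂) η 0≤B 0<η
          M , hx = cx δ 0<δ
          N , hy = cy δ 0<δ
      in (K ⊔ L) ⊔ (M ⊔ N) , λ m n p q →
           product-close (x m) (y m) (x n) (y n) 0≤B Bδ<η η+η≡ε
             (≤-⊔ˡ {B₁} (bx m (≤⊔ˡ {K} (≤⊔ˡ {K ⊔ L} p))))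
             (≤-⊔ʳ {B₁} (by n (≤⊔ʳ {K} (≤⊔ˡ {K ⊔ L} q))))
             (hx m n (≤⊔ˡ {M} (≤⊔ʳ {K ⊔ L} p)) (≤⊔ˡ {M} (≤⊔ʳ {K ⊔ L} q)))
             (hy m n (≤⊔ʳ {M} (≤⊔ʳ {K ⊔ L} p)) (≤⊔ʳ {M} (≤⊔ʳ {K ⊔ L} q)))

  abstract
    ∣∣-cauchy : ∀ {x} → IsCauchy x → IsCauchy (λ n → ℚ.∣ x n ∣)
    ∣∣-cauchy {x} cx ε 0<ε = let N , h = cx ε 0<ε in N , λ m n p q →
      ℚₚ.≤-<-trans (∣∣p∣-∣q∣∣≤∣p-q∣ (x m) (x n)) (h m n p q)

infixl 6 _+_
infixl 7 _*_

_+_ : ℝ → ℝ → ℝ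
x + y = mkℝ (λ n → seq x n ℚ.+ seq y n)
            (+-cauchy {seq x} {seq y} (cauchy x) (cauchy y))

_*_ : ℝ → ℝ → ℝ
x * y = mkℝ (λ n → seq x n ℚ.* seq y n)
            (*-cauchy {seq x} {seq y} (cauchy x) (cauchy y))

∣_∣ : ℝ → ℝ
∣ x ∣ = mkℝ (λ n → ℚ.∣ seq x n ∣) (∣∣-cauchy {seq x} (cauchy x))

------------------------------------------------------------------------
-- Finite simple graphs

record Graph (n : ℕ) : Set where
  field
    adj    : Fin n → Fin n → Bool
    symm   : ∀ u v → adj u v ≡ adj v u
    irrefl : ∀ u → adj u u ≡ false

  Adj : Fin n → Fin n → Set
  Adj u v = adj u v ≡ true

open Graph public using (adj; Adj)

infix 4 _≅_

record _≅_ {m n} (G : Graph m) (H : Graph n) : Set where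
  field
    vertices  : Fin m ↔ Fin n
    preserves : ∀ u v → adj G u v ≡ adj H (Inverse.to vertices u) (Inverse.to vertices v)

Connected : ∀ {n} → Graph n → Set
Connected G = ∀ u v → Star (Adj G) u v

-- The steps of the closed walk v, v₁, …, vₖ, v for vs = [v₁, …, vₖ].
closedWalkSteps : ∀ {n} → Fin n → List (Fin n) → List (Fin n × Fin n)
closedWalkSteps v vs = zip (v ∷ vs) (vs ∷ʳ v)

record Cycle {n} (G : Graph n) : Set where
  field
    start    : Fin n
    rest     : List (Fin n)
    length≥3 : 3 ≤ᴺ length (start ∷ rest)
    distinct : Unique (start ∷ rest)

  steps : List (Fin n × Fin n)
  steps = closedWalkSteps start rest

  field
    adjacent : All (uncurry (Adj G)) steps

  HasEdge : Fin n → Fin n → Set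
  HasEdge u v = (u , v) ∈ steps ⊎ (v , u) ∈ steps

-- Cycles are subgraphs: the starting vertex and the direction of
-- traversal are irrelevant, only the edge set counts.
SameCycle : ∀ {n} {G : Graph n} → Cycle G → Cycle G → Set
SameCycle c d = ∀ u v → Cycle.HasEdge c u v ⇔ Cycle.HasEdge d u v

Unicyclic : ∀ {n} → Graph n → Set
Unicyclic G = Connected G × (Σ[ c ∈ Cycle G ] ∀ d → SameCycle c d)

DisjointEdges : ∀ {n} → Fin n × Fin n → Fin n × Fin n → Set
DisjointEdges (u , v) (x , y) = u ≢ x × u ≢ y × v ≢ x × v ≢ y

-- Each edge is listed once, in one of its two orientations.
record IsMatching {n} (G : Graph n) (M : List (Fin n × Fin n)) : Set where
  field
    edges    : All (uncurry (Adj G)) M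
    disjoint : AllPairs DisjointEdges M

MatchingNumber : ∀ {n} → Graph n → ℕ → Set
MatchingNumber G γ =
  (∃[ M ] IsMatching G M × length M ≡ γ) ×
  (∀ M → IsMatching G M → length M ≤ᴺ γ)

𝒰 : ∀ n → ℕ → Graph n → Set
𝒰 n γ G = Unicyclic G × MatchingNumber G γ

-- attach G v m adds m pendant vertices at v. The old vertices are
-- u ↑ˡ m, the new ones n ↑ʳ i.
attach : ∀ {n} → Graph n → Fin n → ∀ m → Graph (n +ᴺ m)
attach {n} G v m = record
  { adj    = λ x y → A (splitAt n x) (splitAt n y)
  ; symm   = λ x y → A-symm (splitAt n x) (splitAt n y)
  ; irrefl = λ x → A-irrefl (splitAt n x)
  }
  where
  A : Fin n ⊎ Fin m → Fin n ⊎ Fin m → Bool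
  A (inj₁ u) (inj₁ w) = adj G u w
  A (inj₁ u) (inj₂ _) = does (u ≟ v)
  A (inj₂ _) (inj₁ w) = does (w ≟ v)
  A (inj₂ _) (inj₂ _) = false

  A-symm : ∀ x y → A x y ≡ A y x
  A-symm (inj₁ u) (inj₁ w) = Graph.symm G u w
  A-symm (inj₁ _) (inj₂ _) = refl
  A-symm (inj₂ _) (inj₁ _) = refl
  A-symm (inj₂ _) (inj₂ _) = refl

  A-irrefl : ∀ x → A x x ≡ false
  A-irrefl (inj₁ u) = Graph.irrefl G u
  A-irrefl (inj₂ _) = refl

-- The vertices v₁, v₂, v₃, v₄ are 0F, 1F, 2F, 3F.
fourCycle : Graph 4
fourCycle = record
  { adj    = A
  ; symm   = from-yes (all? λ u → all? λ v → A u v ≟ᵇ A v u)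
  ; irrefl = from-yes (all? λ u → A u u ≟ᵇ false)
  }
  where
  A : Fin 4 → Fin 4 → Bool
  A 0F 1F = true
  A 1F 0F = true
  A 1F 2F = true
  A 2F 1F = true
  A 2F 3F = true
  A 3F 2F = true
  A 3F 0F = true
  A 0F 3F = true
  A _  _  = false

G₁ : ∀ a b → Graph (4 +ᴺ a +ᴺ b)
G₁ a b = attach (attach fourCycle 1F a) (3F ↑ˡ a) b

------------------------------------------------------------------------
-- Spectral radius

Matrix : ℕ → Set
Matrix n = Fin n → Fin n → ℝ

adjacencyMatrix : ∀ {n} → Graph n → Matrix n
adjacencyMatrix G u v = if adj G u v then 1ℝ else 0ℝ

_·_ : ∀ {n} → Matrix n → V.Vector ℝ n → V.Vector ℝ n
(A · x) i = V.foldr _+_ 0ℝ (λ j → A i j * x j)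

IsEigenvalue : ∀ {n} → Matrix n → ℝ → Set
IsEigenvalue {n} A μ = Σ[ x ∈ V.Vector ℝ n ]
  ¬ (∀ i → x i ≈ 0ℝ) × (∀ i → (A · x) i ≈ μ * x i)

-- Real eigenvalues suffice, since the adjacency matrix is real symmetric.
-- The relation determines r up to _≈_.
IsSpectralRadius : ∀ {n} → Graph n → ℝ → Set
IsSpectralRadius G r =
  (∃[ μ ] IsEigenvalue (adjacencyMatrix G) μ × ∣ μ ∣ ≈ r) ×
  (∀ μ → IsEigenvalue (adjacencyMatrix G) μ → ∣ μ ∣ ≤ r)

{-# OPTIONS --safe #-}

-- Rationals l < h with 4.14 ≤ 2l² - n and 2h² - n ≤ 4.2 separate the spectral
-- radius of the balanced G₁ from that of every other graph in 𝒰 n 2 (for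
-- n ≤ 10, the triangle with a hanging star needs a more careful choice).
--
-- Upper bound: a positive rational vector y with A y ≤ l y bounds every
-- eigenvalue by l, by pairing y with the absolute values of an eigenvector.
-- Lower bound: every graph is a blow-up of a graph on five vertices, so the
-- eigenvalue equation has an explicit solution, polynomial in λ, up to one
-- residual equation f(λ) = 0; if f(h) < 0, bisection yields a root λ ≥ h, which
-- is an eigenvalue.
--
-- In 𝒰 n 2 with n ≥ 6 the cycle is a square with pendant vertices at two opposite
-- vertices, or a triangle with pendant vertices at two of its vertices, or a
-- triangle with a star hanging at one vertex: anything else has a matching of
-- size 3 or a second cycle.

module Submission where

open import Defs
open import Data.Nat using (ℕ; _∸_; ⌊_/2⌋; ⌈_/2⌉) renaming (_≤_ to _≤ᴺ_)
open import Data.Product using (_×_)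
open import Function.Bundles using (_⇔_)

open import Algebra.Bundles using (CommutativeRing)
import Algebra.Properties.Semiring.Sum as Sum
open import Data.Bool using (Bool; true; false; not; if_then_else_)
open import Data.Bool.Properties using (¬-not) renaming (_≟_ to _≟ᵇ_)
open import Data.Empty using (⊥; ⊥-elim)
open import Data.Fin using (Fin; zero; suc; punchIn; splitAt; _↑ˡ_; _↑ʳ_; _≟_)
open import Data.Fin.Patterns using (0F; 1F; 2F; 3F; 4F; 5F)
open import Data.Fin.Permutation as Perm using (Permutation; _⟨$⟩ʳ_)
import Data.Fin.Properties as Finₚ
open import Data.Integer as ℤ using (+_; -[1+_])
import Data.Integer.Properties as ℤₚ
open import Data.List as List using (List; []; _∷_; length)
open import Data.List.Membership.Propositional using (_∈_)
import Data.List.Membership.DecPropositional as DecMembership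
open import Data.List.Membership.Propositional.Properties using (∈-map⁻; ∈-lookup)
open import Data.List.Relation.Unary.All as All using ([]; _∷_)
open import Data.List.Relation.Unary.AllPairs using ([]; _∷_)
open import Data.List.Relation.Unary.Any using (here)
open import Data.List.Relation.Unary.Unique.DecPropositional using (unique?)
open import Data.List.Relation.Unary.Unique.Propositional using (Unique)
import Data.List.Relation.Unary.Unique.Propositional.Properties as Uniqueₚ
open import Data.Nat as ℕ using (zero; suc; z≤n; s≤s) renaming (_+_ to _+ᴺ_; _*_ to _*ᴺ_)
import Data.Nat.Coprimality as Coprime
import Data.Nat.Properties as ℕₚ
open import Data.Product using (Σ-syntax; ∃-syntax; _,_; proj₁; proj₂)
open import Data.Product.Properties using (≡-dec)
open import Data.Rational as ℚ using (ℚ; mkℚ; 0ℚ; 1ℚ; ½; _/_)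
  renaming (_+_ to infixl 6 _⊕_; _-_ to infixl 6 _⊖_; _*_ to infixl 7 _⊗_; _≤_ to infix 4 _≼_; _<_ to infix 4 _≺_)
import Data.Rational.Properties as ℚₚ
import Data.Rational.Solver as ℚSolver
open import Data.Sum using (_⊎_; inj₁; inj₂; [_,_]′)
open import Data.Vec.Functional as V using () renaming (_∷_ to infixr 5 _▹_)
open import Function using (_∘_; const; case_of_)
open import Function.Bundles using (mk⇔; module Equivalence; module Inverse)
open import Function.Construct.Symmetry using (↔-sym)
open import Relation.Binary.Construct.Closure.ReflexiveTransitive as Star using (Star; _◅_)
open import Relation.Binary.PropositionalEquality
open import Relation.Nullary using (¬_; Dec; yes; no; does)
open import Relation.Nullary.Decidable
  using (from-yes; True; False; toWitness; toWitnessFalse; ¬?; _×-dec_)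

open ℚSolver.+-*-Solver using (Polynomial; con; solve; _:+_; _:*_; _:-_; :-_; _:=_)

-- Write S for 2λ² - n. With a and b pendant vertices on the square, (t - a - 2)(t - b - 2) = 4
-- reads S² = 16 + (b - a)²: S is 4 or √17 ≈ 4.123 in the balanced case and at least √20 ≈ 4.472
-- otherwise. With pendant vertices at two vertices of the triangle, the two factors have sum S + 1
-- and product (λ + 1)², so λ ≥ 2 forces S ≥ 5. The hanging star comes closest: for n = 7 it has S ≈
-- 4.221, just above the upper end 4.2. What shapes the proof is that the reals are Cauchy
-- sequences, on which neither order nor equality is decidable. Eigenvalues are never computed:
-- every strict comparison is a rational certificate, and the gap l < h is what excludes `r ≈ s`.
-- Equality arises only from an isomorphism. For the square one polynomial vector serves both
-- bounds: where f ≥ 0 it is a supersolution, and at a root of f an eigenvector.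

-- Ordered-field arithmetic in ℚ

0≼-diff : ∀ {p q} → p ≼ q → 0ℚ ≼ q ⊖ p
0≼-diff {p} {q} p≤q = subst (_≼ q ⊖ p) (ℚₚ.+-inverseʳ p) (ℚₚ.+-monoˡ-≤ (ℚ.- p) p≤q)

0≺-diff : ∀ {p q} → p ≺ q → 0ℚ ≺ q ⊖ p
0≺-diff {p} {q} p<q = subst (_≺ q ⊖ p) (ℚₚ.+-inverseʳ p) (ℚₚ.+-monoˡ-< (ℚ.- p) p<q)

-- Most inequalities below are proved by a certificate `e`: a ring identity exhibits the difference
-- of the two sides, and a term in `_⊕≼_` and `_⊗≼_` that mirrors the shape of `e` shows that it is
-- nonnegative.
≼-from-diff : ∀ {p q} e → q ≡ p ⊕ e → 0ℚ ≼ e → p ≼ q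
≼-from-diff {p} e refl 0≤e = subst (_≼ p ⊕ e) (ℚₚ.+-identityʳ p) (ℚₚ.+-monoʳ-≤ p 0≤e)

≺-from-diff : ∀ {p q} e → q ≡ p ⊕ e → 0ℚ ≺ e → p ≺ q
≺-from-diff {p} e refl 0<e = subst (_≺ p ⊕ e) (ℚₚ.+-identityʳ p) (ℚₚ.+-monoʳ-< p 0<e)

infixl 6 _⊕≼_ _⊕≺_
infixl 7 _⊗≼_ _⊗≺_

_⊕≼_ : ∀ {p q} → 0ℚ ≼ p → 0ℚ ≼ q → 0ℚ ≼ p ⊕ q
_⊕≼_ = ℚₚ.+-mono-≤

_⊕≺_ : ∀ {p q} → 0ℚ ≼ p → 0ℚ ≺ q → 0ℚ ≺ p ⊕ q
_⊕≺_ = ℚₚ.+-mono-≤-<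

_⊗≼_ : ∀ {p q} → 0ℚ ≼ p → 0ℚ ≼ q → 0ℚ ≼ p ⊗ q
_⊗≼_ {p} {q} 0≤p 0≤q =
  subst (_≼ p ⊗ q) (ℚₚ.*-zeroʳ p) (ℚₚ.*-monoˡ-≤-nonNeg p {{ℚ.nonNegative 0≤p}} 0≤q)

_⊗≺_ : ∀ {p q} → 0ℚ ≺ p → 0ℚ ≺ q → 0ℚ ≺ p ⊗ q
_⊗≺_ {p} {q} 0<p 0<q =
  subst (_≺ p ⊗ q) (ℚₚ.*-zeroʳ p) (ℚₚ.*-monoʳ-<-pos p {{ℚ.positive 0<p}} 0<q)

0≼square : ∀ p → 0ℚ ≼ p ⊗ p
0≼square p with ℚₚ.≤-total 0ℚ p
... | inj₁ 0≤p = 0≤p ⊗≼ 0≤p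
... | inj₂ p≤0 = subst (0ℚ ≼_) (solve 1 (λ p → (con 0ℚ :- p) :* (con 0ℚ :- p) := p :* p) refl p)
  (0≼-diff p≤0 ⊗≼ 0≼-diff p≤0)

≺⇒⋡ : ∀ {p q} → p ≺ q → ¬ q ≼ p
≺⇒⋡ p<q q≤p = ℚₚ.<-irrefl refl (ℚₚ.<-≤-trans p<q q≤p)

∣∣≺ : ∀ {p ε} → p ≺ ε → 0ℚ ≺ p ⊕ ε → ℚ.∣ p ∣ ≺ ε
∣∣≺ {p} {ε} p<ε 0<p+ε with ℚₚ.∣p∣≡p∨∣p∣≡-p p
... | inj₁ eq = subst (_≺ ε) (sym eq) p<ε
... | inj₂ eq = subst (_≺ ε) (sym eq)
  (≺-from-diff (p ⊕ ε) (solve 2 (λ p ε → ε := :- p :+ (p :+ ε)) refl p ε) 0<p+ε)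

∣∣≼ : ∀ {p ε} → p ≼ ε → 0ℚ ≼ p ⊕ ε → ℚ.∣ p ∣ ≼ ε
∣∣≼ {p} {ε} p≤ε 0≤p+ε with ℚₚ.∣p∣≡p∨∣p∣≡-p p
... | inj₁ eq = subst (_≼ ε) (sym eq) p≤ε
... | inj₂ eq = subst (_≼ ε) (sym eq)
  (≼-from-diff (p ⊕ ε) (solve 2 (λ p ε → ε := :- p :+ (p :+ ε)) refl p ε) 0≤p+ε)

p≼∣p∣ : ∀ p → p ≼ ℚ.∣ p ∣
p≼∣p∣ p with ℚₚ.≤-total 0ℚ p
... | inj₁ 0≤p = ℚₚ.≤-reflexive (sym (ℚₚ.0≤p⇒∣p∣≡p 0≤p))
... | inj₂ p≤0 = ℚₚ.≤-trans p≤0 (ℚₚ.0≤∣p∣ p)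

∣∣≺⇒≺ : ∀ p q {ε} → ℚ.∣ p ⊖ q ∣ ≺ ε → p ≺ q ⊕ ε
∣∣≺⇒≺ p q {ε} h = ≺-from-diff (ε ⊖ (p ⊖ q))
  (solve 3 (λ p q ε → q :+ ε := p :+ (ε :- (p :- q))) refl p q ε)
  (0≺-diff (ℚₚ.≤-<-trans (p≼∣p∣ (p ⊖ q)) h))

∣-∣-comm : ∀ p q → ℚ.∣ p ⊖ q ∣ ≡ ℚ.∣ q ⊖ p ∣
∣-∣-comm p q = trans (sym (ℚₚ.∣-p∣≡∣p∣ (p ⊖ q)))
  (cong ℚ.∣_∣ (solve 2 (λ p q → :- (p :- q) := q :- p) refl p q))

halves : ∀ {ε} → 0ℚ ≺ ε → ∃[ η ] 0ℚ ≺ η × η ⊕ η ≡ ε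
halves {ε} 0<ε = ½ ⊗ ε , from-yes (0ℚ ℚₚ.<? ½) ⊗≺ 0<ε ,
  solve 1 (λ ε → con ½ :* ε :+ con ½ :* ε := ε) refl ε

divide : ∀ {c ε} → 0ℚ ≺ c → 0ℚ ≺ ε → ∃[ δ ] 0ℚ ≺ δ × c ⊗ δ ≡ ε
divide {c} {ε} 0<c 0<ε = c⁻¹ ⊗ ε
  , ℚₚ.positive⁻¹ c⁻¹ {{ℚₚ.1/pos⇒pos c {{ℚ.positive 0<c}}}} ⊗≺ 0<ε
  , trans (sym (ℚₚ.*-assoc c c⁻¹ ε))
      (trans (cong (_⊗ ε) (ℚₚ.*-inverseʳ c {{c≢0}})) (ℚₚ.*-identityˡ ε))
  where
  c≢0 = ℚₚ.pos⇒nonZero c {{ℚ.positive 0<c}}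
  c⁻¹ = ℚ.1/_ c {{c≢0}}

fromℕ : ℕ → ℚ
fromℕ zero    = 0ℚ
fromℕ (suc n) = 1ℚ ⊕ fromℕ n

0≼1 : 0ℚ ≼ 1ℚ
0≼1 = from-yes (0ℚ ℚₚ.≤? 1ℚ)

0≼fromℕ : ∀ n → 0ℚ ≼ fromℕ n
0≼fromℕ zero    = ℚₚ.≤-refl
0≼fromℕ (suc n) = 0≼1 ⊕≼ 0≼fromℕ n

fromℕ-+ : ∀ m n → fromℕ (m ℕ.+ n) ≡ fromℕ m ⊕ fromℕ n
fromℕ-+ zero    n = sym (ℚₚ.+-identityˡ (fromℕ n))
fromℕ-+ (suc m) n = trans (cong (1ℚ ⊕_) (fromℕ-+ m n)) (sym (ℚₚ.+-assoc 1ℚ (fromℕ m) (fromℕ n)))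

fromℕ-mono : ∀ {m n} → m ≤ᴺ n → fromℕ m ≼ fromℕ n
fromℕ-mono {n = n} ℕ.z≤n   = 0≼fromℕ n
fromℕ-mono (ℕ.s≤s m≤n) = ℚₚ.+-monoʳ-≤ 1ℚ (fromℕ-mono m≤n)

archimedean : ∀ p → ∃[ n ] p ≼ fromℕ n
archimedean p = m , ℚₚ.≤-trans (lower p) (ℚₚ.≤-reflexive (cast m))
  where
  integer : ℤ.ℤ → ℚ
  integer i = mkℚ i 0 (Coprime.sym (Coprime.1-coprimeTo ℤ.∣ i ∣))
  m = ℤ.∣ ℚ.numerator p ∣
  -- A denominator is at least 1, so the absolute value of the numerator already bounds `p`.
  lower : ∀ p → p ≼ integer (+ ℤ.∣ ℚ.numerator p ∣)
  lower (mkℚ (+ n) d-1 _) = ℚ.*≤* (ℤₚ.≤-trans (ℤₚ.≤-reflexive (ℤₚ.*-identityʳ (+ n)))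
    (ℤₚ.≤-trans (ℤ.+≤+ (ℕₚ.m≤m*n n (suc d-1))) (ℤₚ.≤-reflexive (ℤₚ.pos-* n (suc d-1)))))
  lower (mkℚ -[1+ n ] d-1 _) = ℚ.*≤* ℤ.-≤+
  suc-integer : ∀ n → integer (+ suc n) ≡ 1ℚ ⊕ integer (+ n)
  suc-integer n = trans (sym (ℚₚ.↥p/↧p≡p (integer (+ suc n))))
    (cong (_/ 1) (cong (ℤ._+_ (+ 1)) (sym (ℤₚ.*-identityʳ (+ n)))))
  cast : ∀ n → integer (+ n) ≡ fromℕ n
  cast zero    = refl
  cast (suc n) = trans (suc-integer n) (cong (1ℚ ⊕_) (cast n))

-- Bisection

½^_ : ℕ → ℚ
½^ zero  = 1ℚ
½^ suc k = ½ ⊗ ½^ k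

0≺½^ : ∀ k → 0ℚ ≺ ½^ k
0≺½^ zero    = from-yes (0ℚ ℚₚ.<? 1ℚ)
0≺½^ (suc k) = from-yes (0ℚ ℚₚ.<? ½) ⊗≺ 0≺½^ k

-- Bernoulli's inequality 1 + k ≤ 2^k, in the form that bounds the bracket widths.
½^k*[1+k]≼1 : ∀ k → ½^ k ⊗ (1ℚ ⊕ fromℕ k) ≼ 1ℚ
½^k*[1+k]≼1 zero    = from-yes (1ℚ ⊗ (1ℚ ⊕ 0ℚ) ℚₚ.≤? 1ℚ)
½^k*[1+k]≼1 (suc k) = ℚₚ.≤-trans
  (≼-from-diff (½ ⊗ (½^ k ⊗ fromℕ k))
    (solve 2 (λ t k → t :* (con 1ℚ :+ k) :=
      con ½ :* t :* (con 1ℚ :+ (con 1ℚ :+ k)) :+ con ½ :* (t :* k)) refl (½^ k) (fromℕ k))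
    (from-yes (0ℚ ℚₚ.≤? ½) ⊗≼ (ℚₚ.<⇒≤ (0≺½^ k) ⊗≼ 0≼fromℕ k)))
  (½^k*[1+k]≼1 k)

½^-small : ∀ w {ε} → 0ℚ ≺ ε → ∃[ k ] ½^ k ⊗ w ≺ ε
½^-small w {ε} 0<ε with divide 0<ε (from-yes (0ℚ ℚₚ.<? 1ℚ))
... | e , 0<e , εe≡1 with archimedean (w ⊗ e)
... | k , we≤k = k , ℚₚ.≤-<-trans
  (≼-from-diff (½^ k ⊗ (ε ⊗ (fromℕ k ⊖ w ⊗ e)) ⊕ ½^ k ⊗ w ⊗ (ε ⊗ e ⊖ 1ℚ))
    (solve 5 (λ t k w ε e → t :* (ε :* k) :=
      t :* w :+ (t :* (ε :* (k :- w :* e)) :+ t :* w :* (ε :* e :- con 1ℚ)))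
      refl (½^ k) (fromℕ k) w ε e)
    ((ℚₚ.<⇒≤ (0≺½^ k) ⊗≼ (ℚₚ.<⇒≤ 0<ε ⊗≼ 0≼-diff we≤k))
      ⊕≼ ℚₚ.≤-reflexive (sym (trans (cong (½^ k ⊗ w ⊗_) (trans (cong (_⊖ 1ℚ) εe≡1) (ℚₚ.+-inverseʳ 1ℚ)))
           (ℚₚ.*-zeroʳ (½^ k ⊗ w))))))
  (≺-from-diff (ε ⊗ (1ℚ ⊖ ½^ k ⊗ (1ℚ ⊕ fromℕ k)) ⊕ ½^ k ⊗ ε)
    (solve 3 (λ t k ε → ε := t :* (ε :* k) :+
      (ε :* (con 1ℚ :- t :* (con 1ℚ :+ k)) :+ t :* ε)) refl (½^ k) (fromℕ k) ε)
    ((ℚₚ.<⇒≤ 0<ε ⊗≼ 0≼-diff (½^k*[1+k]≼1 k)) ⊕≺ (0≺½^ k ⊗≺ 0<ε)))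

module Bisection (f : ℚ → ℚ) where

  record Bracket : Set where
    constructor bracket
    field
      lo hi  : ℚ
      lo≼hi  : lo ≼ hi
      below  : f lo ≺ 0ℚ
      above  : 0ℚ ≼ f hi

    width : ℚ
    width = hi ⊖ lo

  open Bracket public

  midpoint : Bracket → ℚ
  midpoint b = ½ ⊗ (lo b ⊕ hi b)

  lo≼mid : ∀ b → lo b ≼ midpoint b
  lo≼mid b = ≼-from-diff (½ ⊗ (hi b ⊖ lo b))
    (solve 2 (λ l h → con ½ :* (l :+ h) := l :+ con ½ :* (h :- l)) refl (lo b) (hi b))
    (from-yes (0ℚ ℚₚ.≤? ½) ⊗≼ 0≼-diff (lo≼hi b))

  mid≼hi : ∀ b → midpoint b ≼ hi b
  mid≼hi b = ≼-from-diff (½ ⊗ (hi b ⊖ lo b))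
    (solve 2 (λ l h → h := con ½ :* (l :+ h) :+ con ½ :* (h :- l)) refl (lo b) (hi b))
    (from-yes (0ℚ ℚₚ.≤? ½) ⊗≼ 0≼-diff (lo≼hi b))

  -- The midpoint is rational, so the sign of `f` there is decidable, and bisection needs no choice
  -- between overlapping alternatives.
  halve : (b : Bracket) → Σ[ b′ ∈ Bracket ]
    lo b ≼ lo b′ × hi b′ ≼ hi b × width b′ ≡ ½ ⊗ width b
  halve b with 0ℚ ℚₚ.≤? f (midpoint b)
  ... | yes 0≤f = bracket (lo b) (midpoint b) (lo≼mid b) (below b) 0≤f
    , ℚₚ.≤-refl , mid≼hi b
    , solve 2 (λ l h → con ½ :* (l :+ h) :- l := con ½ :* (h :- l)) refl (lo b) (hi b)
  ... | no ¬0≤f = bracket (midpoint b) (hi b) (mid≼hi b) (ℚₚ.≰⇒> ¬0≤f) (above b)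
    , lo≼mid b , ℚₚ.≤-refl
    , solve 2 (λ l h → h :- con ½ :* (l :+ h) := con ½ :* (h :- l)) refl (lo b) (hi b)

  next : Bracket → Bracket
  next b = proj₁ (halve b)

  refine : ∀ k (b : Bracket) → Σ[ b′ ∈ Bracket ]
    lo b ≼ lo b′ × hi b′ ≼ hi b × width b′ ≡ ½^ k ⊗ width b
  refine zero    b = b , ℚₚ.≤-refl , ℚₚ.≤-refl , sym (ℚₚ.*-identityˡ (width b))
  refine (suc k) b with halve b
  ... | b₁ , l₁ , h₁ , w₁ with refine k b₁
  ... | b₂ , l₂ , h₂ , w₂ = b₂ , ℚₚ.≤-trans l₁ l₂ , ℚₚ.≤-trans h₂ h₁
    , trans w₂ (trans (cong (½^ k ⊗_) w₁)
        (solve 2 (λ t w → t :* (con ½ :* w) := con ½ :* t :* w) refl (½^ k) (width b)))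

  -- The endpoints of successive brackets are interleaved, so that f changes
  -- sign along every tail; once f ∘ zigzag is Cauchy, its limit must be 0.
  zigzag : Bracket → ℕ → ℚ
  zigzag b zero          = lo b
  zigzag b (suc zero)    = hi b
  zigzag b (suc (suc n)) = zigzag (next b) n

  lo≼zigzag : ∀ b n → lo b ≼ zigzag b n
  lo≼zigzag b zero          = ℚₚ.≤-refl
  lo≼zigzag b (suc zero)    = lo≼hi b
  lo≼zigzag b (suc (suc n)) = ℚₚ.≤-trans (proj₁ (proj₂ (halve b))) (lo≼zigzag (next b) n)

  zigzag≼hi : ∀ b n → zigzag b n ≼ hi b
  zigzag≼hi b zero          = lo≼hi b
  zigzag≼hi b (suc zero)    = ℚₚ.≤-refl
  zigzag≼hi b (suc (suc n)) =
    ℚₚ.≤-trans (zigzag≼hi (next b) n) (proj₁ (proj₂ (proj₂ (halve b))))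

  double : ℕ → ℕ
  double zero    = zero
  double (suc k) = suc (suc (double k))

  k≤double : ∀ k → k ≤ᴺ double k
  k≤double zero    = ℕ.z≤n
  k≤double (suc k) = ℕ.s≤s (ℕₚ.m≤n⇒m≤1+n (k≤double k))

  zigzag-close : ∀ k b {m n} → double k ≤ᴺ m → double k ≤ᴺ n →
    ℚ.∣ zigzag b m ⊖ zigzag b n ∣ ≼ ½^ k ⊗ width b
  zigzag-close zero b {m} {n} _ _ = ∣∣≼
    (≼-from-diff ((hi b ⊖ zigzag b m) ⊕ (zigzag b n ⊖ lo b))
      (solve 4 (λ l h x y → con 1ℚ :* (h :- l) := x :- y :+ ((h :- x) :+ (y :- l))) refl
        (lo b) (hi b) (zigzag b m) (zigzag b n))
      (0≼-diff (zigzag≼hi b m) ⊕≼ 0≼-diff (lo≼zigzag b n)))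
    (subst (0ℚ ≼_)
      (solve 4 (λ l h x y → (h :- y) :+ (x :- l) := x :- y :+ con 1ℚ :* (h :- l)) refl
        (lo b) (hi b) (zigzag b m) (zigzag b n))
      (0≼-diff (zigzag≼hi b n) ⊕≼ 0≼-diff (lo≼zigzag b m)))
  zigzag-close (suc k) b {suc (suc m)} {suc (suc n)} (ℕ.s≤s (ℕ.s≤s p)) (ℕ.s≤s (ℕ.s≤s q)) =
    subst (ℚ.∣ zigzag (next b) m ⊖ zigzag (next b) n ∣ ≼_)
      (trans (cong (½^ k ⊗_) (proj₂ (proj₂ (proj₂ (halve b)))))
        (solve 2 (λ t w → t :* (con ½ :* w) := con ½ :* t :* w) refl (½^ k) (width b)))
      (zigzag-close k (next b) p q)

  zigzag-below : ∀ k b → f (zigzag b (double k)) ≺ 0ℚ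
  zigzag-below zero    b = below b
  zigzag-below (suc k) b = zigzag-below k (next b)

  zigzag-above : ∀ k b → 0ℚ ≼ f (zigzag b (suc (double k)))
  zigzag-above zero    b = above b
  zigzag-above (suc k) b = zigzag-above k (next b)

  abstract
    zigzag-cauchy : ∀ b → IsCauchy (zigzag b)
    zigzag-cauchy b ε 0<ε = let k , small = ½^-small (width b) 0<ε in
      double k , λ m n p q → ℚₚ.≤-<-trans (zigzag-close k b p q) small

  root : Bracket → ℝ
  root b = mkℝ (zigzag b) (zigzag-cauchy b)

  root-vanishes : ∀ b → IsCauchy (λ n → f (zigzag b n)) →
    ∀ ε → 0ℚ ≺ ε → ∃[ N ] ∀ n → N ≤ᴺ n → ℚ.∣ f (zigzag b n) ∣ ≺ ε
  root-vanishes b cauchy-f ε 0<ε = let N , close = cauchy-f ε 0<ε in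
    N , λ n N≤n →
      let x = f (zigzag b n)
          y = f (zigzag b (double N))
          z = f (zigzag b (suc (double N)))
      in ∣∣≺
        (≺-from-diff ((y ⊕ ε ⊖ x) ⊕ (0ℚ ⊖ y))
          (solve 3 (λ x y ε → ε := x :+ ((y :+ ε :- x) :+ (con 0ℚ :- y))) refl x y ε)
          (ℚₚ.<⇒≤ (0≺-diff (∣∣≺⇒≺ x y (close n (double N) N≤n (k≤double N))))
            ⊕≺ 0≺-diff (zigzag-below N b)))
        (subst (0ℚ ≺_) (solve 3 (λ x z ε → z :+ (x :+ ε :- z) := x :+ ε) refl x z ε)
          (zigzag-above N b ⊕≺ 0≺-diff (∣∣≺⇒≺ z x
            (close (suc (double N)) n (ℕₚ.m≤n⇒m≤1+n (k≤double N)) N≤n))))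

-- Finite sums and their estimates

module ℚΣ = Sum (CommutativeRing.semiring ℚₚ.+-*-commutativeRing)
module ℕΣ = Sum ℕₚ.+-*-semiring
open ℚΣ using () renaming (sum to ∑)

∑-mono : ∀ {n} {f g : Fin n → ℚ} → (∀ i → f i ≼ g i) → ∑ f ≼ ∑ g
∑-mono {zero}  _   = ℚₚ.≤-refl
∑-mono {suc n} f≤g = ℚₚ.+-mono-≤ (f≤g zero) (∑-mono (f≤g ∘ suc))

0≼∑ : ∀ {n} {f : Fin n → ℚ} → (∀ i → 0ℚ ≼ f i) → 0ℚ ≼ ∑ f
0≼∑ {zero}  _   = ℚₚ.≤-refl
0≼∑ {suc n} 0≤f = 0≤f zero ⊕≼ 0≼∑ (0≤f ∘ suc)

term≼∑ : ∀ {n} {f : Fin n → ℚ} → (∀ i → 0ℚ ≼ f i) → ∀ i → f i ≼ ∑ f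
term≼∑ {f = f} 0≤f zero = ≼-from-diff (∑ (f ∘ suc)) refl (0≼∑ (0≤f ∘ suc))
term≼∑ {f = f} 0≤f (suc i) =
  ℚₚ.≤-trans (term≼∑ (0≤f ∘ suc) i) (≼-from-diff (f zero) (ℚₚ.+-comm (f zero) _) (0≤f zero))

∣∑∣≼∑∣∣ : ∀ {n} (f : Fin n → ℚ) → ℚ.∣ ∑ f ∣ ≼ ∑ (λ i → ℚ.∣ f i ∣)
∣∑∣≼∑∣∣ {zero}  _ = ℚₚ.≤-refl
∣∑∣≼∑∣∣ {suc n} f = ℚₚ.≤-trans (ℚₚ.∣p+q∣≤∣p∣+∣q∣ (f zero) (∑ (f ∘ suc)))
  (ℚₚ.+-monoʳ-≤ ℚ.∣ f zero ∣ (∣∑∣≼∑∣∣ (f ∘ suc)))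

-- Order on ℝ

≈⇒≤ : ∀ {x y} → x ≈ y → x ≤ y
≈⇒≤ {x} {y} x≈y ε 0<ε = let N , close = x≈y ε 0<ε in
  N , λ n N≤n → ∣∣≺⇒≺ (seq x n) (seq y n) (close n N≤n)

≈-sym : ∀ {x y} → x ≈ y → y ≈ x
≈-sym {x} {y} x≈y ε 0<ε = let N , close = x≈y ε 0<ε in
  N , λ n N≤n → subst (_≺ ε) (∣-∣-comm (seq x n) (seq y n)) (close n N≤n)

≤-trans : ∀ {x y z} → x ≤ y → y ≤ z → x ≤ z
≤-trans {x} {y} {z} x≤y y≤z ε 0<ε =
  let η , 0<η , η+η≡ε = halves 0<ε
      M , x<y = x≤y η 0<η
      N , y<z = y≤z η 0<η
  in M ℕ.⊔ N , λ n p → ℚₚ.<-trans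
       (x<y n (ℕₚ.≤-trans (ℕₚ.m≤m⊔n M N) p))
       (subst (seq y n ⊕ η ≺_) (trans (ℚₚ.+-assoc (seq z n) η η) (cong (seq z n ⊕_) η+η≡ε))
         (ℚₚ.+-monoˡ-< η (y<z n (ℕₚ.≤-trans (ℕₚ.m≤n⊔m M N) p))))

≤-antisym : ∀ {x y} → x ≤ y → y ≤ x → x ≈ y
≤-antisym {x} {y} x≤y y≤x ε 0<ε =
  let M , x<y = x≤y ε 0<ε
      N , y<x = y≤x ε 0<ε
  in M ℕ.⊔ N , λ n p →
       let a = seq x n
           b = seq y n
       in ∣∣≺
         (≺-from-diff (b ⊕ ε ⊖ a) (solve 3 (λ a b e → e := a :- b :+ (b :+ e :- a)) refl a b ε)
           (0≺-diff (x<y n (ℕₚ.≤-trans (ℕₚ.m≤m⊔n M N) p))))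
         (subst (0ℚ ≺_) (solve 3 (λ a b e → a :+ e :- b := a :- b :+ e) refl a b ε)
           (0≺-diff (y<x n (ℕₚ.≤-trans (ℕₚ.m≤n⊔m M N) p))))

fromℚ-cancel-≤ : ∀ {p q} → fromℚ p ≤ fromℚ q → p ≼ q
fromℚ-cancel-≤ {p} {q} p≤q with ℚₚ.≤-total p q
... | inj₁ p≼q = p≼q
... | inj₂ q≼p with p ℚₚ.≤? q
...   | yes p≼q = p≼q
...   | no p⋠q with p≤q (p ⊖ q) (0≺-diff (ℚₚ.≰⇒> p⋠q))
...     | N , lt = ⊥-elim (ℚₚ.<-irrefl
              (solve 2 (λ p q → p := q :+ (p :- q)) refl p q) (lt N ℕₚ.≤-refl))

uniformly : ∀ {k} {P : Fin k → ℕ → Set} →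
  (∀ i → ∃[ N ] ∀ n → N ≤ᴺ n → P i n) → ∃[ N ] ∀ n → N ≤ᴺ n → ∀ i → P i n
uniformly {zero}  _ = 0 , λ _ _ ()
uniformly {suc k} h =
  let M , p = h zero
      N , q = uniformly (h ∘ suc)
  in M ℕ.⊔ N , λ where
       n r zero    → p n (ℕₚ.≤-trans (ℕₚ.m≤m⊔n M N) r)
       n r (suc i) → q n (ℕₚ.≤-trans (ℕₚ.m≤n⊔m M N) r) i

-- Rows of the adjacency matrix

entry : Bool → ℚ
entry b = if b then 1ℚ else 0ℚ

0≼entry : ∀ b → 0ℚ ≼ entry b
0≼entry true  = 0≼1
0≼entry false = ℚₚ.≤-refl

row : ∀ {n} → Graph n → (Fin n → ℚ) → Fin n → ℚ
row G y u = ∑ (λ v → entry (adj G u v) ⊗ y v)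

seq-foldr : ∀ {n} (f : Fin n → ℝ) m → seq (V.foldr _+_ 0ℝ f) m ≡ ∑ (λ i → seq (f i) m)
seq-foldr {zero}  _ _ = refl
seq-foldr {suc n} f m = cong (seq (f zero) m ⊕_) (seq-foldr (f ∘ suc) m)

-- The operations on `ℝ` are pointwise, so at each index the real matrix product is a rational one.
-- This moves all spectral arguments into `ℚ`.
seq-· : ∀ {n} (G : Graph n) x u m →
  seq ((adjacencyMatrix G · x) u) m ≡ row G (λ v → seq (x v) m) u
seq-· G x u m = trans (seq-foldr (λ v → adjacencyMatrix G u v * x v) m)
  (ℚΣ.sum-cong-≗ λ v → cong (_⊗ seq (x v) m) (seq-entry (adj G u v)))
  where
  seq-entry : ∀ b → seq (if b then 1ℝ else 0ℝ) m ≡ entry b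
  seq-entry true  = refl
  seq-entry false = refl

row-symmetric : ∀ {n} (G : Graph n) (y z : Fin n → ℚ) →
  ∑ (λ u → y u ⊗ row G z u) ≡ ∑ (λ v → row G y v ⊗ z v)
row-symmetric G y z = trans
  (ℚΣ.sum-cong-≗ λ u → ℚΣ.*-distribˡ-sum (y u) (λ v → entry (adj G u v) ⊗ z v))
  (trans (ℚΣ.∑-comm (λ u v → y u ⊗ (entry (adj G u v) ⊗ z v)))
  (ℚΣ.sum-cong-≗ λ v → trans
    (ℚΣ.sum-cong-≗ λ u → trans
      (solve 3 (λ y a z → y :* (a :* z) := a :* y :* z) refl (y u) (entry (adj G u v)) (z v))
      (cong (λ a → entry a ⊗ y u ⊗ z v) (Graph.symm G u v)))
    (sym (ℚΣ.*-distribʳ-sum (z v) (λ u → entry (adj G v u) ⊗ y u)))))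

row-∣∣ : ∀ {n} (G : Graph n) x u → ℚ.∣ row G x u ∣ ≼ row G (λ v → ℚ.∣ x v ∣) u
row-∣∣ G x u = ℚₚ.≤-trans (∣∑∣≼∑∣∣ (λ v → entry (adj G u v) ⊗ x v))
  (ℚₚ.≤-reflexive (ℚΣ.sum-cong-≗ λ v → trans (ℚₚ.∣p*q∣≡∣p∣*∣q∣ (entry (adj G u v)) (x v))
    (cong (_⊗ ℚ.∣ x v ∣) (ℚₚ.0≤p⇒∣p∣≡p (0≼entry (adj G u v))))))

-- Pairing an approximate eigenvector with a positive y such that A y ≼ q y
-- (Collatz–Wielandt).
module _ {n} (G : Graph n) (q : ℚ) (y : Fin n → ℚ) (0<y : ∀ u → 0ℚ ≺ y u)
  (supersolution : ∀ u → row G y u ≼ q ⊗ y u) where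

  -- At a single index a real eigenvalue equation holds only up to an error `ε`. Multiplying |m| |x
  -- u| ≤ (A |x|) u + ε by `y u`, summing, and moving A onto `y` by symmetry gives |m| W ≤ q W + ε ∑
  -- y for W = ∑ y u |x u|. Hence η W ≤ ε ∑ y, and W dominates each of its terms.
  approximate-eigenvector-small : ∀ {η ε m} (x : Fin n → ℚ) → q ⊕ η ≼ ℚ.∣ m ∣ → 0ℚ ≼ η →
    (∀ u → ℚ.∣ row G x u ⊖ m ⊗ x u ∣ ≺ ε) → ∀ i → η ⊗ (y i ⊗ ℚ.∣ x i ∣) ≼ ε ⊗ ∑ y
  approximate-eigenvector-small {η} {ε} {m} x q+η≤m 0≤η residual i = ℚₚ.≤-trans
    (ℚₚ.*-monoˡ-≤-nonNeg η {{ℚ.nonNegative 0≤η}} (term≼∑ 0≤yz i))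
    (≼-from-diff ((ℚ.∣ m ∣ ⊖ (q ⊕ η)) ⊗ W ⊕ (q ⊗ W ⊕ ε ⊗ ∑ y ⊖ ℚ.∣ m ∣ ⊗ W))
      (solve 5 (λ η W e m q → e := η :* W :+ ((m :- (q :+ η)) :* W :+ (q :* W :+ e :- m :* W)))
        refl η W (ε ⊗ ∑ y) ℚ.∣ m ∣ q)
      ((0≼-diff q+η≤m ⊗≼ 0≼∑ 0≤yz) ⊕≼ 0≼-diff mW≤))
    where
    z : Fin n → ℚ
    z u = ℚ.∣ x u ∣
    W = ∑ (λ u → y u ⊗ z u)
    0≤yz : ∀ u → 0ℚ ≼ y u ⊗ z u
    0≤yz u = ℚₚ.<⇒≤ (0<y u) ⊗≼ ℚₚ.0≤∣p∣ (x u)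
    pointwise : ∀ u → ℚ.∣ m ∣ ⊗ z u ≼ row G z u ⊕ ε
    pointwise u = begin
      ℚ.∣ m ∣ ⊗ z u                                   ≡⟨ ℚₚ.∣p*q∣≡∣p∣*∣q∣ m (x u) ⟨
      ℚ.∣ m ⊗ x u ∣                                   ≡⟨ cong ℚ.∣_∣ (solve 2 (λ r t → t := r :+ (t :- r)) refl (row G x u) (m ⊗ x u)) ⟩
      ℚ.∣ row G x u ⊕ (m ⊗ x u ⊖ row G x u) ∣         ≤⟨ ℚₚ.∣p+q∣≤∣p∣+∣q∣ (row G x u) (m ⊗ x u ⊖ row G x u) ⟩
      ℚ.∣ row G x u ∣ ⊕ ℚ.∣ m ⊗ x u ⊖ row G x u ∣     ≡⟨ cong (ℚ.∣ row G x u ∣ ⊕_) (∣-∣-comm (m ⊗ x u) (row G x u)) ⟩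
      ℚ.∣ row G x u ∣ ⊕ ℚ.∣ row G x u ⊖ m ⊗ x u ∣     ≤⟨ ℚₚ.+-mono-≤ (row-∣∣ G x u) (ℚₚ.<⇒≤ (residual u)) ⟩
      row G z u ⊕ ε                                   ∎
      where open ℚₚ.≤-Reasoning
    mW≤ : ℚ.∣ m ∣ ⊗ W ≼ q ⊗ W ⊕ ε ⊗ ∑ y
    mW≤ = begin
      ℚ.∣ m ∣ ⊗ W                                      ≡⟨ ℚΣ.*-distribˡ-sum ℚ.∣ m ∣ (λ u → y u ⊗ z u) ⟩
      ∑ (λ u → ℚ.∣ m ∣ ⊗ (y u ⊗ z u))                  ≡⟨ ℚΣ.sum-cong-≗ (λ u → solve 3 (λ m y z → m :* (y :* z) := y :* (m :* z)) refl ℚ.∣ m ∣ (y u) (z u)) ⟩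
      ∑ (λ u → y u ⊗ (ℚ.∣ m ∣ ⊗ z u))                  ≤⟨ ∑-mono (λ u → ℚₚ.*-monoˡ-≤-nonNeg (y u) {{ℚ.nonNegative (ℚₚ.<⇒≤ (0<y u))}} (pointwise u)) ⟩
      ∑ (λ u → y u ⊗ (row G z u ⊕ ε))                  ≡⟨ ℚΣ.sum-cong-≗ (λ u → solve 3 (λ y r e → y :* (r :+ e) := y :* r :+ e :* y) refl (y u) (row G z u) ε) ⟩
      ∑ (λ u → y u ⊗ row G z u ⊕ ε ⊗ y u)              ≡⟨ ℚΣ.∑-distrib-+ (λ u → y u ⊗ row G z u) (λ u → ε ⊗ y u) ⟩
      ∑ (λ u → y u ⊗ row G z u) ⊕ ∑ (λ u → ε ⊗ y u)    ≡⟨ cong₂ _⊕_ (row-symmetric G y z) (sym (ℚΣ.*-distribˡ-sum ε y)) ⟩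
      ∑ (λ u → row G y u ⊗ z u) ⊕ ε ⊗ ∑ y              ≤⟨ ℚₚ.+-monoˡ-≤ (ε ⊗ ∑ y) (∑-mono (λ u → ℚₚ.*-monoʳ-≤-nonNeg (z u) {{ℚ.nonNegative (ℚₚ.0≤∣p∣ (x u))}} (supersolution u))) ⟩
      ∑ (λ u → q ⊗ y u ⊗ z u) ⊕ ε ⊗ ∑ y                ≡⟨ cong (_⊕ ε ⊗ ∑ y) (trans (ℚΣ.sum-cong-≗ (λ u → ℚₚ.*-assoc q (y u) (z u))) (sym (ℚΣ.*-distribˡ-sum q (λ u → y u ⊗ z u)))) ⟩
      q ⊗ W ⊕ ε ⊗ ∑ y                                  ∎
      where open ℚₚ.≤-Reasoning

  -- The case split is made on one rational approximation of |μ|, at an index `N` past which the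
  -- sequence varies by less than η = δ/2. If that approximation is at least q + δ, then |μ| stays
  -- above q + η from `N` on, and every entry of `x` tends to 0, against `x≉0`.
  eigenvalue-bound : ∀ μ → IsEigenvalue (adjacencyMatrix G) μ → ∣ μ ∣ ≤ fromℚ q
  eigenvalue-bound μ (x , x≉0 , eigen) ε 0<ε = decide (ℚ.∣ seq μ N ∣ ℚₚ.<? q ⊕ δ)
    where
    δ   = proj₁ (halves 0<ε)
    0<δ = proj₁ (proj₂ (halves 0<ε))
    δ+δ = proj₂ (proj₂ (halves 0<ε))
    η   = proj₁ (halves 0<δ)
    0<η = proj₁ (proj₂ (halves 0<δ))
    η+η = proj₂ (proj₂ (halves 0<δ))
    N     = proj₁ (cauchy (∣ μ ∣) η 0<η)
    close = proj₂ (cauchy (∣ μ ∣) η 0<η)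
    η≼δ : η ≼ δ
    η≼δ = ≼-from-diff η (sym η+η) (ℚₚ.<⇒≤ 0<η)
    decide : Dec (ℚ.∣ seq μ N ∣ ≺ q ⊕ δ) → ∃[ K ] ∀ n → K ≤ᴺ n → ℚ.∣ seq μ n ∣ ≺ q ⊕ ε
    decide (yes small) = N , λ n N≤n → ℚₚ.<-≤-trans
      (∣∣≺⇒≺ ℚ.∣ seq μ n ∣ ℚ.∣ seq μ N ∣ (close n N N≤n ℕₚ.≤-refl))
      (ℚₚ.≤-trans (ℚₚ.+-mono-≤ (ℚₚ.<⇒≤ small) η≼δ)
        (ℚₚ.≤-reflexive (trans (ℚₚ.+-assoc q δ δ) (cong (q ⊕_) δ+δ))))
    decide (no large) = ⊥-elim (x≉0 vanishes)
      where
      large′ : ∀ n → N ≤ᴺ n → q ⊕ η ≼ ℚ.∣ seq μ n ∣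
      large′ n N≤n = let a = ℚ.∣ seq μ n ∣
                         b = ℚ.∣ seq μ N ∣
                     in ≼-from-diff ((a ⊕ η ⊖ b) ⊕ (b ⊖ (q ⊕ δ)))
        (trans (solve 4 (λ a b q η → a := q :+ η :+ ((a :+ η :- b) :+ (b :- (q :+ (η :+ η))))) refl a b q η)
          (cong (λ d → q ⊕ η ⊕ ((a ⊕ η ⊖ b) ⊕ (b ⊖ (q ⊕ d)))) η+η))
        (ℚₚ.<⇒≤ (0≺-diff (∣∣≺⇒≺ b a (close N n ℕₚ.≤-refl N≤n)))
          ⊕≼ 0≼-diff (ℚₚ.≮⇒≥ large))
      vanishes : ∀ i → x i ≈ 0ℝ
      vanishes i θ 0<θ =
        let κ , 0<κ , κ+κ = halves 0<θ
            -- The tolerance ξ solves ∑ y · ξ = η (y i κ), so that cancelling η and `y i` leaves |x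
            -- i| ≤ κ = θ/2 < θ.
            ξ , 0<ξ , yξ = divide (ℚₚ.<-≤-trans (0<y i) (term≼∑ (λ u → ℚₚ.<⇒≤ (0<y u)) i))
                                  (0<η ⊗≺ (0<y i ⊗≺ 0<κ))
            M , residual = uniformly (λ u → eigen u ξ 0<ξ)
        in N ℕ.⊔ M , λ n p →
          let small = approximate-eigenvector-small (λ u → seq (x u) n)
                (large′ n (ℕₚ.≤-trans (ℕₚ.m≤m⊔n N M) p)) (ℚₚ.<⇒≤ 0<η)
                (λ u → subst (λ t → ℚ.∣ t ⊖ seq μ n ⊗ seq (x u) n ∣ ≺ ξ) (seq-· G x u n)
                  (residual n (ℕₚ.≤-trans (ℕₚ.m≤n⊔m N M) p) u)) i
          in subst (λ t → ℚ.∣ t ∣ ≺ θ) (sym (ℚₚ.+-identityʳ (seq (x i) n)))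
               (ℚₚ.≤-<-trans
                 (ℚₚ.*-cancelˡ-≤-pos (y i) {{ℚ.positive (0<y i)}}
                   (ℚₚ.*-cancelˡ-≤-pos η {{ℚ.positive 0<η}}
                     (ℚₚ.≤-trans small (ℚₚ.≤-reflexive (trans (ℚₚ.*-comm ξ (∑ y)) yξ)))))
                 (≺-from-diff κ (sym κ+κ) 0<κ))

-- Blow-ups of small graphs

indicator : ∀ {k} → Fin k → Fin k → ℕ
indicator c d = if does (c ≟ d) then 1 else 0

count : ∀ {n k} → (Fin n → Fin k) → Fin k → ℕ
count ρ c = ℕΣ.sum (λ v → indicator (ρ v) c)

-- This form serves two ends: on vectors constant on roles the adjacency matrix acts as a k by k
-- system, and `Q` with `size` determines the graph up to isomorphism. A size may be 0, so one `Q`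
-- also covers graphs with pendant vertices at a single host.
record Blowup {n k} (G : Graph n) (Q : Fin k → Fin k → Bool) (size : Fin k → ℕ) : Set where
  field
    role      : Fin n → Fin k
    adjacency : ∀ u v → adj G u v ≡ Q (role u) (role v)
    sizes     : ∀ c → count role c ≡ size c

∑-indicator : ∀ {k} c (g : Fin k → ℚ) → ∑ (λ d → fromℕ (indicator c d) ⊗ g d) ≡ g c
∑-indicator {suc k} zero g = trans
  (cong₂ _⊕_ (ℚₚ.*-identityˡ (g zero))
    (trans (ℚΣ.sum-cong-≗ (λ d → ℚₚ.*-zeroˡ (g (suc d)))) (ℚΣ.sum-replicate-zero k)))
  (ℚₚ.+-identityʳ (g zero))
∑-indicator {suc k} (suc c) g = trans
  (cong₂ _⊕_ (ℚₚ.*-zeroˡ (g zero)) (∑-indicator c (g ∘ suc)))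
  (ℚₚ.+-identityˡ (g (suc c)))

∑-by-role : ∀ {n k} (ρ : Fin n → Fin k) (g : Fin k → ℚ) →
  ∑ (λ v → g (ρ v)) ≡ ∑ (λ c → fromℕ (count ρ c) ⊗ g c)
∑-by-role {zero} {k} ρ g = sym (trans (ℚΣ.sum-cong-≗ (λ c → ℚₚ.*-zeroˡ (g c))) (ℚΣ.sum-replicate-zero k))
∑-by-role {suc n} ρ g = sym (trans
  (ℚΣ.sum-cong-≗ λ c → trans
    (cong (_⊗ g c) (fromℕ-+ (indicator (ρ zero) c) (count (ρ ∘ suc) c)))
    (ℚₚ.*-distribʳ-+ (g c) (fromℕ (indicator (ρ zero) c)) (fromℕ (count (ρ ∘ suc) c))))
  (trans (ℚΣ.∑-distrib-+ (λ c → fromℕ (indicator (ρ zero) c) ⊗ g c)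
                         (λ c → fromℕ (count (ρ ∘ suc) c) ⊗ g c))
    (cong₂ _⊕_ (∑-indicator (ρ zero) g) (sym (∑-by-role (ρ ∘ suc) g)))))

sum-indicator : ∀ {k} (c : Fin k) → ℕΣ.sum (indicator c) ≡ 1
sum-indicator {suc k} zero    = cong suc (ℕΣ.sum-replicate-zero k)
sum-indicator {suc k} (suc c) = sum-indicator c

sum-count : ∀ {n k} (ρ : Fin n → Fin k) → ℕΣ.sum (count ρ) ≡ n
sum-count {zero}  {k} ρ = ℕΣ.sum-replicate-zero k
sum-count {suc n} ρ = trans (ℕΣ.∑-distrib-+ (indicator (ρ zero)) (count (ρ ∘ suc)))
  (cong₂ _+ᴺ_ (sum-indicator (ρ zero)) (sum-count (ρ ∘ suc)))

indicator-refl : ∀ {k} (c : Fin k) → indicator c c ≡ 1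
indicator-refl c with c ≟ c
... | yes _  = refl
... | no c≢c = ⊥-elim (c≢c refl)

indicator-≢ : ∀ {k} {c d : Fin k} → c ≢ d → indicator c d ≡ 0
indicator-≢ {c = c} {d} c≢d with c ≟ d
... | yes c≡d = ⊥-elim (c≢d c≡d)
... | no _    = refl

count-witness : ∀ {n k} (ρ : Fin n → Fin k) c → count ρ c ≢ 0 → ∃[ v ] ρ v ≡ c
count-witness {n} ρ c nonzero with Finₚ.any? (λ v → ρ v ≟ c)
... | yes found = found
... | no none   = ⊥-elim (nonzero (trans
  (ℕΣ.sum-cong-≗ (λ v → indicator-≢ λ eq → none (v , eq))) (ℕΣ.sum-replicate-zero n)))

-- Vertex 0 is matched with some vertex `j` of the same role; deleting both preserves equality of
-- the counts, and the permutation of the rest is extended by 0 ↦ j.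
equal-counts⇒permutation : ∀ {m n k} (ρ : Fin m → Fin k) (σ : Fin n → Fin k) →
  (∀ c → count ρ c ≡ count σ c) → Σ[ π ∈ Permutation m n ] ∀ u → ρ u ≡ σ (π ⟨$⟩ʳ u)
equal-counts⇒permutation {zero}  {zero}  ρ σ eq = Perm.id , λ ()
equal-counts⇒permutation {zero}  {suc n} ρ σ eq =
  ⊥-elim (ℕₚ.1+n≢0 (trans (cong (_+ᴺ count (σ ∘ suc) (σ zero)) (sym (indicator-refl (σ zero))))
    (sym (eq (σ zero)))))
equal-counts⇒permutation {suc m} {n} ρ σ eq with count-witness σ (ρ zero)
  (λ 0≡ → ℕₚ.1+n≢0 (trans (cong (_+ᴺ count (ρ ∘ suc) (ρ zero)) (sym (indicator-refl (ρ zero))))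
    (trans (eq (ρ zero)) 0≡)))
equal-counts⇒permutation {suc m} {suc n} ρ σ eq | j , σj≡ρ0
  with equal-counts⇒permutation (ρ ∘ suc) (σ ∘ punchIn j) (λ c → ℕₚ.+-cancelˡ-≡ (indicator (ρ zero) c) _ _
    (trans (eq c) (trans (ℕΣ.sum-remove {i = j} (λ v → indicator (σ v) c))
      (cong (λ d → indicator d c +ᴺ count (σ ∘ punchIn j) c) σj≡ρ0))))
... | π , match = Perm.insert zero j π , λ where
  zero    → sym σj≡ρ0
  (suc u) → trans (match u) (cong σ (sym (Perm.insert-punchIn zero j π u)))

blowup-≅ : ∀ {m n k} {G : Graph m} {H : Graph n} {Q : Fin k → Fin k → Bool} {size} →
  Blowup G Q size → Blowup H Q size → G ≅ H
blowup-≅ {Q = Q} B C with equal-counts⇒permutation (Blowup.role B) (Blowup.role C)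
  (λ c → trans (Blowup.sizes B c) (sym (Blowup.sizes C c)))
... | π , match = record
  { vertices  = π
  ; preserves = λ u v → trans (Blowup.adjacency B u v)
      (trans (cong₂ Q (match u) (match v)) (sym (Blowup.adjacency C (π ⟨$⟩ʳ u) (π ⟨$⟩ʳ v))))
  }

row-blowup : ∀ {n k} {G : Graph n} {Q : Fin k → Fin k → Bool} {size} (B : Blowup G Q size)
  (X : Fin k → ℚ) u → let open Blowup B in
  row G (λ v → X (role v)) u ≡ ∑ (λ c → fromℕ (size c) ⊗ (entry (Q (role u) c) ⊗ X c))
row-blowup {Q = Q} B X u = trans
  (ℚΣ.sum-cong-≗ λ v → cong (λ a → entry a ⊗ X (role v)) (adjacency u v))
  (trans (∑-by-role role (λ c → entry (Q (role u) c) ⊗ X c))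
    (ℚΣ.sum-cong-≗ λ c → cong (λ s → fromℕ s ⊗ (entry (Q (role u) c) ⊗ X c)) (sizes c)))
  where open Blowup B

-- Continuous functions, as far as they are needed: those which act on ℝ pointwise.

record ActsOnℝ (f : ℚ → ℚ) : Set where
  constructor acts
  field
    image-cauchy : ∀ x → IsCauchy (λ n → f (seq x n))

  image : ℝ → ℝ
  image x = mkℝ (λ n → f (seq x n)) (image-cauchy x)

open ActsOnℝ using (image; image-cauchy)

id-acts : ActsOnℝ (λ q → q)
id-acts = acts cauchy

const-acts : ∀ p → ActsOnℝ (const p)
const-acts p = acts λ _ → cauchy (fromℚ p)

infixl 6 _⊕-acts_ _⊖-acts_
infixl 7 _⊗-acts_

_⊕-acts_ : ∀ {f g} → ActsOnℝ f → ActsOnℝ g → ActsOnℝ (λ q → f q ⊕ g q)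
F ⊕-acts G = acts λ x → cauchy (image F x + image G x)

_⊗-acts_ : ∀ {f g} → ActsOnℝ f → ActsOnℝ g → ActsOnℝ (λ q → f q ⊗ g q)
F ⊗-acts G = acts λ x → cauchy (image F x * image G x)

_⊖-acts_ : ∀ {f g} → ActsOnℝ f → ActsOnℝ g → ActsOnℝ (λ q → f q ⊖ g q)
_⊖-acts_ {f} {g} F G = acts λ x → subst-cauchy x (cauchy (image F x + fromℚ (ℚ.- 1ℚ) * image G x))
  where
  eq : ∀ x n → f (seq x n) ⊕ (ℚ.- 1ℚ) ⊗ g (seq x n) ≡ f (seq x n) ⊖ g (seq x n)
  eq x n = solve 2 (λ a b → a :+ con (ℚ.- 1ℚ) :* b := a :- b) refl (f (seq x n)) (g (seq x n))
  subst-cauchy : ∀ x → IsCauchy (λ n → f (seq x n) ⊕ (ℚ.- 1ℚ) ⊗ g (seq x n)) →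
    IsCauchy (λ n → f (seq x n) ⊖ g (seq x n))
  subst-cauchy x c ε 0<ε = let N , close = c ε 0<ε in
    N , λ m n p q → subst₂ (λ a b → ℚ.∣ a ⊖ b ∣ ≺ ε) (eq x m) (eq x n) (close m n p q)

-- An eigenvector depending polynomially on its eigenvalue: it solves every
-- equation of the quotient system up to a multiple 0 or 1 of f.
module _ {n k} {G : Graph n} {Q : Fin k → Fin k → Bool} {size} (B : Blowup G Q size)
  {f : ℚ → ℚ} (f-acts : ActsOnℝ f)
  (X : Fin k → ℚ → ℚ) (X-acts : ∀ c → ActsOnℝ (X c)) (defect : Fin k → Bool)
  (system : ∀ c q → ∑ (λ d → fromℕ (size d) ⊗ (entry (Q c d) ⊗ X d q)) ⊕ entry (defect c) ⊗ f q ≡ q ⊗ X c q)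
  where
  open Blowup B
  open Bisection f

  -- The residual of each equation is 0 or -f, which tends to 0 along the bisection sequence. The
  -- bound at the one vertex `u` keeps its coordinate at least 1 along the whole sequence, so the
  -- limit vector is nonzero.
  root-eigenvalue : (b : Bracket) → ∀ u → (∀ q → lo b ≼ q → 1ℚ ≼ X (role u) q) →
    IsEigenvalue (adjacencyMatrix G) (root b)
  root-eigenvalue b u₀ 1≤X = x , x≉0 , eigen
    where
    q : ℕ → ℚ
    q = seq (root b)
    x : Fin n → ℝ
    x u = mkℝ (λ m → X (role u) (q m)) (image-cauchy (X-acts (role u)) (root b))
    x≉0 : ¬ (∀ u → x u ≈ 0ℝ)
    x≉0 x≈0 with x≈0 u₀ 1ℚ (from-yes (0ℚ ℚₚ.<? 1ℚ))
    ... | N , close = ≺⇒⋡ (subst (X (role u₀) (q N) ≺_) (ℚₚ.+-identityˡ 1ℚ)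
      (∣∣≺⇒≺ (X (role u₀) (q N)) 0ℚ (close N ℕₚ.≤-refl))) (1≤X (q N) (lo≼zigzag b N))
    residual : ∀ u m → seq ((adjacencyMatrix G · x) u) m ⊖ q m ⊗ seq (x u) m ≡
      ℚ.- (entry (defect (role u)) ⊗ f (q m))
    residual u m = trans
      (cong₂ _⊖_ (trans (seq-· G x u m) (row-blowup B (λ c → X c (q m)) u)) (sym (system (role u) (q m))))
      (solve 2 (λ s t → s :- (s :+ t) := :- t) refl
        (∑ (λ d → fromℕ (size d) ⊗ (entry (Q (role u) d) ⊗ X d (q m))))
        (entry (defect (role u)) ⊗ f (q m)))
    ∣entry∣≼ : ∀ c p → ℚ.∣ ℚ.- (entry c ⊗ p) ∣ ≼ ℚ.∣ p ∣
    ∣entry∣≼ true  p = ℚₚ.≤-reflexive (trans (ℚₚ.∣-p∣≡∣p∣ (1ℚ ⊗ p)) (cong ℚ.∣_∣ (ℚₚ.*-identityˡ p)))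
    ∣entry∣≼ false p = subst (λ t → ℚ.∣ ℚ.- t ∣ ≼ ℚ.∣ p ∣) (sym (ℚₚ.*-zeroˡ p)) (ℚₚ.0≤∣p∣ p)
    eigen : ∀ u → (adjacencyMatrix G · x) u ≈ root b * x u
    eigen u ε 0<ε = let N , small = root-vanishes b (image-cauchy f-acts (root b)) ε 0<ε in
      N , λ m N≤m → subst (λ t → ℚ.∣ t ∣ ≺ ε) (sym (residual u m))
        (ℚₚ.≤-<-trans (∣entry∣≼ (defect (role u)) (f (q m))) (small m N≤m))

  spectral-radius-lower : ∀ {r} → IsSpectralRadius G r →
    (b : Bracket) → ∀ u → (∀ q → lo b ≼ q → 1ℚ ≼ X (role u) q) → fromℚ (lo b) ≤ r
  spectral-radius-lower {r} (_ , maximal) b u 1≤X =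
    ≤-trans {fromℚ (lo b)} {∣ root b ∣} {r}
      (λ ε 0<ε → 0 , λ m _ → ℚₚ.≤-<-trans (ℚₚ.≤-trans (lo≼zigzag b m) (p≼∣p∣ (seq (root b) m)))
        (≺-from-diff ε refl 0<ε))
      (maximal (root b) (root-eigenvalue b u 1≤X))

spectral-radius-upper : ∀ {n k} {G : Graph n} {Q : Fin k → Fin k → Bool} {size} (B : Blowup G Q size)
  (X : Fin k → ℚ) → (∀ c → 0ℚ ≺ X c) →
  ∀ {q} → (∀ c → ∑ (λ d → fromℕ (size d) ⊗ (entry (Q c d) ⊗ X d)) ≼ q ⊗ X c) →
  ∀ {r} → IsSpectralRadius G r → r ≤ fromℚ q
spectral-radius-upper {G = G} B X 0<X {q} super {r} ((μ , eigen , ∣μ∣≈r) , _) =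
  ≤-trans {r} {∣ μ ∣} {fromℚ q} (≈⇒≤ {r} {∣ μ ∣} (≈-sym {∣ μ ∣} {r} ∣μ∣≈r))
    (eigenvalue-bound G q (λ v → X (role v)) (λ v → 0<X (role v))
      (λ u → subst (_≼ q ⊗ X (role u)) (sym (row-blowup B X u)) (super (role u))) μ eigen)
  where open Blowup B

-- Isomorphism invariance

≅-sym : ∀ {m n} {G : Graph m} {H : Graph n} → G ≅ H → H ≅ G
≅-sym {G = G} {H} i = record
  { vertices  = ↔-sym vertices
  ; preserves = λ u v → sym (trans (preserves (from u) (from v))
      (cong₂ (adj H) (strictlyInverseˡ u) (strictlyInverseˡ v)))
  }
  where
  open _≅_ i
  open Inverse vertices

eigenvalue-≅ : ∀ {m n} {G : Graph m} {H : Graph n} → G ≅ H → ∀ μ →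
  IsEigenvalue (adjacencyMatrix G) μ → IsEigenvalue (adjacencyMatrix H) μ
eigenvalue-≅ {G = G} {H} i μ (x , x≉0 , eigen) = x ∘ from
  , (λ vanishes → x≉0 λ u → subst (λ w → x w ≈ 0ℝ) (strictlyInverseʳ u) (vanishes (to u)))
  , λ v ε 0<ε → let N , close = eigen (from v) ε 0<ε in
      N , λ k N≤k → subst (λ t → ℚ.∣ t ⊖ seq μ k ⊗ seq (x (from v)) k ∣ ≺ ε) (same v k) (close k N≤k)
  where
  open _≅_ i
  open Inverse vertices
  same : ∀ v k → seq ((adjacencyMatrix G · x) (from v)) k ≡ seq ((adjacencyMatrix H · (x ∘ from)) v) k
  same v k = trans (seq-· G x (from v) k) (sym (trans (seq-· H (x ∘ from) v k)
    (trans (ℚΣ.sum-permute (λ w → entry (adj H v w) ⊗ seq (x (from w)) k) vertices)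
      (ℚΣ.sum-cong-≗ λ w → cong₂ (λ a y → entry a ⊗ seq (x y) k)
        (trans (cong (λ v → adj H v (to w)) (sym (strictlyInverseˡ v))) (sym (preserves (from v) w)))
        (strictlyInverseʳ w)))))

spectral-radius-≅-≤ : ∀ {m n} {G : Graph m} {H : Graph n} → G ≅ H → ∀ {r s} →
  IsSpectralRadius G r → IsSpectralRadius H s → r ≤ s
spectral-radius-≅-≤ {G = G} {H} i {r} {s} ((μ , eigen , ∣μ∣≈r) , _) (_ , maximal) =
  ≤-trans {r} {∣ μ ∣} {s} (≈⇒≤ {r} {∣ μ ∣} (≈-sym {∣ μ ∣} {r} ∣μ∣≈r))
    (maximal μ (eigenvalue-≅ {G = G} {H} i μ eigen))

spectral-radius-≅ : ∀ {m n} {G : Graph m} {H : Graph n} → G ≅ H → ∀ {r s} →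
  IsSpectralRadius G r → IsSpectralRadius H s → r ≈ s
spectral-radius-≅ {G = G} {H} i {r} {s} ρ σ =
  ≤-antisym {r} {s} (spectral-radius-≅-≤ i {r} {s} ρ σ)
    (spectral-radius-≅-≤ (≅-sym {G = G} {H} i) {s} {r} σ ρ)

-- The three families and their eigenvectors

-- The square with a pendant vertices at x and b at the opposite vertex y is
-- the blow-up with roles z (the two other vertices of the square), x, y,
-- pendant at x, pendant at y.
square : Fin 5 → Fin 5 → Bool
square 0F 1F = true
square 0F 2F = true
square 1F 0F = true
square 1F 3F = true
square 2F 0F = true
square 2F 4F = true
square 3F 1F = true
square 4F 2F = true
square _  _  = false

squareSize : ℕ → ℕ → Fin 5 → ℕ
squareSize a b 0F = 2
squareSize a b 1F = 1
squareSize a b 2F = 1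
squareSize a b 3F = a
squareSize a b 4F = b

-- The triangle z x y, with pendant vertices at x and y.
triangle : Fin 5 → Fin 5 → Bool
triangle 1F 2F = true
triangle 2F 1F = true
triangle c  d  = square c d

triangleSize : ℕ → ℕ → Fin 5 → ℕ
triangleSize a b 0F = 1
triangleSize a b 1F = 1
triangleSize a b 2F = 1
triangleSize a b 3F = a
triangleSize a b 4F = b

-- The triangle 0 1 2, a hub 3 attached to 0, and pendant vertices at the hub.
paw : Fin 5 → Fin 5 → Bool
paw 0F 1F = true
paw 0F 2F = true
paw 0F 3F = true
paw 1F 0F = true
paw 1F 2F = true
paw 2F 0F = true
paw 2F 1F = true
paw 3F 0F = true
paw 3F 4F = true
paw 4F 3F = true
paw _  _  = false

pawSize : ℕ → Fin 5 → ℕ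
pawSize c 4F = c
pawSize c _  = 1

two four : ℚ
two  = fromℕ 2
four = fromℕ 4

-- Syntactic mirror of the unfolded `∑` over `Fin 5`, so that the evaluated polynomial equation
-- agrees definitionally with `system`.
∑ᵖ : ∀ {n} → (s e x : Fin 5 → Polynomial n) → Polynomial n
∑ᵖ s e x = s 0F :* (e 0F :* x 0F) :+ (s 1F :* (e 1F :* x 1F) :+ (s 2F :* (e 2F :* x 2F) :+
  (s 3F :* (e 3F :* x 3F) :+ (s 4F :* (e 4F :* x 4F) :+ con 0ℚ))))

-- λ² is the larger root of (t - a - 2) (t - b - 2) = 4.
module Square (a b : ℕ) where
  α = fromℕ a
  β = fromℕ b

  f : ℚ → ℚ
  f q = (q ⊗ q ⊖ (α ⊕ two)) ⊗ (q ⊗ q ⊖ (β ⊕ two)) ⊖ four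

  f-acts : ActsOnℝ f
  f-acts = (id-acts ⊗-acts id-acts ⊖-acts const-acts (α ⊕ two)) ⊗-acts
           (id-acts ⊗-acts id-acts ⊖-acts const-acts (β ⊕ two)) ⊖-acts const-acts four

  -- Found by elimination: starting from the value 2 at the pendant vertices of x, the equations at
  -- 3F, 1F, 0F and 4F determine in turn the values at x, at z, at y and at the pendant vertices of
  -- y. What remains at y is `f`.
  X : Fin 5 → ℚ → ℚ
  X 0F q = q ⊗ q ⊖ α
  X 1F q = two ⊗ q
  X 2F q = q ⊗ (q ⊗ q ⊖ (α ⊕ two))
  X 3F q = two
  X 4F q = q ⊗ q ⊖ (α ⊕ two)

  X-acts : ∀ c → ActsOnℝ (X c)
  X-acts 0F = id-acts ⊗-acts id-acts ⊖-acts const-acts α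
  X-acts 1F = const-acts two ⊗-acts id-acts
  X-acts 2F = id-acts ⊗-acts (id-acts ⊗-acts id-acts ⊖-acts const-acts (α ⊕ two))
  X-acts 3F = const-acts two
  X-acts 4F = id-acts ⊗-acts id-acts ⊖-acts const-acts (α ⊕ two)

  defect : Fin 5 → Bool
  defect 2F = true
  defect _  = false

  system : ∀ c q → ∑ (λ d → fromℕ (squareSize a b d) ⊗ (entry (square c d) ⊗ X d q))
    ⊕ entry (defect c) ⊗ f q ≡ q ⊗ X c q
  system = λ where
      0F → solve 3 (eqn 0F) refl α β
      1F → solve 3 (eqn 1F) refl α β
      2F → solve 3 (eqn 2F) refl α β
      3F → solve 3 (eqn 3F) refl α β
      4F → solve 3 (eqn 4F) refl α β
    where
    sᵖ : Polynomial 3 → Polynomial 3 → Fin 5 → Polynomial 3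
    sᵖ a b 0F = con two
    sᵖ a b 1F = con 1ℚ
    sᵖ a b 2F = con 1ℚ
    sᵖ a b 3F = a
    sᵖ a b 4F = b
    Xᵖ : Polynomial 3 → Polynomial 3 → Fin 5 → Polynomial 3
    Xᵖ a q 0F = q :* q :- a
    Xᵖ a q 1F = con two :* q
    Xᵖ a q 2F = q :* (q :* q :- (a :+ con two))
    Xᵖ a q 3F = con two
    Xᵖ a q 4F = q :* q :- (a :+ con two)
    eqn : Fin 5 → Polynomial 3 → Polynomial 3 → Polynomial 3 → Polynomial 3 × Polynomial 3
    eqn c a b q = ∑ᵖ (sᵖ a b) (λ d → con (entry (square c d))) (Xᵖ a q)
      :+ con (entry (defect c)) :* ((q :* q :- (a :+ con two)) :* (q :* q :- (b :+ con two)) :- con four)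
      := q :* Xᵖ a q c

-- λ is the largest root of (t - a - 1) (t - b - 1) = (λ + 1)², where t = λ².
module Triangle (a b : ℕ) where
  α = fromℕ a
  β = fromℕ b

  f : ℚ → ℚ
  f q = (q ⊗ q ⊖ (α ⊕ 1ℚ)) ⊗ (q ⊗ q ⊖ (β ⊕ 1ℚ)) ⊖ (q ⊕ 1ℚ) ⊗ (q ⊕ 1ℚ)

  f-acts : ActsOnℝ f
  f-acts = (id-acts ⊗-acts id-acts ⊖-acts const-acts (α ⊕ 1ℚ)) ⊗-acts
           (id-acts ⊗-acts id-acts ⊖-acts const-acts (β ⊕ 1ℚ)) ⊖-acts
           (id-acts ⊕-acts const-acts 1ℚ) ⊗-acts (id-acts ⊕-acts const-acts 1ℚ)

  -- The equations at x and z now both involve z and y; eliminating y divides by q + 1. Starting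
  -- from q + 1 instead of a constant at the pendant vertices of x keeps all entries polynomial.
  X : Fin 5 → ℚ → ℚ
  X 0F q = q ⊗ q ⊕ q ⊖ α
  X 1F q = q ⊗ (q ⊕ 1ℚ)
  X 2F q = q ⊗ (q ⊗ q ⊖ (α ⊕ 1ℚ))
  X 3F q = q ⊕ 1ℚ
  X 4F q = q ⊗ q ⊖ (α ⊕ 1ℚ)

  X-acts : ∀ c → ActsOnℝ (X c)
  X-acts 0F = id-acts ⊗-acts id-acts ⊕-acts id-acts ⊖-acts const-acts α
  X-acts 1F = id-acts ⊗-acts (id-acts ⊕-acts const-acts 1ℚ)
  X-acts 2F = id-acts ⊗-acts (id-acts ⊗-acts id-acts ⊖-acts const-acts (α ⊕ 1ℚ))
  X-acts 3F = id-acts ⊕-acts const-acts 1ℚ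
  X-acts 4F = id-acts ⊗-acts id-acts ⊖-acts const-acts (α ⊕ 1ℚ)

  defect : Fin 5 → Bool
  defect 2F = true
  defect _  = false

  system : ∀ c q → ∑ (λ d → fromℕ (triangleSize a b d) ⊗ (entry (triangle c d) ⊗ X d q))
    ⊕ entry (defect c) ⊗ f q ≡ q ⊗ X c q
  system = λ where
      0F → solve 3 (eqn 0F) refl α β
      1F → solve 3 (eqn 1F) refl α β
      2F → solve 3 (eqn 2F) refl α β
      3F → solve 3 (eqn 3F) refl α β
      4F → solve 3 (eqn 4F) refl α β
    where
    sᵖ : Polynomial 3 → Polynomial 3 → Fin 5 → Polynomial 3
    sᵖ a b 0F = con 1ℚ
    sᵖ a b 1F = con 1ℚ
    sᵖ a b 2F = con 1ℚ
    sᵖ a b 3F = a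
    sᵖ a b 4F = b
    Xᵖ : Polynomial 3 → Polynomial 3 → Fin 5 → Polynomial 3
    Xᵖ a q 0F = q :* q :+ q :- a
    Xᵖ a q 1F = q :* (q :+ con 1ℚ)
    Xᵖ a q 2F = q :* (q :* q :- (a :+ con 1ℚ))
    Xᵖ a q 3F = q :+ con 1ℚ
    Xᵖ a q 4F = q :* q :- (a :+ con 1ℚ)
    eqn : Fin 5 → Polynomial 3 → Polynomial 3 → Polynomial 3 → Polynomial 3 × Polynomial 3
    eqn c a b q = ∑ᵖ (sᵖ a b) (λ d → con (entry (triangle c d))) (Xᵖ a q)
      :+ con (entry (defect c)) :* ((q :* q :- (a :+ con 1ℚ)) :* (q :* q :- (b :+ con 1ℚ))
           :- (q :+ con 1ℚ) :* (q :+ con 1ℚ))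
      := q :* Xᵖ a q c

-- λ is the largest root of λ (λ - 1) (t - c - 1) = 2 (t - c), where t = λ².
module Paw (c : ℕ) where
  γ = fromℕ c

  f : ℚ → ℚ
  f q = q ⊗ (q ⊖ 1ℚ) ⊗ (q ⊗ q ⊖ (γ ⊕ 1ℚ)) ⊖ two ⊗ (q ⊗ q ⊖ γ)

  f-acts : ActsOnℝ f
  f-acts = id-acts ⊗-acts (id-acts ⊖-acts const-acts 1ℚ) ⊗-acts
             (id-acts ⊗-acts id-acts ⊖-acts const-acts (γ ⊕ 1ℚ)) ⊖-acts
           const-acts two ⊗-acts (id-acts ⊗-acts id-acts ⊖-acts const-acts γ)

  X : Fin 5 → ℚ → ℚ
  X 0F q = two ⊗ (q ⊗ q ⊖ γ)
  X 1F q = q ⊗ (q ⊗ q ⊖ (γ ⊕ 1ℚ))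
  X 2F q = q ⊗ (q ⊗ q ⊖ (γ ⊕ 1ℚ))
  X 3F q = two ⊗ q
  X 4F q = two

  X-acts : ∀ d → ActsOnℝ (X d)
  X-acts 0F = const-acts two ⊗-acts (id-acts ⊗-acts id-acts ⊖-acts const-acts γ)
  X-acts 1F = id-acts ⊗-acts (id-acts ⊗-acts id-acts ⊖-acts const-acts (γ ⊕ 1ℚ))
  X-acts 2F = id-acts ⊗-acts (id-acts ⊗-acts id-acts ⊖-acts const-acts (γ ⊕ 1ℚ))
  X-acts 3F = const-acts two ⊗-acts id-acts
  X-acts 4F = const-acts two

  -- Roles 1F and 2F are adjacent twins, hence separate roles with equal entries of `X`; both carry
  -- the same residual equation.
  defect : Fin 5 → Bool
  defect 1F = true
  defect 2F = true
  defect _  = false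

  system : ∀ d q → ∑ (λ e → fromℕ (pawSize c e) ⊗ (entry (paw d e) ⊗ X e q))
    ⊕ entry (defect d) ⊗ f q ≡ q ⊗ X d q
  system = λ where
      0F → solve 2 (eqn 0F) refl γ
      1F → solve 2 (eqn 1F) refl γ
      2F → solve 2 (eqn 2F) refl γ
      3F → solve 2 (eqn 3F) refl γ
      4F → solve 2 (eqn 4F) refl γ
    where
    sᵖ : Polynomial 2 → Fin 5 → Polynomial 2
    sᵖ c 4F = c
    sᵖ c _  = con 1ℚ
    Xᵖ : Polynomial 2 → Polynomial 2 → Fin 5 → Polynomial 2
    Xᵖ c q 0F = con two :* (q :* q :- c)
    Xᵖ c q 1F = q :* (q :* q :- (c :+ con 1ℚ))
    Xᵖ c q 2F = q :* (q :* q :- (c :+ con 1ℚ))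
    Xᵖ c q 3F = con two :* q
    Xᵖ c q 4F = con two
    eqn : Fin 5 → Polynomial 2 → Polynomial 2 → Polynomial 2 × Polynomial 2
    eqn d c q = ∑ᵖ (sᵖ c) (λ e → con (entry (paw d e))) (Xᵖ c q)
      :+ con (entry (defect d)) :* (q :* (q :- con 1ℚ) :* (q :* q :- (c :+ con 1ℚ))
           :- con two :* (q :* q :- c))
      := q :* Xᵖ c q d

-- Separation by rational windows

excess : ℕ → ℚ → ℚ
excess n q = two ⊗ (q ⊗ q) ⊖ fromℕ n

-- The square of the spectral radius of the balanced G₁ on n vertices is n/2 + 2
-- or n/2 + √17/2 ≈ n/2 + 2.06; a window separates it from the competitors.
record Window (n : ℕ) : Set where
  field
    left right : ℚ
    2≼left     : two ≼ left
    left≺right : left ≺ right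
    4∙14≼left  : (+ 414 / 100) ≼ excess n left
    0≼right    : 0ℚ ≼ excess n right
    right≼4∙2  : excess n right ≼ (+ 42 / 10)

  2≼right : two ≼ right
  2≼right = ℚₚ.≤-trans 2≼left (ℚₚ.<⇒≤ left≺right)

¼ : ℚ
¼ = + 1 / 4

0≼_by : ∀ p {_ : True (0ℚ ℚₚ.≤? p)} → 0ℚ ≼ p
0≼_by p {t} = toWitness t

0≺_by : ∀ p {_ : True (0ℚ ℚₚ.<? p)} → 0ℚ ≺ p
0≺_by p {t} = toWitness t

-- The equation 2q² = n + 4.17, with 4.17 midway between 4.14 and 4.2, is bisected on [2, n] until
-- 4n (h - l) < 0.03. Since h ≤ n, 2h² - 2l² = 2 (h + l)(h - l) ≤ 4n (h - l), so both excesses stay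
-- within 0.03 of 4.17.
window : ∀ n → 6 ≤ᴺ n → Window n
window n 6≤n = record
  { left = lo b ; right = hi b ; 2≼left = lo≥
  ; left≺right = lo≺hi
  ; 4∙14≼left = ≼-from-diff (f (hi b) ⊕ (+ 3 / 100 ⊖ (½^ k) ⊗ (four ⊗ ν ⊗ width b₀)) ⊕ two ⊗ (two ⊗ (ν ⊖ hi b) ⊕ (hi b ⊖ lo b)) ⊗ (hi b ⊖ lo b))
      (trans (solve 3 (λ l h ν → con two :* (l :* l) :- ν :=
          con (+ 414 / 100) :+ ((con two :* (h :* h) :- (ν :+ con (+ 417 / 100)))
            :+ (con (+ 3 / 100) :- con four :* ν :* (h :- l))
            :+ con two :* (con two :* (ν :- h) :+ (h :- l)) :* (h :- l))) refl (lo b) (hi b) ν)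
        (cong (λ w → + 414 / 100 ⊕ (f (hi b) ⊕ (+ 3 / 100 ⊖ w) ⊕ two ⊗ (two ⊗ (ν ⊖ hi b) ⊕ (hi b ⊖ lo b)) ⊗ (hi b ⊖ lo b))) rescale))
      (above b ⊕≼ ℚₚ.<⇒≤ (0≺-diff small)
        ⊕≼ 0≼ two by ⊗≼ (0≼ two by ⊗≼ 0≼-diff hi≤ ⊕≼ 0≼-diff (lo≼hi b)) ⊗≼ 0≼-diff (lo≼hi b))
  ; 0≼right = subst (0ℚ ≼_) (solve 2 (λ h ν → (con two :* (h :* h) :- (ν :+ con (+ 417 / 100))) :+ con (+ 417 / 100) := con two :* (h :* h) :- ν) refl (hi b) ν)
      (above b ⊕≼ 0≼ + 417 / 100 by)
  ; right≼4∙2 = ≼-from-diff ((0ℚ ⊖ f (lo b)) ⊕ (+ 3 / 100 ⊖ (½^ k) ⊗ (four ⊗ ν ⊗ width b₀)) ⊕ two ⊗ (two ⊗ (ν ⊖ hi b) ⊕ (hi b ⊖ lo b)) ⊗ (hi b ⊖ lo b))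
      (trans (solve 3 (λ l h ν → con (+ 42 / 10) :=
          con two :* (h :* h) :- ν :+ ((con 0ℚ :- (con two :* (l :* l) :- (ν :+ con (+ 417 / 100))))
            :+ (con (+ 3 / 100) :- con four :* ν :* (h :- l))
            :+ con two :* (con two :* (ν :- h) :+ (h :- l)) :* (h :- l))) refl (lo b) (hi b) ν)
        (cong (λ w → two ⊗ (hi b ⊗ hi b) ⊖ ν ⊕ ((0ℚ ⊖ f (lo b)) ⊕ (+ 3 / 100 ⊖ w) ⊕ two ⊗ (two ⊗ (ν ⊖ hi b) ⊕ (hi b ⊖ lo b)) ⊗ (hi b ⊖ lo b))) rescale))
      (0≼-diff (ℚₚ.<⇒≤ (below b)) ⊕≼ ℚₚ.<⇒≤ (0≺-diff small)
        ⊕≼ 0≼ two by ⊗≼ (0≼ two by ⊗≼ 0≼-diff hi≤ ⊕≼ 0≼-diff (lo≼hi b)) ⊗≼ 0≼-diff (lo≼hi b))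
  }
  where
  ν : ℚ
  ν = fromℕ n
  f : ℚ → ℚ
  f q = two ⊗ (q ⊗ q) ⊖ (ν ⊕ + 417 / 100)
  open Bisection f
  6≼ν : 0ℚ ≼ ν ⊖ fromℕ 6
  6≼ν = 0≼-diff (fromℕ-mono 6≤n)
  b₀ : Bracket
  b₀ = bracket two ν
    (≼-from-diff ((ν ⊖ fromℕ 6) ⊕ four) (solve 1 (λ ν → ν := con two :+ (ν :- con (fromℕ 6) :+ con four)) refl ν)
      (6≼ν ⊕≼ 0≼ four by))
    (≺-from-diff ((ν ⊖ fromℕ 6) ⊕ + 217 / 100)
      (solve 1 (λ ν → con 0ℚ := con two :* (con two :* con two) :- (ν :+ con (+ 417 / 100)) :+ (ν :- con (fromℕ 6) :+ con (+ 217 / 100))) refl ν)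
      (6≼ν ⊕≺ 0≺ + 217 / 100 by))
    (subst (0ℚ ≼_) (solve 1 (λ ν → let g = ν :- con (fromℕ 6) in
        con two :* (g :* g) :+ con (fromℕ 23) :* g :+ con (+ 6183 / 100) := con two :* (ν :* ν) :- (ν :+ con (+ 417 / 100))) refl ν)
      (0≼ two by ⊗≼ (6≼ν ⊗≼ 6≼ν) ⊕≼ 0≼ fromℕ 23 by ⊗≼ 6≼ν ⊕≼ 0≼ + 6183 / 100 by))
  fine-enough = ½^-small (four ⊗ ν ⊗ width b₀) (0≺ + 3 / 100 by)
  k = proj₁ fine-enough
  small = proj₂ fine-enough
  b = proj₁ (refine k b₀)
  lo≥ = proj₁ (proj₂ (refine k b₀))
  hi≤ = proj₁ (proj₂ (proj₂ (refine k b₀)))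
  rescale : four ⊗ ν ⊗ (hi b ⊖ lo b) ≡ (½^ k) ⊗ (four ⊗ ν ⊗ width b₀)
  rescale = trans (cong (four ⊗ ν ⊗_) (proj₂ (proj₂ (proj₂ (refine k b₀)))))
    (solve 3 (λ ν t w → con four :* ν :* (t :* w) := t :* (con four :* ν :* w)) refl ν (½^ k) (width b₀))
  lo≺hi : lo b ≺ hi b
  lo≺hi = ℚₚ.≰⇒> λ hi≼lo → ≺⇒⋡ (below b)
    (subst (λ q → 0ℚ ≼ f q) (ℚₚ.≤-antisym hi≼lo (lo≼hi b)) (above b))

-- For S = A + B and D = A - B, 4AB = S² - D². As 4.14² = 17.1396, the bound D² ≤ 1 leaves 0.1396
-- above 16.
product-above : ∀ A B → (+ 414 / 100) ≼ A ⊕ B → 0ℚ ≼ A ⊖ B → A ⊖ B ≼ 1ℚ → 0ℚ ≼ A ⊗ B ⊖ four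
product-above A B σ≤S 0≤D D≤1 = subst (0ℚ ≼_)
  (solve 2 (λ A B → let σ = con (+ 414 / 100) ; S = A :+ B ; D = A :- B in
      con ¼ :* ((S :- σ) :* (S :- σ :+ con (+ 828 / 100)) :+ con (+ 1396 / 10000) :+ (con 1ℚ :- D) :* (con 1ℚ :+ D))
      := A :* B :- con four) refl A B)
  (0≼ ¼ by ⊗≼ (0≼-diff σ≤S ⊗≼ (0≼-diff σ≤S ⊕≼ 0≼ + 828 / 100 by) ⊕≼ 0≼ + 1396 / 10000 by
    ⊕≼ 0≼-diff D≤1 ⊗≼ (0≼1 ⊕≼ 0≤D)))

-- Again 4AB = S² - D²: here S² ≤ 4.2² = 17.64 and D² ≥ 4, which leaves 2.36 below 16.
product-below : ∀ A B → 0ℚ ≼ A ⊕ B → A ⊕ B ≼ (+ 42 / 10) → two ≼ A ⊖ B → A ⊗ B ⊖ four ≺ 0ℚ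
product-below A B 0≤S S≤τ 2≤D = ≺-from-diff _
  (solve 2 (λ A B → let τ = con (+ 42 / 10) ; S = A :+ B ; D = A :- B in
      con 0ℚ := A :* B :- con four :+
      con ¼ :* ((D :- con two) :* (D :- con two :+ con four) :+ (τ :- S) :* (τ :+ S) :+ con (+ 236 / 100))) refl A B)
  (0≺ ¼ by ⊗≺ ((0≼-diff 2≤D ⊗≼ (0≼-diff 2≤D ⊕≼ 0≼ four by) ⊕≼ 0≼-diff S≤τ ⊗≼ (0≼ + 42 / 10 by ⊕≼ 0≤S))
    ⊕≺ 0≺ + 236 / 100 by))

-- 4AB ≤ S² ≤ 5.2² = 27.04, while 4 (q + 1)² ≥ 36. The bound 5.2 is 4.2 + 1, since the two factors
-- for the triangle sum to the excess plus 1.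
product-below-square : ∀ A B q → 0ℚ ≼ A ⊕ B → A ⊕ B ≼ (+ 52 / 10) → two ≼ q →
  A ⊗ B ⊖ (q ⊕ 1ℚ) ⊗ (q ⊕ 1ℚ) ≺ 0ℚ
product-below-square A B q 0≤S S≤τ 2≤q = ≺-from-diff _
  (solve 3 (λ A B q → let τ = con (+ 52 / 10) ; S = A :+ B ; D = A :- B in
      con 0ℚ := A :* B :- (q :+ con 1ℚ) :* (q :+ con 1ℚ) :+
      con ¼ :* (D :* D :+ con four :* ((q :- con two) :* (q :- con two :+ con (fromℕ 6)))
        :+ (τ :- S) :* (τ :+ S) :+ con (+ 896 / 100))) refl A B q)
  (0≺ ¼ by ⊗≺ ((0≼square (A ⊖ B) ⊕≼ 0≼ four by ⊗≼ (0≼-diff 2≤q ⊗≼ (0≼-diff 2≤q ⊕≼ 0≼ fromℕ 6 by))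
    ⊕≼ 0≼-diff S≤τ ⊗≼ (0≼ + 52 / 10 by ⊕≼ 0≤S)) ⊕≺ 0≺ + 896 / 100 by))

1≼2q : ∀ {p q} → two ≼ p → p ≼ q → 1ℚ ≼ two ⊗ q
1≼2q {p} {q} 2≤p p≤q = ≼-from-diff (two ⊗ (q ⊖ two) ⊕ fromℕ 3)
  (solve 1 (λ q → con two :* q := con 1ℚ :+ (con two :* (q :- con two) :+ con (fromℕ 3))) refl q)
  (0≼ two by ⊗≼ 0≼-diff (ℚₚ.≤-trans 2≤p p≤q) ⊕≼ 0≼ fromℕ 3 by)

right≼right+n : ∀ q n → q ≼ q ⊕ fromℕ n
right≼right+n q n = ≼-from-diff (fromℕ n) refl (0≼fromℕ n)

role-witness : ∀ {n k} {G : Graph n} {Q : Fin k → Fin k → Bool} {size} (B : Blowup G Q size) c →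
  size c ≡ 1 → ∃[ u ] Blowup.role B u ≡ c
role-witness B c size≡1 = count-witness (Blowup.role B) c
  λ 0≡ → ℕₚ.1+n≢0 (trans (sym size≡1) (trans (sym (Blowup.sizes B c)) 0≡))

module _ (a b : ℕ) where
  open Square a b

  excess-square : ∀ q → excess (4 +ᴺ (a +ᴺ b)) q ≡ (q ⊗ q ⊖ (α ⊕ two)) ⊕ (q ⊗ q ⊖ (β ⊕ two))
  excess-square q = trans
    (cong (λ s → two ⊗ (q ⊗ q) ⊖ (1ℚ ⊕ (1ℚ ⊕ (1ℚ ⊕ (1ℚ ⊕ s))))) (fromℕ-+ a b))
    (solve 3 (λ a b q → con two :* (q :* q) :- (con 1ℚ :+ (con 1ℚ :+ (con 1ℚ :+ (con 1ℚ :+ (a :+ b))))) :=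
      (q :* q :- (a :+ con two)) :+ (q :* q :- (b :+ con two))) refl α β q)

  difference-square : ∀ q → (q ⊗ q ⊖ (α ⊕ two)) ⊖ (q ⊗ q ⊖ (β ⊕ two)) ≡ β ⊖ α
  difference-square q = solve 3 (λ a b q → (q :* q :- (a :+ con two)) :- (q :* q :- (b :+ con two)) := b :- a) refl α β q

  -- The eigenvector formula `X`, evaluated at the left end, is the test vector: f ≥ 0 there turns
  -- the defect into slack, and A = (S + D)/2 > 0 makes all entries positive.
  balanced-square-upper : a ≤ᴺ b → b ≤ᴺ suc a → (w : Window (4 +ᴺ (a +ᴺ b))) →
    ∀ {n} {H : Graph n} → Blowup H square (squareSize a b) →
    ∀ {s} → IsSpectralRadius H s → s ≤ fromℚ (Window.left w)
  balanced-square-upper a≤b b≤1+a w {H = H} B {s} =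
    spectral-radius-upper B (λ c → X c q) positive {q} super {s}
    where
    open Window w renaming (left to q)
    A′ B′ : ℚ
    A′ = q ⊗ q ⊖ (α ⊕ two)
    B′ = q ⊗ q ⊖ (β ⊕ two)
    4∙14≼S : (+ 414 / 100) ≼ A′ ⊕ B′
    4∙14≼S = subst (_ ≼_) (excess-square q) 4∙14≼left
    0≼D : 0ℚ ≼ A′ ⊖ B′
    0≼D = subst (0ℚ ≼_) (sym (difference-square q)) (0≼-diff (fromℕ-mono a≤b))
    0≼f : 0ℚ ≼ f q
    0≼f = product-above A′ B′ 4∙14≼S 0≼D
      (subst (_≼ 1ℚ) (sym (difference-square q))
        (≼-from-diff (1ℚ ⊕ α ⊖ β) (solve 2 (λ a b → con 1ℚ := b :- a :+ (con 1ℚ :+ a :- b)) refl α β)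
          (0≼-diff (fromℕ-mono b≤1+a))))
    0≺A : 0ℚ ≺ A′
    0≺A = subst (0ℚ ≺_)
      (solve 2 (λ A B → con ½ :* (((A :+ B) :- con (+ 414 / 100)) :+ (A :- B) :+ con (+ 414 / 100)) := A) refl A′ B′)
      (0≺ ½ by ⊗≺ (0≼-diff 4∙14≼S ⊕≼ 0≼D ⊕≺ 0≺ + 414 / 100 by))
    0≺q : 0ℚ ≺ q
    0≺q = ℚₚ.<-≤-trans (0≺ two by) 2≼left
    positive : ∀ c → 0ℚ ≺ X c q
    positive 0F = subst (0ℚ ≺_) (solve 2 (λ a q → con two :+ (q :* q :- (a :+ con two)) := q :* q :- a) refl α q)
      (0≼ two by ⊕≺ 0≺A)
    positive 1F = 0≺ two by ⊗≺ 0≺q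
    positive 2F = 0≺q ⊗≺ 0≺A
    positive 3F = 0≺ two by
    positive 4F = 0≺A
    super : ∀ c → ∑ (λ d → fromℕ (squareSize a b d) ⊗ (entry (square c d) ⊗ X d q)) ≼ q ⊗ X c q
    super c = ≼-from-diff (entry (defect c) ⊗ f q) (sym (system c q)) (0≼entry (defect c) ⊗≼ 0≼f)

  unbalanced-square-lower : suc (suc a) ≤ᴺ b → (w : Window (4 +ᴺ (a +ᴺ b))) →
    ∀ {n} {G : Graph n} → Blowup G square (squareSize a b) →
    ∀ {r} → IsSpectralRadius G r → fromℚ (Window.right w) ≤ r
  unbalanced-square-lower 2+a≤b w B {r} ρ = spectral-radius-lower B f-acts X X-acts defect system {r} ρ
    (bracket h (h ⊕ fromℕ (4 +ᴺ (a +ᴺ b))) (right≼right+n h (4 +ᴺ (a +ᴺ b))) f≺0 0≼f)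
    (proj₁ x) (λ q h≤q → subst (λ c → 1ℚ ≼ X c q) (sym (proj₂ x)) (1≼2q 2≼right h≤q))
    where
    open Window w renaming (right to h)
    open Bisection f
    x = role-witness B 1F refl
    A′ B′ g m : ℚ
    A′ = h ⊗ h ⊖ (α ⊕ two)
    B′ = h ⊗ h ⊖ (β ⊕ two)
    g = h ⊖ two
    f≺0 : f h ≺ 0ℚ
    f≺0 = product-below A′ B′
      (subst (0ℚ ≼_) (excess-square h) 0≼right)
      (subst (_≼ _) (excess-square h) right≼4∙2)
      (subst (two ≼_) (sym (difference-square h))
        (≼-from-diff (β ⊖ (1ℚ ⊕ (1ℚ ⊕ α)))
          (solve 2 (λ a b → b :- a := con two :+ (b :- (con 1ℚ :+ (con 1ℚ :+ a)))) refl α β)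
          (0≼-diff (fromℕ-mono 2+a≤b))))
    m = h ⊕ fromℕ (4 +ᴺ (a +ᴺ b))
    m≡ : m ≡ g ⊕ α ⊕ β ⊕ fromℕ 6
    m≡ = trans (cong (λ s → h ⊕ (1ℚ ⊕ (1ℚ ⊕ (1ℚ ⊕ (1ℚ ⊕ s))))) (fromℕ-+ a b))
      (solve 3 (λ a b h → h :+ (con 1ℚ :+ (con 1ℚ :+ (con 1ℚ :+ (con 1ℚ :+ (a :+ b))))) :=
        h :- con two :+ a :+ b :+ con (fromℕ 6)) refl α β h)
    0≼g : 0ℚ ≼ g
    0≼g = 0≼-diff 2≼right
    0≼f : 0ℚ ≼ f m
    -- The upper end m = h + n is generous: written in the nonnegative quantities g = h - 2, α, β,
    -- the two factors are d + 2 and d′ + 2, so f m = d d′ + 2 (d + d′).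
    0≼f = subst (λ m → 0ℚ ≼ f m) (sym m≡) (subst (0ℚ ≼_)
      (solve 3 (λ a b g → let k = g :+ a :+ b ; m = k :+ con (fromℕ 6) ; e = m :* k :+ con (fromℕ 5) :* m ; d = e :+ (g :+ b :+ con two) ; d′ = e :+ (g :+ a :+ con two) in
          d :* d′ :+ con two :* (d :+ d′) :=
          (m :* m :- (a :+ con two)) :* (m :* m :- (b :+ con two)) :- con four) refl α β g)
      (let 0≼k = 0≼g ⊕≼ 0≼fromℕ a ⊕≼ 0≼fromℕ b
           0≼m = 0≼k ⊕≼ 0≼ fromℕ 6 by
           0≼e = 0≼m ⊗≼ 0≼k ⊕≼ 0≼ fromℕ 5 by ⊗≼ 0≼m
           0≼d = 0≼e ⊕≼ (0≼g ⊕≼ 0≼fromℕ b ⊕≼ 0≼ two by)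
           0≼d′ = 0≼e ⊕≼ (0≼g ⊕≼ 0≼fromℕ a ⊕≼ 0≼ two by)
       in 0≼d ⊗≼ 0≼d′ ⊕≼ 0≼ two by ⊗≼ (0≼d ⊕≼ 0≼d′)))

module _ (a b : ℕ) where
  open Triangle a b

  triangle-lower : (w : Window (3 +ᴺ (a +ᴺ b))) →
    ∀ {n} {G : Graph n} → Blowup G triangle (triangleSize a b) →
    ∀ {r} → IsSpectralRadius G r → fromℚ (Window.right w) ≤ r
  triangle-lower w B {r} ρ = spectral-radius-lower B f-acts X X-acts defect system {r} ρ
    (bracket h (h ⊕ fromℕ (3 +ᴺ (a +ᴺ b))) (right≼right+n h (3 +ᴺ (a +ᴺ b))) f≺0 0≼f)
    (proj₁ x) (λ q h≤q → subst (λ c → 1ℚ ≼ X c q) (sym (proj₂ x)) (1≼X q h≤q))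
    where
    open Window w renaming (right to h)
    open Bisection f
    x = role-witness B 1F refl
    A′ B′ g m : ℚ
    A′ = h ⊗ h ⊖ (α ⊕ 1ℚ)
    B′ = h ⊗ h ⊖ (β ⊕ 1ℚ)
    g = h ⊖ two
    1≼X : ∀ q → h ≼ q → 1ℚ ≼ q ⊗ (q ⊕ 1ℚ)
    1≼X q h≤q = ≼-from-diff ((q ⊖ two) ⊗ (q ⊖ two) ⊕ fromℕ 5 ⊗ (q ⊖ two) ⊕ fromℕ 5)
      (solve 1 (λ q → q :* (q :+ con 1ℚ) := con 1ℚ :+ ((q :- con two) :* (q :- con two)
        :+ con (fromℕ 5) :* (q :- con two) :+ con (fromℕ 5))) refl q)
      (let 0≼q-2 = 0≼-diff (ℚₚ.≤-trans 2≼right h≤q) in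
        0≼q-2 ⊗≼ 0≼q-2 ⊕≼ 0≼ fromℕ 5 by ⊗≼ 0≼q-2 ⊕≼ 0≼ fromℕ 5 by)
    excess+1 : excess (3 +ᴺ (a +ᴺ b)) h ⊕ 1ℚ ≡ A′ ⊕ B′
    excess+1 = trans (cong (λ s → two ⊗ (h ⊗ h) ⊖ (1ℚ ⊕ (1ℚ ⊕ (1ℚ ⊕ s))) ⊕ 1ℚ) (fromℕ-+ a b))
      (solve 3 (λ a b q → con two :* (q :* q) :- (con 1ℚ :+ (con 1ℚ :+ (con 1ℚ :+ (a :+ b)))) :+ con 1ℚ :=
        (q :* q :- (a :+ con 1ℚ)) :+ (q :* q :- (b :+ con 1ℚ))) refl α β h)
    f≺0 : f h ≺ 0ℚ
    f≺0 = product-below-square A′ B′ h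
      (subst (0ℚ ≼_) excess+1 (0≼right ⊕≼ 0≼1))
      (subst (_≼ _) excess+1 (ℚₚ.+-monoˡ-≤ 1ℚ right≼4∙2)) 2≼right
    m = h ⊕ fromℕ (3 +ᴺ (a +ᴺ b))
    m≡ : m ≡ g ⊕ α ⊕ β ⊕ fromℕ 5
    m≡ = trans (cong (λ s → h ⊕ (1ℚ ⊕ (1ℚ ⊕ (1ℚ ⊕ s)))) (fromℕ-+ a b))
      (solve 3 (λ a b h → h :+ (con 1ℚ :+ (con 1ℚ :+ (con 1ℚ :+ (a :+ b)))) :=
        h :- con two :+ a :+ b :+ con (fromℕ 5)) refl α β h)
    0≼g : 0ℚ ≼ g
    0≼g = 0≼-diff 2≼right
    0≼f : 0ℚ ≼ f m
    -- The two factors at m are d + (m + 1) and d′ + (m + 1), so the subtracted square (m + 1)²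
    -- cancels.
    0≼f = subst (λ m → 0ℚ ≼ f m) (sym m≡) (subst (0ℚ ≼_)
      (solve 3 (λ a b g → let k = g :+ a :+ b ; m = k :+ con (fromℕ 5) ; e = m :* k :+ con (fromℕ 3) :* m ; d = e :+ (g :+ b :+ con (fromℕ 3)) ; d′ = e :+ (g :+ a :+ con (fromℕ 3)) in
          d :* d′ :+ (m :+ con 1ℚ) :* (d :+ d′) :=
          (m :* m :- (a :+ con 1ℚ)) :* (m :* m :- (b :+ con 1ℚ)) :- (m :+ con 1ℚ) :* (m :+ con 1ℚ)) refl α β g)
      (let 0≼k = 0≼g ⊕≼ 0≼fromℕ a ⊕≼ 0≼fromℕ b
           0≼m = 0≼k ⊕≼ 0≼ fromℕ 5 by
           0≼e = 0≼m ⊗≼ 0≼k ⊕≼ 0≼ fromℕ 3 by ⊗≼ 0≼m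
           0≼d = 0≼e ⊕≼ (0≼g ⊕≼ 0≼fromℕ b ⊕≼ 0≼ fromℕ 3 by)
           0≼d′ = 0≼e ⊕≼ (0≼g ⊕≼ 0≼fromℕ a ⊕≼ 0≼ fromℕ 3 by)
       in 0≼d ⊗≼ 0≼d′ ⊕≼ (0≼m ⊕≼ 0≼1) ⊗≼ (0≼d ⊕≼ 0≼d′)))

module _ (c : ℕ) where
  open Paw c

  paw-lower : (w : Window (4 +ᴺ c)) → f (Window.right w) ≺ 0ℚ →
    ∀ {n} {G : Graph n} → Blowup G paw (pawSize c) →
    ∀ {r} → IsSpectralRadius G r → fromℚ (Window.right w) ≤ r
  paw-lower w f≺0 B {r} ρ = spectral-radius-lower B f-acts X X-acts defect system {r} ρ
    (bracket h m (right≼right+n h (4 +ᴺ c)) f≺0 0≼f)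
    (proj₁ x) (λ q h≤q → subst (λ c → 1ℚ ≼ X c q) (sym (proj₂ x)) (1≼2q 2≼right h≤q))
    where
    open Window w renaming (right to h)
    open Bisection f
    x = role-witness B 3F refl
    g m : ℚ
    g = h ⊖ two
    m = h ⊕ fromℕ (4 +ᴺ c)
    m≡ : m ≡ g ⊕ γ ⊕ fromℕ 6
    m≡ = solve 2 (λ c h → h :+ (con 1ℚ :+ (con 1ℚ :+ (con 1ℚ :+ (con 1ℚ :+ c)))) :=
        h :- con two :+ c :+ con (fromℕ 6)) refl γ h
    0≼g : 0ℚ ≼ g
    0≼g = 0≼-diff 2≼right
    0≼f : 0ℚ ≼ f m
    -- With m (m - 1) - 2 = e + 2 and m² - c - 1 = d + 1, f m = (e + 2)(d + 1) - 2.
    0≼f = subst (λ m → 0ℚ ≼ f m) (sym m≡) (subst (0ℚ ≼_)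
      (solve 2 (λ c g → let k = g :+ c ; m = k :+ con (fromℕ 6) ; d = m :* k :+ con (fromℕ 5) :* m :+ (g :+ con four) ; e = m :* k :+ con four :* m :+ (k :+ con two) in
          con two :* d :+ e :+ e :* d :=
          m :* (m :- con 1ℚ) :* (m :* m :- (c :+ con 1ℚ)) :- con two :* (m :* m :- c)) refl γ g)
      (let 0≼k = 0≼g ⊕≼ 0≼fromℕ c
           0≼m = 0≼k ⊕≼ 0≼ fromℕ 6 by
           0≼d = 0≼m ⊗≼ 0≼k ⊕≼ 0≼ fromℕ 5 by ⊗≼ 0≼m ⊕≼ (0≼g ⊕≼ 0≼ four by)
           0≼e = 0≼m ⊗≼ 0≼k ⊕≼ 0≼ four by ⊗≼ 0≼m ⊕≼ (0≼k ⊕≼ 0≼ two by)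
       in 0≼ two by ⊗≼ 0≼d ⊕≼ 0≼e ⊕≼ 0≼e ⊗≼ 0≼d))

  -- Put w = h² - c. Then f h = -(1 - w)(h - 2)(h + 1) - 2, which is negative once w ≤ 1. The window
  -- gives w ≤ (8.2 - c)/2, which is at most 0.6 for c ≥ 7.
  paw-large : 7 ≤ᴺ c → (w : Window (4 +ᴺ c)) → f (Window.right w) ≺ 0ℚ
  paw-large 7≤c w = ≺-from-diff ((1ℚ ⊖ (h ⊗ h ⊖ γ)) ⊗ ((h ⊖ two) ⊗ ((h ⊖ two) ⊕ fromℕ 3)) ⊕ two)
    (solve 2 (λ c h → con 0ℚ := h :* (h :- con 1ℚ) :* (h :* h :- (c :+ con 1ℚ)) :- con two :* (h :* h :- c)
      :+ ((con 1ℚ :- (h :* h :- c)) :* ((h :- con two) :* ((h :- con two) :+ con (fromℕ 3))) :+ con two)) refl γ h)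
    (0≼1-w ⊗≼ (0≼-diff 2≼right ⊗≼ (0≼-diff 2≼right ⊕≼ 0≼ fromℕ 3 by)) ⊕≺ 0≺ two by)
    where
    open Window w renaming (right to h)
    0≼1-w : 0ℚ ≼ 1ℚ ⊖ (h ⊗ h ⊖ γ)
    0≼1-w = subst (0ℚ ≼_)
      (solve 2 (λ c h → con ½ :* ((con (+ 42 / 10) :- (con two :* (h :* h) :- (con 1ℚ :+ (con 1ℚ :+ (con 1ℚ :+ (con 1ℚ :+ c))))))
          :+ (c :- con (fromℕ 7)) :+ con (+ 8 / 10)) := con 1ℚ :- (h :* h :- c)) refl γ h)
      (0≼ ½ by ⊗≼ (0≼-diff right≼4∙2 ⊕≼ 0≼-diff (fromℕ-mono 7≤c) ⊕≼ 0≼ + 8 / 10 by))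

explicit-paw-window : ∀ c (left right : ℚ) → {True (two ℚₚ.≤? left)} → {True (left ℚₚ.<? right)} →
  {True ((+ 414 / 100) ℚₚ.≤? excess (4 +ᴺ c) left)} → {True (0ℚ ℚₚ.≤? excess (4 +ᴺ c) right)} →
  {True (excess (4 +ᴺ c) right ℚₚ.≤? (+ 42 / 10))} → {True (Paw.f c right ℚₚ.<? 0ℚ)} →
  Σ[ w ∈ Window (4 +ᴺ c) ] Paw.f c (Window.right w) ≺ 0ℚ
explicit-paw-window c left right {p} {q} {r} {s} {t} {u} = record
  { left = left ; right = right ; 2≼left = toWitness p ; left≺right = toWitness q
  ; 4∙14≼left = toWitness r ; 0≼right = toWitness s ; right≼4∙2 = toWitness t } , toWitness u

-- For c from 2 to 6 the chosen right ends have h² - c > 1, so the sign argument of `paw-large` does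
-- not apply; the endpoints are explicit and all inequalities are decided by evaluation.
paw-window : ∀ c → 6 ≤ᴺ 4 +ᴺ c → Σ[ w ∈ Window (4 +ᴺ c) ] Paw.f c (Window.right w) ≺ 0ℚ
paw-window 0 (ℕ.s≤s (ℕ.s≤s (ℕ.s≤s (ℕ.s≤s ()))))
paw-window 1 (ℕ.s≤s (ℕ.s≤s (ℕ.s≤s (ℕ.s≤s (ℕ.s≤s ())))))
paw-window 2 _ = explicit-paw-window 2 (+ 2256 / 1000) (+ 2258 / 1000)
paw-window 3 _ = explicit-paw-window 3 (+ 2361 / 1000) (+ 2365 / 1000)
paw-window 4 _ = explicit-paw-window 4 (+ 2464 / 1000) (+ 2465 / 1000)
paw-window 5 _ = explicit-paw-window 5 (+ 2564 / 1000) (+ 2565 / 1000)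
paw-window 6 _ = explicit-paw-window 6 (+ 2659 / 1000) (+ 2660 / 1000)
paw-window c@(suc (suc (suc (suc (suc (suc (suc k))))))) 6≤n =
  window (4 +ᴺ c) 6≤n , paw-large c (ℕₚ.m≤m+n 7 k) (window (4 +ᴺ c) 6≤n)

-- The extremal graph as a blow-up

sum-split : ∀ m {n} (f : Fin (m +ᴺ n) → ℕ) →
  ℕΣ.sum f ≡ ℕΣ.sum (λ i → f (i ↑ˡ n)) +ᴺ ℕΣ.sum (λ j → f (m ↑ʳ j))
sum-split zero    f = refl
sum-split (suc m) f = trans (cong (f zero +ᴺ_) (sum-split m (f ∘ suc)))
  (sym (ℕₚ.+-assoc (f zero) _ _))

sum-ones : ∀ n → ℕΣ.sum {n} (const 1) ≡ n
sum-ones zero    = refl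
sum-ones (suc n) = cong suc (sum-ones n)

squareRole : ∀ {a} → Fin (4 +ᴺ a) → Fin 5
squareRole 0F = 0F
squareRole 1F = 1F
squareRole 2F = 0F
squareRole 3F = 2F
squareRole (suc (suc (suc (suc _)))) = 3F

4+-cases : ∀ {a} (P : Fin (4 +ᴺ a) → Set) → P 0F → P 1F → P 2F → P 3F →
  (∀ w → P (suc (suc (suc (suc w))))) → ∀ u → P u
4+-cases P p₀ p₁ p₂ p₃ p 0F = p₀
4+-cases P p₀ p₁ p₂ p₃ p 1F = p₁
4+-cases P p₀ p₁ p₂ p₃ p 2F = p₂
4+-cases P p₀ p₁ p₂ p₃ p 3F = p₃
4+-cases P p₀ p₁ p₂ p₃ p (suc (suc (suc (suc w)))) = p w

G₁-blowup : ∀ a b → Blowup (G₁ a b) square (squareSize a b)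
G₁-blowup a b = record { role = role ; adjacency = adjacency ; sizes = sizes }
  where
  role′ : Fin (4 +ᴺ a) ⊎ Fin b → Fin 5
  role′ = [ squareRole , const 4F ]′
  role : Fin (4 +ᴺ a +ᴺ b) → Fin 5
  role u = role′ (splitAt (4 +ᴺ a) u)
  inner : ∀ u v → adj (attach fourCycle 1F a) u v ≡ square (squareRole u) (squareRole v)
  inner = 4+-cases _
    (4+-cases _ refl refl refl refl λ _ → refl)
    (4+-cases _ refl refl refl refl λ _ → refl)
    (4+-cases _ refl refl refl refl λ _ → refl)
    (4+-cases _ refl refl refl refl λ _ → refl)
    (λ _ → 4+-cases _ refl refl refl refl λ _ → refl)
  outer : ∀ u → does (u ≟ 3F ↑ˡ a) ≡ square (squareRole u) 4F
  outer = 4+-cases _ refl refl refl refl λ _ → refl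
  square-sym : ∀ c d → square c d ≡ square d c
  square-sym = from-yes (Finₚ.all? λ c → Finₚ.all? λ d → square c d ≟ᵇ square d c)
  adjacency : ∀ u v → adj (G₁ a b) u v ≡ square (role u) (role v)
  adjacency u v with splitAt (4 +ᴺ a) u | splitAt (4 +ᴺ a) v
  ... | inj₁ u′ | inj₁ v′ = inner u′ v′
  ... | inj₁ u′ | inj₂ _  = outer u′
  ... | inj₂ _  | inj₁ v′ = trans (outer v′) (square-sym (squareRole v′) 4F)
  ... | inj₂ _  | inj₂ _  = refl
  count≡ : ∀ c → count role c ≡ ℕΣ.sum (λ i → indicator (squareRole {a} i) c) +ᴺ ℕΣ.sum {b} (const (indicator 4F c))
  count≡ c = trans (sum-split (4 +ᴺ a) (λ v → indicator (role v) c)) (cong₂ _+ᴺ_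
    (ℕΣ.sum-cong-≗ λ i → cong (λ s → indicator (role′ s) c) (Finₚ.splitAt-↑ˡ (4 +ᴺ a) i b))
    (ℕΣ.sum-cong-≗ λ j → cong (λ s → indicator (role′ s) c) (Finₚ.splitAt-↑ʳ (4 +ᴺ a) b j)))
  zeros : ∀ n → ℕΣ.sum {n} (const 0) ≡ 0
  zeros = ℕΣ.sum-replicate-zero
  sizes : ∀ c → count role c ≡ squareSize a b c
  sizes 0F = trans (count≡ 0F) (cong₂ (λ s t → suc (suc s) +ᴺ t) (zeros a) (zeros b))
  sizes 1F = trans (count≡ 1F) (cong₂ (λ s t → suc s +ᴺ t) (zeros a) (zeros b))
  sizes 2F = trans (count≡ 2F) (cong₂ (λ s t → suc s +ᴺ t) (zeros a) (zeros b))
  sizes 3F = trans (count≡ 3F) (trans (cong₂ _+ᴺ_ (sum-ones a) (zeros b)) (ℕₚ.+-identityʳ a))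
  sizes 4F = trans (count≡ 4F) (cong₂ _+ᴺ_ (zeros a) (sum-ones b))

-- The reflection of the square that exchanges the two hosts allows a ≤ b to be assumed.
swap-sides : ∀ {n a b} {G : Graph n} → Blowup G square (squareSize a b) → Blowup G square (squareSize b a)
swap-sides {a = a} {b} B = record
  { role      = λ u → τ (role u)
  ; adjacency = λ u v → trans (adjacency u v) (automorphism (role u) (role v))
  ; sizes     = λ c → trans (ℕΣ.sum-cong-≗ λ v → indicator-τ (role v) c) (trans (sizes (τ c)) (size-τ c))
  }
  where
  open Blowup B
  τ : Fin 5 → Fin 5
  τ 0F = 0F
  τ 1F = 2F
  τ 2F = 1F
  τ 3F = 4F
  τ 4F = 3F
  automorphism : ∀ c d → square c d ≡ square (τ c) (τ d)
  automorphism = from-yes (Finₚ.all? λ c → Finₚ.all? λ d → square c d ≟ᵇ square (τ c) (τ d))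
  indicator-τ : ∀ c d → indicator (τ c) d ≡ indicator c (τ d)
  indicator-τ = from-yes (Finₚ.all? λ c → Finₚ.all? λ d → indicator (τ c) d ℕₚ.≟ indicator c (τ d))
  size-τ : ∀ c → squareSize a b (τ c) ≡ squareSize b a c
  size-τ 0F = refl
  size-τ 1F = refl
  size-τ 2F = refl
  size-τ 3F = refl
  size-τ 4F = refl

-- Structure of the graphs in `𝒰 n 2`

sum-indicator-* : ∀ {k} c (g : Fin k → ℕ) → ℕΣ.sum (λ d → indicator c d *ᴺ g d) ≡ g c
sum-indicator-* {suc k} zero    g = trans (cong₂ _+ᴺ_ (ℕₚ.+-identityʳ (g zero)) (ℕΣ.sum-replicate-zero k))
  (ℕₚ.+-identityʳ (g zero))
sum-indicator-* {suc k} (suc c) g = sum-indicator-* c (g ∘ suc)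

Injective : ∀ {m n} → (Fin m → Fin n) → Set
Injective F = ∀ {i j} → F i ≡ F j → i ≡ j

Outside : ∀ {m n} → (Fin m → Fin n) → Fin n → Set
Outside F u = ∀ i → u ≢ F i

outside? : ∀ {m n} (F : Fin m → Fin n) u → (∃[ i ] u ≡ F i) ⊎ Outside F u
outside? F u with Finₚ.any? (λ i → u ≟ F i)
... | yes inside = inj₁ inside
... | no ¬inside = inj₂ λ i eq → ¬inside (i , eq)

-- Pendant vertices of type t are attached to the vertex core (host t). The role
-- map κ on the core need not be injective, so that twins can share a role.
module CoreWithPendants {n k p K} (G : Graph n)
  (core : Fin k → Fin n) (core-injective : Injective core) (host : Fin p → Fin k)
  (pendant : ∀ u → Outside core u → Σ[ t ∈ Fin p ] ∀ i → adj G u (core i) ≡ does (i ≟ host t))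
  (independent : ∀ u v → Outside core u → Outside core v → adj G u v ≡ false)
  (Q : Fin K → Fin K → Bool) (Q-sym : ∀ c d → Q c d ≡ Q d c) (κ : Fin k → Fin K) (π : Fin p → Fin K)
  (Q-core : ∀ i j → adj G (core i) (core j) ≡ Q (κ i) (κ j))
  (Q-pendant : ∀ t i → Q (π t) (κ i) ≡ does (i ≟ host t))
  (Q-pendants : ∀ s t → Q (π s) (π t) ≡ false)
  where

  role′ : ∀ {u} → (∃[ i ] u ≡ core i) ⊎ Outside core u → Fin K
  role′     (inj₁ (i , _)) = κ i
  role′ {u} (inj₂ out)     = π (proj₁ (pendant u out))

  role : Fin n → Fin K
  role u = role′ (outside? core u)

  adjacency′ : ∀ {u v} (x : (∃[ i ] u ≡ core i) ⊎ Outside core u) (y : (∃[ i ] v ≡ core i) ⊎ Outside core v) →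
    adj G u v ≡ Q (role′ x) (role′ y)
  adjacency′ (inj₁ (i , refl)) (inj₁ (j , refl)) = Q-core i j
  adjacency′ {v = v} (inj₁ (i , refl)) (inj₂ out) = trans (Graph.symm G (core i) v)
    (trans (proj₂ (pendant v out) i) (trans (sym (Q-pendant (proj₁ (pendant v out)) i)) (Q-sym _ (κ i))))
  adjacency′ {u = u} (inj₂ out) (inj₁ (j , refl)) =
    trans (proj₂ (pendant u out) j) (sym (Q-pendant (proj₁ (pendant u out)) j))
  adjacency′ (inj₂ out) (inj₂ out′) = trans (independent _ _ out out′) (sym (Q-pendants _ _))

  adjacency : ∀ u v → adj G u v ≡ Q (role u) (role v)
  adjacency u v = adjacency′ (outside? core u) (outside? core v)

  -- Double counting: the indicator of role `c` at a vertex is expanded over the core labels and the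
  -- sums are exchanged. Injectivity of `core` makes each label count one vertex.
  core-count : ∀ c → (∀ t → π t ≢ c) → count role c ≡ ℕΣ.sum (λ i → indicator (κ i) c)
  core-count c πt≢c = trans (ℕΣ.sum-cong-≗ λ v → expand (outside? core v))
    (trans (ℕΣ.∑-comm (λ v i → indicator (core i) v *ᴺ indicator (κ i) c))
      (ℕΣ.sum-cong-≗ λ i → trans (sym (ℕΣ.*-distribʳ-sum (indicator (κ i) c) (indicator (core i))))
        (trans (cong (_*ᴺ indicator (κ i) c) (sum-indicator (core i))) (ℕₚ.+-identityʳ _))))
    where
    indicator-core : ∀ i j → indicator (core j) (core i) ≡ indicator i j
    indicator-core i j with i ≟ j
    ... | yes refl = indicator-refl (core i)
    ... | no i≢j   = indicator-≢ λ eq → i≢j (sym (core-injective eq))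
    expand : ∀ {v} (x : (∃[ i ] v ≡ core i) ⊎ Outside core v) →
      indicator (role′ x) c ≡ ℕΣ.sum (λ i → indicator (core i) v *ᴺ indicator (κ i) c)
    expand (inj₁ (i , refl)) = sym (trans
      (ℕΣ.sum-cong-≗ λ j → cong (_*ᴺ indicator (κ j) c) (indicator-core i j))
      (sum-indicator-* i (λ j → indicator (κ j) c)))
    expand {v} (inj₂ out) = trans (indicator-≢ (πt≢c _)) (sym (trans
      (ℕΣ.sum-cong-≗ λ i → cong (_*ᴺ indicator (κ i) c) (indicator-≢ {c = core i} {v} λ eq → out i (sym eq)))
      (ℕΣ.sum-replicate-zero k)))

unique⇒injective : ∀ {n} {xs : List (Fin n)} → Unique xs → Injective (List.lookup xs)
unique⇒injective (_ ∷ _)   {zero}  {zero}  _  = refl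
unique⇒injective {xs = _ ∷ xs} (x∉ ∷ _) {zero}  {suc j} eq = ⊥-elim (All.lookup x∉ (∈-lookup {xs = xs} j) eq)
unique⇒injective {xs = _ ∷ xs} (x∉ ∷ _) {suc i} {zero}  eq = ⊥-elim (All.lookup x∉ (∈-lookup {xs = xs} i) (sym eq))
unique⇒injective (_ ∷ u)   {suc i} {suc j} eq = cong suc (unique⇒injective u eq)

▹-injective : ∀ {m n} {u : Fin n} {F : Fin m → Fin n} → Outside F u → Injective F → Injective (u ▹ F)
▹-injective out inj {zero}  {zero}  _  = refl
▹-injective out inj {zero}  {suc j} eq = ⊥-elim (out j eq)
▹-injective out inj {suc i} {zero}  eq = ⊥-elim (out i (sym eq))
▹-injective out inj {suc i} {suc j} eq = cong suc (inj eq)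

▹-outside : ∀ {m n} {u v : Fin n} {F : Fin m → Fin n} → v ≢ u → Outside F v → Outside (u ▹ F) v
▹-outside v≢u out zero    = v≢u
▹-outside v≢u out (suc i) = out i

-- The order is stored as an equation so that matching on `refl` turns `n` into the index of the
-- corresponding `Window` lemma.
data Shape (n : ℕ) (G : Graph n) : Set where
  square-shape   : ∀ a b → 4 +ᴺ (a +ᴺ b) ≡ n → Blowup G square (squareSize a b) → Shape n G
  triangle-shape : ∀ a b → 3 +ᴺ (a +ᴺ b) ≡ n → Blowup G triangle (triangleSize a b) → Shape n G
  paw-shape      : ∀ c → 4 +ᴺ c ≡ n → Blowup G paw (pawSize c) → Shape n G

blowup-order : ∀ {n k} {G : Graph n} {Q : Fin k → Fin k → Bool} {size} → Blowup G Q size → ℕΣ.sum size ≡ n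
blowup-order B = trans (sym (ℕΣ.sum-cong-≗ (Blowup.sizes B))) (sum-count (Blowup.role B))

-- Vertices are named by labels: F sends the labels to distinct vertices, and the
-- distinctness of vertices is decided on their labels.
module Classification {n} (G : Graph n) (connected : Connected G) (6≤n : 6 ≤ᴺ n)
  (matching≤2 : ∀ M → IsMatching G M → length M ≤ᴺ 2)
  (cycle-edges : List (Fin n × Fin n))
  (only : ∀ (d : Cycle G) u v → Cycle.HasEdge d u v → (u , v) ∈ cycle-edges ⊎ (v , u) ∈ cycle-edges)
  where

  adj-sym : ∀ {u v} → Adj G u v → Adj G v u
  adj-sym {u} {v} uv = trans (Graph.symm G v u) uv

  ¬loop : ∀ {u v} → Adj G u v → u ≢ v
  ¬loop {u} uv refl = case trans (sym uv) (Graph.irrefl G u) of λ ()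

  ¬adj : ∀ {u v} → ¬ Adj G u v → adj G u v ≡ false
  ¬adj = ¬-not

  neighbour : ∀ {u v} → u ≢ v → ∃[ w ] Adj G u w
  neighbour {u} {v} u≢v with connected u v
  ... | Star.ε    = ⊥-elim (u≢v refl)
  ... | step ◅ _ = _ , step

  -- A walk from a named vertex to `v` has a first step that leaves the image of `F`.
  boundary-edge : ∀ {m} (F : Fin m → Fin n) i {v} → Outside F v →
    ∃[ j ] ∃[ w ] Outside F w × Adj G (F j) w
  boundary-edge F i {v} out = go i refl (connected (F i) v)
    where
    go : ∀ i {u} → u ≡ F i → Star (Adj G) u v → ∃[ j ] ∃[ w ] Outside F w × Adj G (F j) w
    go i refl Star.ε = ⊥-elim (out i refl)
    go i refl (_◅_ {j = w} step rest) with outside? F w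
    ... | inj₁ (j , eq) = go j eq rest
    ... | inj₂ out-w    = i , w , out-w , step

  -- Pigeonhole: if every vertex had a label, choosing labels would inject `Fin n` into `Fin m`.
  outside-vertex : ∀ {m} (F : Fin m → Fin n) → m ℕ.< n → ∃[ v ] Outside F v
  outside-vertex {m} F m<n with Finₚ.any? (λ v → ¬? (Finₚ.any? (λ i → v ≟ F i)))
  ... | yes (v , ¬inside) = v , λ i eq → ¬inside (i , eq)
  ... | no none = ⊥-elim (ℕₚ.<⇒≱ m<n (Finₚ.injective⇒≤ {f = λ v → proj₁ (inside v)} λ {u} {v} eq →
      trans (proj₂ (inside u)) (trans (cong F eq) (sym (proj₂ (inside v))))))
    where
    inside : ∀ v → ∃[ i ] v ≡ F i
    inside v with outside? F v
    ... | inj₁ found = found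
    ... | inj₂ out   = ⊥-elim (none (v , λ (i , eq) → out i eq))

  no-3-matching : ∀ {m} {F : Fin m → Fin n} → Injective F → ∀ a b c d e f →
    {_ : True (unique? _≟_ (a ∷ b ∷ c ∷ d ∷ e ∷ f ∷ []))} →
    Adj G (F a) (F b) → Adj G (F c) (F d) → Adj G (F e) (F f) → ⊥
  no-3-matching {F = F} inj a b c d e f {t} ab cd ef
    with toWitness t
  ... | (_ ∷ ac ∷ ad ∷ ae ∷ af ∷ []) ∷ (bc ∷ bd ∷ be ∷ bf ∷ []) ∷ (_ ∷ ce ∷ cf ∷ []) ∷ (de ∷ df ∷ []) ∷ _
    with matching≤2 ((F a , F b) ∷ (F c , F d) ∷ (F e , F f) ∷ []) (record
      { edges    = ab ∷ cd ∷ ef ∷ []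
      ; disjoint = ((ac ∘ inj , ad ∘ inj , bc ∘ inj , bd ∘ inj) ∷ (ae ∘ inj , af ∘ inj , be ∘ inj , bf ∘ inj) ∷ [])
          ∷ ((ce ∘ inj , cf ∘ inj , de ∘ inj , df ∘ inj) ∷ []) ∷ [] ∷ []
      })
  ... | s≤s (s≤s ())

  relabel : ∀ {m} → (Fin m → Fin n) → Fin m × Fin m → Fin n × Fin n
  relabel F (i , j) = F i , F j

  module _ {m : ℕ} where
    open DecMembership (≡-dec (_≟_ {m}) (_≟_ {m})) using (_∈?_) public

  edge-on-cycle : ∀ {m} {F : Fin m → Fin n} → Injective F → ∀ L → cycle-edges ≡ List.map (relabel F) L →
    ∀ {a b} → (F a , F b) ∈ cycle-edges → (a , b) ∈ L
  edge-on-cycle {F = F} inj L eq {a} {b} ab∈ with ∈-map⁻ (relabel F) (subst ((F a , F b) ∈_) eq ab∈)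
  ... | (i , j) , ij∈L , ab≡ij =
    subst (_∈ L) (sym (cong₂ _,_ (inj (cong proj₁ ab≡ij)) (inj (cong proj₂ ab≡ij)))) ij∈L

  -- Only the edge ab is tested against `L`: one edge off the given cycle already makes the triangle
  -- a second cycle. Each use therefore lists such an edge first; likewise for `no-square`.
  no-triangle : ∀ {m} {F : Fin m → Fin n} → Injective F → ∀ L → cycle-edges ≡ List.map (relabel F) L →
    ∀ a b c → {_ : True (unique? _≟_ (a ∷ b ∷ c ∷ []))} →
    {_ : False ((a , b) ∈? L)} → {_ : False ((b , a) ∈? L)} →
    Adj G (F a) (F b) → Adj G (F b) (F c) → Adj G (F c) (F a) → ⊥
  no-triangle {F = F} inj L eq a b c {t} {p} {q} ab bc ca
    with only (record { start = F a ; rest = F b ∷ F c ∷ [] ; length≥3 = s≤s (s≤s (s≤s z≤n))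
                      ; distinct = Uniqueₚ.map⁺ inj (toWitness t) ; adjacent = ab ∷ bc ∷ ca ∷ [] })
              (F a) (F b) (inj₁ (here refl))
  ... | inj₁ ab∈ = toWitnessFalse p (edge-on-cycle inj L eq ab∈)
  ... | inj₂ ba∈ = toWitnessFalse q (edge-on-cycle inj L eq ba∈)

  no-square : ∀ {m} {F : Fin m → Fin n} → Injective F → ∀ L → cycle-edges ≡ List.map (relabel F) L →
    ∀ a b c d → {_ : True (unique? _≟_ (a ∷ b ∷ c ∷ d ∷ []))} →
    {_ : False ((a , b) ∈? L)} → {_ : False ((b , a) ∈? L)} →
    Adj G (F a) (F b) → Adj G (F b) (F c) → Adj G (F c) (F d) → Adj G (F d) (F a) → ⊥
  no-square {F = F} inj L eq a b c d {t} {p} {q} ab bc cd da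
    with only (record { start = F a ; rest = F b ∷ F c ∷ F d ∷ [] ; length≥3 = s≤s (s≤s (s≤s z≤n))
                      ; distinct = Uniqueₚ.map⁺ inj (toWitness t) ; adjacent = ab ∷ bc ∷ cd ∷ da ∷ [] })
              (F a) (F b) (inj₁ (here refl))
  ... | inj₁ ab∈ = toWitnessFalse p (edge-on-cycle inj L eq ab∈)
  ... | inj₂ ba∈ = toWitnessFalse q (edge-on-cycle inj L eq ba∈)

  only-host : ∀ {m} {F : Fin m → Fin n} {u} i → Adj G u (F i) → (∀ j → Adj G u (F j) → j ≡ i) →
    ∀ j → adj G u (F j) ≡ does (j ≟ i)
  only-host {F = F} i ui unique j with j ≟ i
  ... | yes refl = ui
  ... | no j≢i   = ¬adj λ uj → j≢i (unique j uj)

  module SquareCase {F : Fin 4 → Fin n} (inj : Injective F)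
    (01# : Adj G (F 0F) (F 1F)) (12# : Adj G (F 1F) (F 2F)) (23# : Adj G (F 2F) (F 3F)) (30# : Adj G (F 3F) (F 0F))
    (edges≡ : cycle-edges ≡ List.map (relabel F) ((0F , 1F) ∷ (1F , 2F) ∷ (2F , 3F) ∷ (3F , 0F) ∷ []))
    where

    L : List (Fin 4 × Fin 4)
    L = (0F , 1F) ∷ (1F , 2F) ∷ (2F , 3F) ∷ (3F , 0F) ∷ []

    -- Putting a new vertex in front of `F` shifts the labels of the cycle by one. The relabelled
    -- edges stay definitionally the same, which is why `edges≡` is reused as it stands.
    L↑ : List (Fin 5 × Fin 5)
    L↑ = (1F , 2F) ∷ (2F , 3F) ∷ (3F , 4F) ∷ (4F , 1F) ∷ []

    02̸ : ¬ Adj G (F 0F) (F 2F)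
    02̸ 02# = no-triangle inj L edges≡ 0F 2F 1F 02# (adj-sym 12#) (adj-sym 01#)

    13̸ : ¬ Adj G (F 1F) (F 3F)
    13̸ 13# = no-triangle inj L edges≡ 1F 3F 2F 13# (adj-sym 23#) (adj-sym 12#)

    core : ∀ i j → adj G (F i) (F j) ≡ adj fourCycle i j
    core 0F 0F = Graph.irrefl G (F 0F)
    core 0F 1F = 01#
    core 0F 2F = ¬adj 02̸
    core 0F 3F = adj-sym 30#
    core 1F 0F = adj-sym 01#
    core 1F 1F = Graph.irrefl G (F 1F)
    core 1F 2F = 12#
    core 1F 3F = ¬adj 13̸
    core 2F 0F = ¬adj (02̸ ∘ adj-sym)
    core 2F 1F = adj-sym 12#
    core 2F 2F = Graph.irrefl G (F 2F)
    core 2F 3F = 23#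
    core 3F 0F = 30#
    core 3F 1F = ¬adj (13̸ ∘ adj-sym)
    core 3F 2F = adj-sym 23#
    core 3F 3F = Graph.irrefl G (F 3F)

    ¬outside-edge : ∀ {u v} → Outside F u → Outside F v → ¬ Adj G u v
    ¬outside-edge out-u out-v uv = no-3-matching
      (▹-injective (▹-outside (¬loop uv) out-u) (▹-injective out-v inj)) 0F 1F 2F 3F 4F 5F uv 01# 23#

    host : ∀ u → Outside F u → ∃[ i ] Adj G u (F i)
    host u out with neighbour (out 0F)
    ... | v , uv with outside? F v
    ...   | inj₁ (i , refl) = i , uv
    ...   | inj₂ out-v      = ⊥-elim (¬outside-edge out out-v uv)

    -- Adjacent hosts would close a triangle and opposite hosts a square, each through an edge at
    -- `u`, which is off the given cycle.
    host-unique : ∀ {u} → Outside F u → ∀ i j → Adj G u (F i) → Adj G u (F j) → i ≡ j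
    host-unique {u} out = go
      where
      inj′ = ▹-injective out inj
      eq′ : cycle-edges ≡ List.map (relabel (u ▹ F)) L↑
      eq′ = edges≡
      go : ∀ i j → Adj G u (F i) → Adj G u (F j) → i ≡ j
      go 0F 0F _ _ = refl
      go 1F 1F _ _ = refl
      go 2F 2F _ _ = refl
      go 3F 3F _ _ = refl
      go 0F 1F p q = ⊥-elim (no-triangle inj′ L↑ eq′ 0F 1F 2F p 01# (adj-sym q))
      go 1F 2F p q = ⊥-elim (no-triangle inj′ L↑ eq′ 0F 2F 3F p 12# (adj-sym q))
      go 2F 3F p q = ⊥-elim (no-triangle inj′ L↑ eq′ 0F 3F 4F p 23# (adj-sym q))
      go 3F 0F p q = ⊥-elim (no-triangle inj′ L↑ eq′ 0F 4F 1F p 30# (adj-sym q))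
      go 0F 2F p q = ⊥-elim (no-square inj′ L↑ eq′ 0F 1F 2F 3F p 01# 12# (adj-sym q))
      go 1F 3F p q = ⊥-elim (no-square inj′ L↑ eq′ 0F 2F 3F 4F p 12# 23# (adj-sym q))
      go 1F 0F p q = sym (go 0F 1F q p)
      go 2F 1F p q = sym (go 1F 2F q p)
      go 3F 2F p q = sym (go 2F 3F q p)
      go 0F 3F p q = sym (go 3F 0F q p)
      go 2F 0F p q = sym (go 0F 2F q p)
      go 3F 1F p q = sym (go 1F 3F q p)

    -- Pendant edges at two adjacent vertices of the square, together with the side opposite to
    -- them, would be a matching of size 3.
    same-side : ∀ {u v} → Outside F u → Outside F v → ∀ i j → Adj G u (F i) → Adj G v (F j) →
      adj fourCycle i j ≢ true
    same-side {u} {v} out-u out-v i j ui vj ij = go i j ij ui vj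
      where
      u≢v : u ≢ v
      u≢v refl with host-unique out-u i j ui vj
      ... | refl = case trans (sym ij) (Graph.irrefl fourCycle i) of λ ()
      inj′ = ▹-injective (▹-outside u≢v out-u) (▹-injective out-v inj)
      go : ∀ i j → adj fourCycle i j ≡ true → Adj G u (F i) → Adj G v (F j) → ⊥
      go 0F 1F _ p q = no-3-matching inj′ 0F 2F 1F 3F 4F 5F p q 23#
      go 1F 0F _ p q = no-3-matching inj′ 0F 3F 1F 2F 4F 5F p q 23#
      go 1F 2F _ p q = no-3-matching inj′ 0F 3F 1F 4F 5F 2F p q 30#
      go 2F 1F _ p q = no-3-matching inj′ 0F 4F 1F 3F 5F 2F p q 30#
      go 2F 3F _ p q = no-3-matching inj′ 0F 4F 1F 5F 2F 3F p q 01#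
      go 3F 2F _ p q = no-3-matching inj′ 0F 5F 1F 4F 2F 3F p q 01#
      go 3F 0F _ p q = no-3-matching inj′ 0F 5F 1F 2F 3F 4F p q 12#
      go 0F 3F _ p q = no-3-matching inj′ 0F 2F 1F 5F 3F 4F p q 12#
      go 0F 0F () _ _
      go 0F 2F () _ _
      go 1F 1F () _ _
      go 1F 3F () _ _
      go 2F 0F () _ _
      go 2F 2F () _ _
      go 3F 1F () _ _
      go 3F 3F () _ _

    module _ (hosts : Fin 2 → Fin 4) (κ : Fin 4 → Fin 5)
      (on-hosts : ∀ u → Outside F u → ∃[ t ] Adj G u (F (hosts t)))
      where

      π : Fin 2 → Fin 5
      π 0F = 3F
      π 1F = 4F

      square-from : (∀ i j → adj fourCycle i j ≡ square (κ i) (κ j)) →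
        (∀ t i → square (π t) (κ i) ≡ does (i ≟ hosts t)) →
        (∀ c → ℕΣ.sum (λ i → indicator (κ i) c) ≡ squareSize 0 0 c) → Shape n G
      square-from Q-core Q-pendant core-sizes = square-shape a b
        -- Summing `squareSize` ends in b + 0, which has to be rewritten to `b`.
        (trans (cong (λ t → 4 +ᴺ (a +ᴺ t)) (sym (ℕₚ.+-identityʳ b))) (blowup-order blowup)) blowup
        where
        module P = CoreWithPendants G F inj hosts
          (λ u out → proj₁ (on-hosts u out) , only-host (hosts (proj₁ (on-hosts u out))) (proj₂ (on-hosts u out))
            λ j uj → host-unique out j _ uj (proj₂ (on-hosts u out)))
          (λ u v out-u out-v → ¬adj (¬outside-edge out-u out-v))
          square (from-yes (Finₚ.all? λ c → Finₚ.all? λ d → square c d ≟ᵇ square d c)) κ π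
          (λ i j → trans (core i j) (Q-core i j)) Q-pendant
          (from-yes (Finₚ.all? λ s → Finₚ.all? λ t → square (π s) (π t) ≟ᵇ false))
        a = count P.role 3F
        b = count P.role 4F
        sizes : ∀ c → count P.role c ≡ squareSize a b c
        sizes 0F = trans (P.core-count 0F λ { 0F () ; 1F () }) (core-sizes 0F)
        sizes 1F = trans (P.core-count 1F λ { 0F () ; 1F () }) (core-sizes 1F)
        sizes 2F = trans (P.core-count 2F λ { 0F () ; 1F () }) (core-sizes 2F)
        sizes 3F = refl
        sizes 4F = refl
        blowup : Blowup G square (squareSize a b)
        blowup = record { role = P.role ; adjacency = P.adjacency ; sizes = sizes }

    even odd : Fin 2 → Fin 4
    even 0F = 0F
    even 1F = 2F
    odd 0F = 1F
    odd 1F = 3F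

    κ-even κ-odd : Fin 4 → Fin 5
    κ-even 0F = 1F
    κ-even 1F = 0F
    κ-even 2F = 2F
    κ-even 3F = 0F
    κ-odd 0F = 0F
    κ-odd 1F = 1F
    κ-odd 2F = 0F
    κ-odd 3F = 2F

    -- Non-adjacency in the 4-cycle is an equivalence relation whose classes are the two opposite
    -- pairs, so `same-side` confines all hosts to one class.
    parity : ∀ i j → adj fourCycle i j ≢ true → (∃[ t ] i ≡ even t × ∃[ s ] j ≡ even s) ⊎ (∃[ t ] i ≡ odd t × ∃[ s ] j ≡ odd s)
    parity 0F 0F _ = inj₁ (0F , refl , 0F , refl)
    parity 0F 2F _ = inj₁ (0F , refl , 1F , refl)
    parity 2F 0F _ = inj₁ (1F , refl , 0F , refl)
    parity 2F 2F _ = inj₁ (1F , refl , 1F , refl)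
    parity 1F 1F _ = inj₂ (0F , refl , 0F , refl)
    parity 1F 3F _ = inj₂ (0F , refl , 1F , refl)
    parity 3F 1F _ = inj₂ (1F , refl , 0F , refl)
    parity 3F 3F _ = inj₂ (1F , refl , 1F , refl)
    parity 0F 1F h = ⊥-elim (h refl)
    parity 0F 3F h = ⊥-elim (h refl)
    parity 1F 0F h = ⊥-elim (h refl)
    parity 1F 2F h = ⊥-elim (h refl)
    parity 2F 1F h = ⊥-elim (h refl)
    parity 2F 3F h = ⊥-elim (h refl)
    parity 3F 0F h = ⊥-elim (h refl)
    parity 3F 2F h = ⊥-elim (h refl)

    even≢odd : ∀ s t → even s ≢ odd t
    even≢odd 0F 0F ()
    even≢odd 0F 1F ()
    even≢odd 1F 0F ()
    even≢odd 1F 1F ()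

    -- Since n > 4, some vertex `w` lies off the square; its host selects the opposite pair that
    -- carries every pendant vertex.
    shape : Shape n G
    shape with outside-vertex F (ℕₚ.≤-trans (ℕₚ.n≤1+n 5) 6≤n)
    ... | w , out-w with host w out-w
    ...   | i , wi with parity i i (λ ii → same-side out-w out-w i i wi wi ii)
    ...     | inj₁ (t , refl , _) = square-from even κ-even on-even
              (from-yes (Finₚ.all? λ i → Finₚ.all? λ j → adj fourCycle i j ≟ᵇ square (κ-even i) (κ-even j)))
              (λ { 0F → λ { 0F → refl ; 1F → refl ; 2F → refl ; 3F → refl }
                 ; 1F → λ { 0F → refl ; 1F → refl ; 2F → refl ; 3F → refl } })
              (λ { 0F → refl ; 1F → refl ; 2F → refl ; 3F → refl ; 4F → refl })
      where
      on-even : ∀ u → Outside F u → ∃[ t ] Adj G u (F (even t))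
      on-even u out with host u out
      ... | j , uj with parity (even t) j (λ h → same-side out-w out (even t) j wi uj h)
      ...   | inj₁ (_ , _ , s , refl) = s , uj
      ...   | inj₂ (s , eq , _)       = ⊥-elim (even≢odd t s eq)
    ...     | inj₂ (t , refl , _) = square-from odd κ-odd on-odd
              (from-yes (Finₚ.all? λ i → Finₚ.all? λ j → adj fourCycle i j ≟ᵇ square (κ-odd i) (κ-odd j)))
              (λ { 0F → λ { 0F → refl ; 1F → refl ; 2F → refl ; 3F → refl }
                 ; 1F → λ { 0F → refl ; 1F → refl ; 2F → refl ; 3F → refl } })
              (λ { 0F → refl ; 1F → refl ; 2F → refl ; 3F → refl ; 4F → refl })
      where
      on-odd : ∀ u → Outside F u → ∃[ t ] Adj G u (F (odd t))
      on-odd u out with host u out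
      ... | j , uj with parity (odd t) j (λ h → same-side out-w out (odd t) j wi uj h)
      ...   | inj₂ (_ , _ , s , refl) = s , uj
      ...   | inj₁ (s , eq , _)       = ⊥-elim (even≢odd s t (sym eq))

  module TriangleCase {F : Fin 3 → Fin n} (inj : Injective F)
    (01# : Adj G (F 0F) (F 1F)) (12# : Adj G (F 1F) (F 2F)) (20# : Adj G (F 2F) (F 0F))
    (edges≡ : cycle-edges ≡ List.map (relabel F) ((0F , 1F) ∷ (1F , 2F) ∷ (2F , 0F) ∷ []))
    where

    L↑ : List (Fin 4 × Fin 4)
    L↑ = (1F , 2F) ∷ (2F , 3F) ∷ (3F , 1F) ∷ []

    L↑↑ : List (Fin 5 × Fin 5)
    L↑↑ = (2F , 3F) ∷ (3F , 4F) ∷ (4F , 2F) ∷ []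

    core : ∀ i j → adj G (F i) (F j) ≡ not (does (i ≟ j))
    core 0F 0F = Graph.irrefl G (F 0F)
    core 0F 1F = 01#
    core 0F 2F = adj-sym 20#
    core 1F 0F = adj-sym 01#
    core 1F 1F = Graph.irrefl G (F 1F)
    core 1F 2F = 12#
    core 2F 0F = 20#
    core 2F 1F = adj-sym 12#
    core 2F 2F = Graph.irrefl G (F 2F)

    host-unique : ∀ {u} → Outside F u → ∀ i j → Adj G u (F i) → Adj G u (F j) → i ≡ j
    host-unique {u} out = go
      where
      inj′ = ▹-injective out inj
      eq′ : cycle-edges ≡ List.map (relabel (u ▹ F)) L↑
      eq′ = edges≡
      go : ∀ i j → Adj G u (F i) → Adj G u (F j) → i ≡ j
      go 0F 0F _ _ = refl
      go 1F 1F _ _ = refl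
      go 2F 2F _ _ = refl
      go 0F 1F p q = ⊥-elim (no-triangle inj′ L↑ eq′ 0F 1F 2F p 01# (adj-sym q))
      go 1F 2F p q = ⊥-elim (no-triangle inj′ L↑ eq′ 0F 2F 3F p 12# (adj-sym q))
      go 2F 0F p q = ⊥-elim (no-triangle inj′ L↑ eq′ 0F 3F 1F p 20# (adj-sym q))
      go 1F 0F p q = sym (go 0F 1F q p)
      go 2F 1F p q = sym (go 1F 2F q p)
      go 0F 2F p q = sym (go 2F 0F q p)

    module Depth1 (¬outside-edge : ∀ {u v} → Outside F u → Outside F v → ¬ Adj G u v) where

      host : ∀ u → Outside F u → ∃[ i ] Adj G u (F i)
      host u out with neighbour (out 0F)
      ... | v , uv with outside? F v
      ...   | inj₁ (i , refl) = i , uv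
      ...   | inj₂ out-v      = ⊥-elim (¬outside-edge out out-v uv)

      HasPendant : Fin 3 → Set
      HasPendant i = ∃[ u ] Outside F u × Adj G u (F i)

      pendant? : ∀ i → Dec (HasPendant i)
      pendant? i = Finₚ.any? λ u → Finₚ.all? (λ j → ¬? (u ≟ F j)) ×-dec (adj G u (F i) ≟ᵇ true)

      module _ (hosts : Fin 2 → Fin 3) (κ : Fin 3 → Fin 5)
        (on-hosts : ∀ u → Outside F u → ∃[ t ] Adj G u (F (hosts t)))
        where

        π : Fin 2 → Fin 5
        π 0F = 3F
        π 1F = 4F

        triangle-from : (∀ i j → not (does (i ≟ j)) ≡ triangle (κ i) (κ j)) →
          (∀ t i → triangle (π t) (κ i) ≡ does (i ≟ hosts t)) →
          (∀ c → ℕΣ.sum (λ i → indicator (κ i) c) ≡ triangleSize 0 0 c) → Shape n G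
        triangle-from Q-core Q-pendant core-sizes = triangle-shape a b
          (trans (cong (λ t → 3 +ᴺ (a +ᴺ t)) (sym (ℕₚ.+-identityʳ b))) (blowup-order blowup)) blowup
          where
          module P = CoreWithPendants G F inj hosts
            (λ u out → proj₁ (on-hosts u out) , only-host (hosts (proj₁ (on-hosts u out))) (proj₂ (on-hosts u out))
              λ j uj → host-unique out j _ uj (proj₂ (on-hosts u out)))
            (λ u v out-u out-v → ¬adj (¬outside-edge out-u out-v))
            triangle (from-yes (Finₚ.all? λ c → Finₚ.all? λ d → triangle c d ≟ᵇ triangle d c)) κ π
            (λ i j → trans (core i j) (Q-core i j)) Q-pendant
            (from-yes (Finₚ.all? λ s → Finₚ.all? λ t → triangle (π s) (π t) ≟ᵇ false))
          a = count P.role 3F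
          b = count P.role 4F
          sizes : ∀ c → count P.role c ≡ triangleSize a b c
          sizes 0F = trans (P.core-count 0F λ { 0F () ; 1F () }) (core-sizes 0F)
          sizes 1F = trans (P.core-count 1F λ { 0F () ; 1F () }) (core-sizes 1F)
          sizes 2F = trans (P.core-count 2F λ { 0F () ; 1F () }) (core-sizes 2F)
          sizes 3F = refl
          sizes 4F = refl
          blowup : Blowup G triangle (triangleSize a b)
          blowup = record { role = P.role ; adjacency = P.adjacency ; sizes = sizes }

      hosts₀ hosts₁ hosts₂ : Fin 2 → Fin 3
      hosts₀ 0F = 1F
      hosts₀ 1F = 2F
      hosts₁ 0F = 0F
      hosts₁ 1F = 2F
      hosts₂ 0F = 0F
      hosts₂ 1F = 1F

      κ₀ κ₁ κ₂ : Fin 3 → Fin 5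
      κ₀ 0F = 0F
      κ₀ 1F = 1F
      κ₀ 2F = 2F
      κ₁ 0F = 1F
      κ₁ 1F = 0F
      κ₁ 2F = 2F
      κ₂ 0F = 1F
      κ₂ 1F = 2F
      κ₂ 2F = 0F

      avoid₀ : ¬ HasPendant 0F → ∀ u → Outside F u → ∃[ t ] Adj G u (F (hosts₀ t))
      avoid₀ none u out with host u out
      ... | 0F , u0 = ⊥-elim (none (u , out , u0))
      ... | 1F , u1 = 0F , u1
      ... | 2F , u2 = 1F , u2

      avoid₁ : ¬ HasPendant 1F → ∀ u → Outside F u → ∃[ t ] Adj G u (F (hosts₁ t))
      avoid₁ none u out with host u out
      ... | 0F , u0 = 0F , u0
      ... | 1F , u1 = ⊥-elim (none (u , out , u1))
      ... | 2F , u2 = 1F , u2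

      avoid₂ : ¬ HasPendant 2F → ∀ u → Outside F u → ∃[ t ] Adj G u (F (hosts₂ t))
      avoid₂ none u out with host u out
      ... | 0F , u0 = 0F , u0
      ... | 1F , u1 = 1F , u1
      ... | 2F , u2 = ⊥-elim (none (u , out , u2))

      -- Pendant edges at all three vertices of the triangle would be a matching of size 3, so one
      -- vertex is free and takes role 0F.
      shape : Shape n G
      shape with pendant? 0F | pendant? 1F | pendant? 2F
      ... | no none | _ | _ = triangle-from hosts₀ κ₀ (avoid₀ none)
        (from-yes (Finₚ.all? λ i → Finₚ.all? λ j → not (does (i ≟ j)) ≟ᵇ triangle (κ₀ i) (κ₀ j)))
        (λ { 0F → λ { 0F → refl ; 1F → refl ; 2F → refl } ; 1F → λ { 0F → refl ; 1F → refl ; 2F → refl } })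
        (λ { 0F → refl ; 1F → refl ; 2F → refl ; 3F → refl ; 4F → refl })
      ... | _ | no none | _ = triangle-from hosts₁ κ₁ (avoid₁ none)
        (from-yes (Finₚ.all? λ i → Finₚ.all? λ j → not (does (i ≟ j)) ≟ᵇ triangle (κ₁ i) (κ₁ j)))
        (λ { 0F → λ { 0F → refl ; 1F → refl ; 2F → refl } ; 1F → λ { 0F → refl ; 1F → refl ; 2F → refl } })
        (λ { 0F → refl ; 1F → refl ; 2F → refl ; 3F → refl ; 4F → refl })
      ... | _ | _ | no none = triangle-from hosts₂ κ₂ (avoid₂ none)
        (from-yes (Finₚ.all? λ i → Finₚ.all? λ j → not (does (i ≟ j)) ≟ᵇ triangle (κ₂ i) (κ₂ j)))
        (λ { 0F → λ { 0F → refl ; 1F → refl ; 2F → refl } ; 1F → λ { 0F → refl ; 1F → refl ; 2F → refl } })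
        (λ { 0F → refl ; 1F → refl ; 2F → refl ; 3F → refl ; 4F → refl })
      ... | yes (u , out-u , u0) | yes (v , out-v , v1) | yes (w , out-w , w2) = ⊥-elim (no-3-matching
        (▹-injective (▹-outside u≢v (▹-outside u≢w out-u)) (▹-injective (▹-outside v≢w out-v) (▹-injective out-w inj)))
        0F 3F 1F 4F 2F 5F u0 v1 w2)
        where
        u≢v : u ≢ v
        u≢v refl = case host-unique out-u 0F 1F u0 v1 of λ ()
        u≢w : u ≢ w
        u≢w refl = case host-unique out-u 0F 2F u0 w2 of λ ()
        v≢w : v ≢ w
        v≢w refl = case host-unique out-v 1F 2F v1 w2 of λ ()

    module Depth2 {u w} (out-u : Outside F u) (out-w : Outside F w) (uw : Adj G u w) (i : Fin 3) (ui : Adj G u (F i)) where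

      -- An edge disjoint from the triangle and from `u` would be a third matching edge besides the
      -- edge from `u` to the triangle and the triangle side it misses. So every edge off the
      -- triangle meets `u`, the hub.
      avoiding-triangle : ∀ {x y} → Adj G x y → Outside F x → Outside F y → x ≢ u → y ≢ u → ⊥
      avoiding-triangle {x} {y} xy out-x out-y x≢u y≢u = go i ui
        where
        inj′ = ▹-injective (▹-outside (¬loop xy) (▹-outside x≢u out-x)) (▹-injective (▹-outside y≢u out-y) (▹-injective out-u inj))
        go : ∀ i → Adj G u (F i) → ⊥
        go 0F ui = no-3-matching inj′ 0F 1F 2F 3F 4F 5F xy ui 12#
        go 1F ui = no-3-matching inj′ 0F 1F 2F 4F 5F 3F xy ui 20#
        go 2F ui = no-3-matching inj′ 0F 1F 2F 5F 3F 4F xy ui 01#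

      w≢u : w ≢ u
      w≢u eq = ¬loop uw (sym eq)

      -- Otherwise `w`, `u` and one or two vertices of the triangle form another cycle, through the
      -- edge wu.
      ¬triangle-w : ∀ j → ¬ Adj G w (F j)
      ¬triangle-w j = go i j ui
        where
        inj′ = ▹-injective (▹-outside w≢u out-w) (▹-injective out-u inj)
        eq′ : cycle-edges ≡ List.map (relabel (w ▹ u ▹ F)) L↑↑
        eq′ = edges≡
        wu = adj-sym uw
        go : ∀ i j → Adj G u (F i) → Adj G w (F j) → ⊥
        go 0F 0F p q = no-triangle inj′ L↑↑ eq′ 0F 1F 2F wu p (adj-sym q)
        go 1F 1F p q = no-triangle inj′ L↑↑ eq′ 0F 1F 3F wu p (adj-sym q)
        go 2F 2F p q = no-triangle inj′ L↑↑ eq′ 0F 1F 4F wu p (adj-sym q)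
        go 0F 1F p q = no-square inj′ L↑↑ eq′ 0F 1F 2F 3F wu p 01# (adj-sym q)
        go 0F 2F p q = no-square inj′ L↑↑ eq′ 0F 1F 2F 4F wu p (adj-sym 20#) (adj-sym q)
        go 1F 0F p q = no-square inj′ L↑↑ eq′ 0F 1F 3F 2F wu p (adj-sym 01#) (adj-sym q)
        go 1F 2F p q = no-square inj′ L↑↑ eq′ 0F 1F 3F 4F wu p 12# (adj-sym q)
        go 2F 0F p q = no-square inj′ L↑↑ eq′ 0F 1F 4F 2F wu p 20# (adj-sym q)
        go 2F 1F p q = no-square inj′ L↑↑ eq′ 0F 1F 4F 3F wu p (adj-sym 12#) (adj-sym q)

      -- For y ≠ w, the edge from `y` to the triangle, the edge uw and the side of the triangle
      -- missed by `y` would be a matching of size 3.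
      ¬triangle : ∀ {y} → Outside F y → y ≢ u → ∀ j → ¬ Adj G y (F j)
      ¬triangle {y} out-y y≢u j yj with y ≟ w
      ... | yes refl = ¬triangle-w j yj
      ... | no y≢w   = go j yj
        where
        inj′ = ▹-injective (▹-outside y≢u (▹-outside y≢w out-y)) (▹-injective (▹-outside (¬loop uw) out-u) (▹-injective out-w inj))
        go : ∀ j → Adj G y (F j) → ⊥
        go 0F yj = no-3-matching inj′ 0F 3F 1F 2F 4F 5F yj uw 12#
        go 1F yj = no-3-matching inj′ 0F 4F 1F 2F 5F 3F yj uw 20#
        go 2F yj = no-3-matching inj′ 0F 5F 1F 2F 3F 4F yj uw 01#

      core′ : Fin 4 → Fin n
      core′ = u ▹ F

      pendant : ∀ y → Outside core′ y → ∀ j → adj G y (core′ j) ≡ does (j ≟ 0F)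
      pendant y out = only-host {F = core′} 0F yu λ { 0F _ → refl ; (suc j) yj → ⊥-elim (¬triangle (out ∘ suc) (out 0F) j yj) }
        where
        yu : Adj G y u
        yu with neighbour (out 0F)
        ... | x , yx with outside? core′ x
        ...   | inj₁ (0F , refl)    = yx
        ...   | inj₁ (suc j , refl) = ⊥-elim (¬triangle (out ∘ suc) (out 0F) j yx)
        ...   | inj₂ out-x          = ⊥-elim (avoiding-triangle yx (out ∘ suc) (out-x ∘ suc) (out 0F) (out-x 0F))

      module _ (κ : Fin 4 → Fin 5) where

        paw-from : (∀ j → does (j ≟ i) ≡ paw (κ 0F) (κ (suc j))) → paw (κ 0F) (κ 0F) ≡ false →
          (∀ j k → not (does (j ≟ k)) ≡ paw (κ (suc j)) (κ (suc k))) →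
          (∀ j → paw 4F (κ j) ≡ does (j ≟ 0F)) →
          (∀ c → ℕΣ.sum (λ i → indicator (κ i) c) ≡ pawSize 0 c) → Shape n G
        paw-from Q-hub Q-hub-hub Q-triangle Q-pendant core-sizes = paw-shape c
          (trans (cong (4 +ᴺ_) (sym (ℕₚ.+-identityʳ c))) (blowup-order blowup)) blowup
          where
          paw-sym : ∀ c d → paw c d ≡ paw d c
          paw-sym = from-yes (Finₚ.all? λ c → Finₚ.all? λ d → paw c d ≟ᵇ paw d c)
          Q-core : ∀ j k → adj G (core′ j) (core′ k) ≡ paw (κ j) (κ k)
          Q-core 0F 0F = trans (Graph.irrefl G u) (sym Q-hub-hub)
          Q-core 0F (suc k) = trans (only-host i ui (λ j uj → host-unique out-u j i uj ui) k) (Q-hub k)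
          Q-core (suc j) 0F = trans (Graph.symm G (F j) u) (trans (Q-core 0F (suc j)) (paw-sym (κ 0F) (κ (suc j))))
          Q-core (suc j) (suc k) = trans (core j k) (Q-triangle j k)
          module P = CoreWithPendants {p = 1} G core′ (▹-injective out-u inj) (const 0F)
            (λ y out → 0F , pendant y out)
            (λ x y out-x out-y → ¬adj λ xy →
              avoiding-triangle xy (out-x ∘ suc) (out-y ∘ suc) (out-x 0F) (out-y 0F))
            paw paw-sym κ (const 4F) Q-core (const Q-pendant) (λ _ _ → refl)
          c = count P.role 4F
          sizes : ∀ d → count P.role d ≡ pawSize c d
          sizes 0F = trans (P.core-count 0F λ { 0F () }) (core-sizes 0F)
          sizes 1F = trans (P.core-count 1F λ { 0F () }) (core-sizes 1F)
          sizes 2F = trans (P.core-count 2F λ { 0F () }) (core-sizes 2F)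
          sizes 3F = trans (P.core-count 3F λ { 0F () }) (core-sizes 3F)
          sizes 4F = refl
          blowup : Blowup G paw (pawSize c)
          blowup = record { role = P.role ; adjacency = P.adjacency ; sizes = sizes }

    κ₀ κ₁ κ₂ : Fin 4 → Fin 5
    κ₀ 0F = 3F
    κ₀ 1F = 0F
    κ₀ 2F = 1F
    κ₀ 3F = 2F
    κ₁ 0F = 3F
    κ₁ 1F = 1F
    κ₁ 2F = 0F
    κ₁ 3F = 2F
    κ₂ 0F = 3F
    κ₂ 1F = 1F
    κ₂ 2F = 2F
    κ₂ 3F = 0F

    hub-shape : ∀ {u w} → Outside F u → Outside F w → Adj G u w → ∀ i → Adj G u (F i) → Shape n G
    hub-shape out-u out-w uw 0F ui = Depth2.paw-from out-u out-w uw 0F ui κ₀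
      (λ { 0F → refl ; 1F → refl ; 2F → refl }) refl
      (from-yes (Finₚ.all? λ j → Finₚ.all? λ k → not (does (j ≟ k)) ≟ᵇ paw (κ₀ (suc j)) (κ₀ (suc k))))
      (λ { 0F → refl ; 1F → refl ; 2F → refl ; 3F → refl })
      (λ { 0F → refl ; 1F → refl ; 2F → refl ; 3F → refl ; 4F → refl })
    hub-shape out-u out-w uw 1F ui = Depth2.paw-from out-u out-w uw 1F ui κ₁
      (λ { 0F → refl ; 1F → refl ; 2F → refl }) refl
      (from-yes (Finₚ.all? λ j → Finₚ.all? λ k → not (does (j ≟ k)) ≟ᵇ paw (κ₁ (suc j)) (κ₁ (suc k))))
      (λ { 0F → refl ; 1F → refl ; 2F → refl ; 3F → refl })
      (λ { 0F → refl ; 1F → refl ; 2F → refl ; 3F → refl ; 4F → refl })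
    hub-shape out-u out-w uw 2F ui = Depth2.paw-from out-u out-w uw 2F ui κ₂
      (λ { 0F → refl ; 1F → refl ; 2F → refl }) refl
      (from-yes (Finₚ.all? λ j → Finₚ.all? λ k → not (does (j ≟ k)) ≟ᵇ paw (κ₂ (suc j)) (κ₂ (suc k))))
      (λ { 0F → refl ; 1F → refl ; 2F → refl ; 3F → refl })
      (λ { 0F → refl ; 1F → refl ; 2F → refl ; 3F → refl ; 4F → refl })

    outside-dec : ∀ u → Dec (Outside F u)
    outside-dec u = Finₚ.all? λ i → ¬? (u ≟ F i)

    -- If an edge uw lies off the triangle, connectedness supplies an edge from the triangle to some
    -- outside `y`. Were `y` neither `u` nor `w`, this edge, uw and the opposite side of the
    -- triangle would be a matching; so `y` is the hub.
    shape : Shape n G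
    shape with Finₚ.any? (λ u → Finₚ.any? λ w → outside-dec u ×-dec outside-dec w ×-dec (adj G u w ≟ᵇ true))
    ... | no none = Depth1.shape λ {u} {w} out-u out-w uw → none (u , w , out-u , out-w , uw)
    ... | yes (u , w , out-u , out-w , uw) with boundary-edge F 0F out-u
    ...   | i , y , out-y , iy with y ≟ u | y ≟ w
    ...     | yes refl | _        = hub-shape out-u out-w uw i (adj-sym iy)
    ...     | no _     | yes refl = hub-shape out-w out-u (adj-sym uw) i (adj-sym iy)
    ...     | no y≢u   | no y≢w   = ⊥-elim (go i (adj-sym iy))
      where
      inj′ = ▹-injective (▹-outside y≢u (▹-outside y≢w out-y)) (▹-injective (▹-outside (¬loop uw) out-u) (▹-injective out-w inj))
      go : ∀ j → Adj G y (F j) → ⊥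
      go 0F yj = no-3-matching inj′ 0F 3F 1F 2F 4F 5F yj uw 12#
      go 1F yj = no-3-matching inj′ 0F 4F 1F 2F 5F 3F yj uw 20#
      go 2F yj = no-3-matching inj′ 0F 5F 1F 2F 3F 4F yj uw 01#

  -- As n ≥ 6, some vertex outside is adjacent to the pentagon. Removing its neighbour leaves a path
  -- on four vertices, whose two end edges complete a matching of size 3.
  ¬pentagon : {F : Fin 5 → Fin n} → Injective F → Adj G (F 0F) (F 1F) → Adj G (F 1F) (F 2F) →
    Adj G (F 2F) (F 3F) → Adj G (F 3F) (F 4F) → Adj G (F 4F) (F 0F) → ⊥
  ¬pentagon {F} inj 01# 12# 23# 34# 40# with outside-vertex F 6≤n
  ... | v , out-v with boundary-edge F 0F out-v
  ...   | i , y , out-y , iy = go i (adj-sym iy)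
    where
    inj′ = ▹-injective out-y inj
    go : ∀ i → Adj G y (F i) → ⊥
    go 0F yi = no-3-matching inj′ 0F 1F 2F 3F 4F 5F yi 12# 34#
    go 1F yi = no-3-matching inj′ 0F 2F 3F 4F 5F 1F yi 23# 40#
    go 2F yi = no-3-matching inj′ 0F 3F 4F 5F 1F 2F yi 34# 01#
    go 3F yi = no-3-matching inj′ 0F 4F 5F 1F 2F 3F yi 40# 12#
    go 4F yi = no-3-matching inj′ 0F 5F 1F 2F 3F 4F yi 01# 23#

shape : ∀ {n} (G : Graph n) → 6 ≤ᴺ n → 𝒰 n 2 G → Shape n G
shape G 6≤n ((connected , record { rest = [] ; length≥3 = s≤s () } , _) , _)
shape G 6≤n ((connected , record { rest = _ ∷ [] ; length≥3 = s≤s (s≤s ()) } , _) , _)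
shape G 6≤n ((connected , cycle@(record { start = s ; rest = a ∷ b ∷ [] ; distinct = u ; adjacent = sa ∷ ab ∷ bs ∷ [] }) , same) , _ , ≤2) =
  TriangleCase.shape (unique⇒injective u) sa ab bs refl
  where open Classification G connected 6≤n ≤2 (Cycle.steps cycle) (λ d u v → Equivalence.from (same d u v))
shape G 6≤n ((connected , cycle@(record { start = s ; rest = a ∷ b ∷ c ∷ [] ; distinct = u ; adjacent = sa ∷ ab ∷ bc ∷ cs ∷ [] }) , same) , _ , ≤2) =
  SquareCase.shape (unique⇒injective u) sa ab bc cs refl
  where open Classification G connected 6≤n ≤2 (Cycle.steps cycle) (λ d u v → Equivalence.from (same d u v))
shape G 6≤n ((connected , cycle@(record { start = s ; rest = a ∷ b ∷ c ∷ d ∷ [] ; distinct = u ; adjacent = sa ∷ ab ∷ bc ∷ cd ∷ ds ∷ [] }) , same) , _ , ≤2) =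
  ⊥-elim (¬pentagon (unique⇒injective u) sa ab bc cd ds)
  where open Classification G connected 6≤n ≤2 (Cycle.steps cycle) (λ d u v → Equivalence.from (same d u v))
-- On a cycle with at least six vertices, alternate edges already form a matching of size 3.
shape G 6≤n ((connected , cycle@(record { start = s ; rest = a ∷ b ∷ c ∷ d ∷ e ∷ rest ; distinct = u ; adjacent = sa ∷ ab ∷ bc ∷ cd ∷ de ∷ _ }) , same) , _ , ≤2) =
  ⊥-elim (no-3-matching (unique⇒injective u) 0F 1F 2F 3F 4F 5F sa bc de)
  where open Classification G connected 6≤n ≤2 (Cycle.steps cycle) (λ d u v → Equivalence.from (same d u v))

-- Comparison with the extremal graph

balanced-halves : ∀ a b → a ≤ᴺ b → b ≤ᴺ suc a → a ≡ ⌊ a +ᴺ b /2⌋ × b ≡ ⌈ a +ᴺ b /2⌉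
balanced-halves a b a≤b b≤1+a with ℕₚ.m≤n⇒m<n∨m≡n a≤b
... | inj₂ refl = ℕₚ.n≡⌊n+n/2⌋ a , ℕₚ.n≡⌈n+n/2⌉ a
... | inj₁ a<b with ℕₚ.≤-antisym b≤1+a a<b
...   | refl = trans (ℕₚ.n≡⌈n+n/2⌉ a) (cong ⌊_/2⌋ (sym (ℕₚ.+-suc a a)))
             , trans (cong suc (ℕₚ.n≡⌊n+n/2⌋ a)) (cong ⌈_/2⌉ (sym (ℕₚ.+-suc a a)))

module Comparison (n : ℕ) (6≤n : 6 ≤ᴺ n) {G : Graph n} (r s : ℝ) (ρ : IsSpectralRadius G r)
  (σ : IsSpectralRadius (G₁ ⌊ n ∸ 4 /2⌋ ⌈ n ∸ 4 /2⌉) s) where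

  Conclusion : Set
  Conclusion = s ≤ r × (r ≈ s ⇔ G ≅ G₁ ⌊ n ∸ 4 /2⌋ ⌈ n ∸ 4 /2⌉)

  target-order : 4 +ᴺ (⌊ n ∸ 4 /2⌋ +ᴺ ⌈ n ∸ 4 /2⌉) ≡ n
  target-order = trans (cong (4 +ᴺ_) (ℕₚ.⌊n/2⌋+⌈n/2⌉≡n (n ∸ 4)))
    (ℕₚ.m+[n∸m]≡n (ℕₚ.≤-trans (ℕₚ.m≤m+n 4 2) 6≤n))

  target-upper : (w : Window n) → s ≤ fromℚ (Window.left w)
  target-upper = go target-order
    where
    a≤b : ⌊ n ∸ 4 /2⌋ ≤ᴺ ⌈ n ∸ 4 /2⌉
    a≤b = ℕₚ.⌊n/2⌋≤⌈n/2⌉ (n ∸ 4)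
    ⌈⌉≤1+⌊⌋ : ∀ m → ⌈ m /2⌉ ≤ᴺ suc ⌊ m /2⌋
    ⌈⌉≤1+⌊⌋ m = ℕₚ.⌊n/2⌋-mono (ℕₚ.n≤1+n (suc m))
    -- The sizes themselves mention n ∸ 4, so the order is generalised to `m` before matching on
    -- `refl`.
    go : ∀ {m} → 4 +ᴺ (⌊ n ∸ 4 /2⌋ +ᴺ ⌈ n ∸ 4 /2⌉) ≡ m → (w : Window m) → s ≤ fromℚ (Window.left w)
    go refl w = balanced-square-upper _ _ a≤b (⌈⌉≤1+⌊⌋ (n ∸ 4)) w (G₁-blowup _ _) {s} σ

  -- The strict gap refutes `r ≈ s`, so the forward implication is vacuous; the backward one is
  -- invariance of the spectral radius under isomorphism.
  separated : (w : Window n) → fromℚ (Window.right w) ≤ r → Conclusion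
  separated w right≤r = ≤-trans {s} {fromℚ left} {r} s≤left
      (≤-trans {fromℚ left} {fromℚ right} {r}
        (λ ε 0<ε → 0 , λ _ _ → ℚₚ.<-trans left≺right (≺-from-diff ε refl 0<ε)) right≤r)
    , mk⇔ (λ r≈s → ⊥-elim (≺⇒⋡ left≺right (fromℚ-cancel-≤
            (≤-trans {fromℚ right} {r} {fromℚ left} right≤r
              (≤-trans {r} {s} {fromℚ left} (≈⇒≤ {r} {s} r≈s) s≤left)))))
          (λ G≅H → spectral-radius-≅ G≅H {r} {s} ρ σ)
    where
    open Window w
    s≤left = target-upper w

  isomorphic : G ≅ G₁ ⌊ n ∸ 4 /2⌋ ⌈ n ∸ 4 /2⌉ → Conclusion
  isomorphic G≅H = ≈⇒≤ {s} {r} (≈-sym {r} {s} r≈s) , mk⇔ (λ _ → G≅H) (λ _ → r≈s)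
    where
    r≈s = spectral-radius-≅ G≅H {r} {s} ρ σ

  square-case : ∀ {a b} → a ≤ᴺ b → 4 +ᴺ (a +ᴺ b) ≡ n → Blowup G square (squareSize a b) → Conclusion
  square-case {a} {b} a≤b refl B with b ℕₚ.≤? suc a
  ... | no b≰1+a = let w = window n 6≤n in
    separated w (unbalanced-square-lower a b (ℕₚ.≰⇒> b≰1+a) w B {r} ρ)
  ... | yes b≤1+a with balanced-halves a b a≤b b≤1+a
  ...   | a≡ , b≡ = isomorphic (blowup-≅ (subst₂ (λ a b → Blowup G square (squareSize a b)) a≡ b≡ B) (G₁-blowup _ _))

  conclusion : Shape n G → Conclusion
  conclusion (square-shape a b eq B) with ℕₚ.≤-total a b
  ... | inj₁ a≤b = square-case a≤b eq B
  ... | inj₂ b≤a = square-case b≤a (trans (cong (4 +ᴺ_) (ℕₚ.+-comm b a)) eq) (swap-sides B)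
  conclusion (triangle-shape a b refl B) = let w = window n 6≤n in separated w (triangle-lower a b w B {r} ρ)
  conclusion (paw-shape c refl B) = let w , f≺0 = paw-window c 6≤n in separated w (paw-lower c w f≺0 B {r} ρ)

theorem2p1 : (n : ℕ) → 6 ≤ᴺ n → (G : Graph n) → 𝒰 n 2 G →
    (r s : ℝ) → IsSpectralRadius G r →
    IsSpectralRadius (G₁ ⌊ n ∸ 4 /2⌋ ⌈ n ∸ 4 /2⌉) s →
    s ≤ r × (r ≈ s ⇔ G ≅ G₁ ⌊ n ∸ 4 /2⌋ ⌈ n ∸ 4 /2⌉)
theorem2p1 n 6≤n G G∈𝒰 r s ρ σ = Comparison.conclusion n 6≤n {G} r s ρ σ (shape G 6≤n G∈𝒰)
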